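{- Let $p\ge q\ge 0$ be integers with $p+q\ge 1$, and let $S_1,\dots,S_{p+q}$ be the basis matrices of an $m$-dimensional representation $\rho$ of $R_{p,q}=C_p\otimes C_q$ on $W=\mathbb{R}^m$. Let $Q(w)=(S_1[w],\dots,S_{p+q}[w])$ and $\tilde P(w)=\sum_{i=1}^pS_i[w]^2-\sum_{i=p+1}^{p+q}S_i[w]^2$. The following four conditions are equivalent: (i) the quadratic mapping $Q$ is degenerate; (ii) the Clifford quartic form $\tilde P(w)$ vanishes identically; (iii) there exist linear forms $f_1(w),\dots,f_{p+q}(w)$ on $W$, not all of which are $0$, satisfying the identity $\sum_{i=1}^{p+q}S_i[w]f_i(w)\equiv 0$; (iv) $(p,q,m)$ is one of $(2,1,2),(3,1,4),(5,1,8),(9,1,16),(2,2,4),(3,3,8),(5,5,16)$, or $(p,q)=(1,1)$ and $S_1=\pm S_2$.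
   Context: $C_r$ denotes the real Clifford algebra of the positive definite quadratic form in $r$ variables (generators $e_1,\dots,e_r$, $e_i^2=1$, $e_ie_j=-e_je_i$ for $i\ne j$; $C_0=\mathbb{R}$). $R_{p,q}=C_p\otimes_{\mathbb{R}}C_q$ (ordinary, ungraded tensor product) with $e_1,\dots,e_p$ the generators of $C_p$ and $e_{p+1},\dots,e_{p+q}$ those of $C_q$. Representations $\rho:R_{p,q}\to M(m;\mathbb{R})$ are unital, with $m\ge1$, and (after replacing by an equivalent one) are always taken so that the matrices $S_i=\rho(e_i)$ are symmetric; $S_1,\dots,S_{p+q}$ are called the basis matrices of $\rho$. Thus $S_i^2=1_m$, $S_iS_j=-S_jS_i$ if $i\neq j$ are both $\le p$ or both $>p$, and $S_iS_j=S_jS_i$ if exactly one of $i,j$ is $\le p$. For a symmetric matrix $S$, $S[w]={}^tw\,S\,w$. $P(v)=\sum_{i\le p}v_i^2-\sum_{i>p}v_i^2$, so $\tilde P=P\circ Q$; $\tilde P$ is called the Clifford quartic form associated with $\rho$. $Q$ is called non-degenerate if, regarding it as a polynomial map $\mathbb{C}^m\to\mathbb{C}^{p+q}$, the open set $\{w\in\mathbb{C}^m:P(Q(w))\neq0\}$ is non-empty and the differential of $Q$ has rank $p+q$ at every point of this set; otherwise $Q$ is degenerate. -}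

module Defs where

open import Level using (Level; _⊔_) renaming (suc to lsuc)
open import Algebra.Bundles using (CommutativeRing; RawRing)
open import Algebra.Module.Bundles using (RawLeftModule)
open import Algebra.Module.Construct.TensorUnit using () renaming (rawLeftModule to asModule)
open import Algebra.Module.Morphism.Structures using (module LeftModuleMorphisms)
open import Algebra.Morphism.Structures using (module RingMorphisms)
open import Data.Bool.Base using (if_then_else_)
open import Data.Fin.Base using (Fin; zero; suc; _↑ˡ_; _↑ʳ_)
open import Data.Fin.Properties using (_≟_)
open import Data.List.Base using (List; []; _∷_; [_]; _++_; cartesianProductWith)
import Data.List.Base as List
open import Data.List.Membership.Propositional using (_∈_)
open import Data.Nat.Base as ℕ using (ℕ)
open import Data.Product.Base using (∃; _×_; _,_; map₁; proj₁; proj₂)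
open import Data.Sum.Base using (_⊎_)
open import Data.Vec.Functional as Vector using (Vector)
open import Data.Vec.Functional.Relation.Binary.Pointwise using (Pointwise)
open import Relation.Binary.Core using (Rel)
open import Relation.Binary.PropositionalEquality.Core using (_≡_; refl; _≢_)
open import Relation.Binary.Structures using (IsStrictTotalOrder)
open import Relation.Nullary.Decidable.Core using (does)
open import Relation.Nullary.Negation.Core using (¬_)
open import Relation.Unary using (Pred; Satisfiable)

private
  variable
    a b c k ℓ ℓ₁ ℓ₂ : Level

------------------------------------------------------------------------
-- The real numbers, characterised (classically: up to unique isomorphism)
-- as a Dedekind-complete totally ordered field.

record Reals c ℓ₁ ℓ₂ : Set (lsuc (c ⊔ ℓ₁ ⊔ ℓ₂)) where
  infix 4 _<_ _≤_
  field
    commutativeRing : CommutativeRing c ℓ₁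

  open CommutativeRing commutativeRing public

  field
    _<_                : Rel Carrier ℓ₂
    isStrictTotalOrder : IsStrictTotalOrder _≈_ _<_
    0<1                : 0# < 1#
    +-monoˡ-<          : ∀ z {x y} → x < y → x + z < y + z
    *-pos              : ∀ {x y} → 0# < x → 0# < y → 0# < x * y
    inverse            : ∀ x → ¬ (x ≈ 0#) → ∃ λ y → x * y ≈ 1#

  _≤_ : Rel Carrier ℓ₂
  x ≤ y = ¬ (y < x)

  UpperBound : ∀ {ℓ} → Pred Carrier ℓ → Pred Carrier (c ⊔ ℓ₂ ⊔ ℓ)
  UpperBound A u = ∀ x → A x → x ≤ u

  field
    supremum : (A : Pred Carrier (c ⊔ ℓ₁ ⊔ ℓ₂)) →
               Satisfiable A → Satisfiable (UpperBound A) →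
               ∃ λ s → UpperBound A s × (∀ u → UpperBound A u → s ≤ u)

------------------------------------------------------------------------
-- The complex numbers a + b i, as pairs (a , b)

Complex : RawRing c ℓ → RawRing c ℓ
Complex R = record
  { Carrier = Carrier × Carrier
  ; _≈_     = λ (x , y) (x′ , y′) → x ≈ x′ × y ≈ y′
  ; _+_     = λ (x , y) (x′ , y′) → x + x′ , y + y′
  ; _*_     = λ (x , y) (x′ , y′) → x * x′ + - (y * y′) , x * y′ + y * x′
  ; -_      = λ (x , y) → - x , - y
  ; 0#      = 0# , 0#
  ; 1#      = 1# , 0#
  }
  where open RawRing R

------------------------------------------------------------------------
-- Unital associative algebras: the operations only

record RawAlgebra (R : RawRing c ℓ₁) a ℓ : Set (c ⊔ lsuc (a ⊔ ℓ)) where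
  infixr 7 _•_
  field
    rawRing : RawRing a ℓ

  open RawRing rawRing public

  field
    _•_ : RawRing.Carrier R → Carrier → Carrier

  rawLeftModule : RawLeftModule (RawRing.Carrier R) a ℓ
  rawLeftModule = record
    { Carrierᴹ = Carrier
    ; _≈ᴹ_     = _≈_
    ; _+ᴹ_     = _+_
    ; _*ₗ_     = _•_
    ; 0ᴹ       = 0#
    ; -ᴹ_      = -_
    }

module _ {R : RawRing c ℓ₁} (A : RawAlgebra R a ℓ) (B : RawAlgebra R b ℓ₂) where
  private
    module A = RawAlgebra A
    module B = RawAlgebra B

  record IsAlgebraHomomorphism (f : A.Carrier → B.Carrier) :
                               Set (c ⊔ a ⊔ ℓ ⊔ b ⊔ ℓ₂) where
    open RingMorphisms A.rawRing B.rawRing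
    open LeftModuleMorphisms A.rawLeftModule B.rawLeftModule
    field
      isRingHomomorphism       : IsRingHomomorphism f
      isLeftModuleHomomorphism : IsLeftModuleHomomorphism f

------------------------------------------------------------------------
-- Vectors, matrices, and quadratic maps given by tuples of matrices

module LinearAlgebra (K : RawRing k ℓ) where
  open RawRing K
  open import Algebra.Definitions.RawMonoid +-rawMonoid public using (sum)

  infix 4 _≋_ _≋ₘ_
  infix 7 _·_ _*ᵥ_
  infix 8 _⟦_⟧

  _≋_ : ∀ {n} → Rel (Vector Carrier n) ℓ
  _≋_ = Pointwise _≈_

  vectors : ℕ → RawLeftModule Carrier k ℓ
  vectors n = record
    { Carrierᴹ = Vector Carrier n
    ; _≈ᴹ_     = _≋_
    ; _+ᴹ_     = λ v w i → v i + w i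
    ; _*ₗ_     = λ x v i → x * v i
    ; 0ᴹ       = λ _ → 0#
    ; -ᴹ_      = λ v i → - v i
    }

  IsLinearForm : ∀ {n} → (Vector Carrier n → Carrier) → Set (k ⊔ ℓ)
  IsLinearForm {n} = IsLeftModuleHomomorphism
    where open LeftModuleMorphisms (vectors n) (asModule {R = K})

  _·_ : ∀ {n} → Vector Carrier n → Vector Carrier n → Carrier
  v · w = sum (λ i → v i * w i)

  combination : ∀ {r n} → Vector Carrier r → Vector (Vector Carrier n) r → Vector Carrier n
  combination x v i = sum (λ j → x j * v j i)

  LinearlyIndependent : ∀ {r n} → Vector (Vector Carrier n) r → Set (k ⊔ ℓ)
  LinearlyIndependent v = ∀ x → combination x v ≋ (λ _ → 0#) → x ≋ (λ _ → 0#)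

  -- For a linear map L: the vectors L (h 0), …, L (h (r - 1)) form a basis of
  -- the image of L, i.e. the image has dimension r.
  HasRank : ∀ {m n} → (Vector Carrier m → Vector Carrier n) → ℕ → Set (k ⊔ ℓ)
  HasRank {m} L r = ∃ λ (h : Vector (Vector Carrier m) r) →
    LinearlyIndependent (λ j → L (h j)) ×
    (∀ w → ∃ λ x → L w ≋ combination x (λ j → L (h j)))

  Matrix : ℕ → Set k
  Matrix m = Vector (Vector Carrier m) m

  _≋ₘ_ : ∀ {m} → Rel (Matrix m) ℓ
  _≋ₘ_ = Pointwise _≋_

  matrices : ℕ → RawAlgebra K k ℓ
  matrices m = record
    { rawRing = record
      { Carrier = Matrix m
      ; _≈_     = _≋ₘ_
      ; _+_     = λ S T i j → S i j + T i j
      ; _*_     = λ S T i j → sum (λ l → S i l * T l j)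
      ; -_      = λ S i j → - S i j
      ; 0#      = λ _ _ → 0#
      ; 1#      = λ i j → if does (i ≟ j) then 1# else 0#
      }
    ; _•_ = λ x S i j → x * S i j
    }

  Symmetric : ∀ {m} → Matrix m → Set ℓ
  Symmetric S = ∀ i j → S i j ≈ S j i

  _*ᵥ_ : ∀ {m} → Matrix m → Vector Carrier m → Vector Carrier m
  (S *ᵥ w) i = S i · w

  _⟦_⟧ : ∀ {m} → Matrix m → Vector Carrier m → Carrier
  S ⟦ w ⟧ = w · (S *ᵥ w)

  quadraticMap : ∀ {m n} → Vector (Matrix m) n → Vector Carrier m → Vector Carrier n
  quadraticMap S w i = S i ⟦ w ⟧

  -- The part of quadraticMap S (w + h) which is linear in h.
  differential : ∀ {m n} → Vector (Matrix m) n →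
                 Vector Carrier m → Vector Carrier m → Vector Carrier n
  differential S w h i = h · (S i *ᵥ w) + w · (S i *ᵥ h)

  P : ∀ p q → Vector Carrier (p ℕ.+ q) → Carrier
  P p q v = sum (λ i → v (i ↑ˡ q) * v (i ↑ˡ q)) + - sum (λ j → v (p ↑ʳ j) * v (p ↑ʳ j))

------------------------------------------------------------------------
-- Clifford algebras: the unital R-algebra presented by generators e i with
-- e i * e i = 1 and e i * e j = - (e j * e i) for i ≠ j. Elements are terms;
-- equality is the least R-algebra congruence containing the relations.

module _ (R : RawRing c ℓ) where
  private module R = RawRing R

  infixl 6 _+ᶜ_
  infixl 7 _*ᶜ_
  infix  8 -ᶜ_

  data CliffordTerm (r : ℕ) : Set c where
    scalar    : R.Carrier → CliffordTerm r
    e         : Fin r → CliffordTerm r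
    _+ᶜ_ _*ᶜ_ : CliffordTerm r → CliffordTerm r → CliffordTerm r
    -ᶜ_       : CliffordTerm r → CliffordTerm r

module _ {R : RawRing c ℓ} where
  private module R = RawRing R

  infix 4 _≈ᶜ_

  data _≈ᶜ_ {r : ℕ} : Rel (CliffordTerm R r) (c ⊔ ℓ) where
    reflᶜ  : ∀ {x} → x ≈ᶜ x
    symᶜ   : ∀ {x y} → x ≈ᶜ y → y ≈ᶜ x
    transᶜ : ∀ {x y z} → x ≈ᶜ y → y ≈ᶜ z → x ≈ᶜ z

    +-cong : ∀ {x x′ y y′} → x ≈ᶜ x′ → y ≈ᶜ y′ → x +ᶜ y ≈ᶜ x′ +ᶜ y′
    *-cong : ∀ {x x′ y y′} → x ≈ᶜ x′ → y ≈ᶜ y′ → x *ᶜ y ≈ᶜ x′ *ᶜ y′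
    neg-cong : ∀ {x x′} → x ≈ᶜ x′ → -ᶜ x ≈ᶜ -ᶜ x′

    +-assoc     : ∀ x y z → (x +ᶜ y) +ᶜ z ≈ᶜ x +ᶜ (y +ᶜ z)
    +-comm      : ∀ x y → x +ᶜ y ≈ᶜ y +ᶜ x
    +-identityˡ : ∀ x → scalar R.0# +ᶜ x ≈ᶜ x
    +-inverseˡ  : ∀ x → (-ᶜ x) +ᶜ x ≈ᶜ scalar R.0#
    *-assoc     : ∀ x y z → (x *ᶜ y) *ᶜ z ≈ᶜ x *ᶜ (y *ᶜ z)
    *-identityˡ : ∀ x → scalar R.1# *ᶜ x ≈ᶜ x
    *-identityʳ : ∀ x → x *ᶜ scalar R.1# ≈ᶜ x
    *-distribˡ  : ∀ x y z → x *ᶜ (y +ᶜ z) ≈ᶜ x *ᶜ y +ᶜ x *ᶜ z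
    *-distribʳ  : ∀ x y z → (y +ᶜ z) *ᶜ x ≈ᶜ y *ᶜ x +ᶜ z *ᶜ x

    scalar-cong    : ∀ {s t} → s R.≈ t → scalar s ≈ᶜ scalar t
    scalar-+       : ∀ s t → scalar (s R.+ t) ≈ᶜ scalar s +ᶜ scalar t
    scalar-*       : ∀ s t → scalar (s R.* t) ≈ᶜ scalar s *ᶜ scalar t
    scalar-central : ∀ s x → scalar s *ᶜ x ≈ᶜ x *ᶜ scalar s

    e-square      : ∀ i → e i *ᶜ e i ≈ᶜ scalar R.1#
    e-anticommute : ∀ {i j} → i ≢ j → e i *ᶜ e j ≈ᶜ -ᶜ (e j *ᶜ e i)

Clifford : (R : RawRing c ℓ) → ℕ → RawAlgebra R c (c ⊔ ℓ)
Clifford R r = record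
  { rawRing = record
    { Carrier = CliffordTerm R r
    ; _≈_     = _≈ᶜ_
    ; _+_     = _+ᶜ_
    ; _*_     = _*ᶜ_
    ; -_      = -ᶜ_
    ; 0#      = scalar (RawRing.0# R)
    ; 1#      = scalar (RawRing.1# R)
    }
  ; _•_ = λ s x → scalar s *ᶜ x
  }

------------------------------------------------------------------------
-- The (ungraded) tensor product of two algebras: a list of pairs (x , y)
-- stands for the sum of the pure tensors x ⊗ y.

module _ {R : RawRing c ℓ} (A : RawAlgebra R a ℓ₁) (B : RawAlgebra R b ℓ₂) where
  private
    module R = RawRing R
    module A = RawAlgebra A
    module B = RawAlgebra B

    Tensors : Set (a ⊔ b)
    Tensors = List (A.Carrier × B.Carrier)

  infix 4 _≈ᵗ_

  data _≈ᵗ_ : Rel Tensors (c ⊔ a ⊔ b ⊔ ℓ₁ ⊔ ℓ₂) where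
    reflᵗ  : ∀ {s} → s ≈ᵗ s
    symᵗ   : ∀ {s t} → s ≈ᵗ t → t ≈ᵗ s
    transᵗ : ∀ {s t u} → s ≈ᵗ t → t ≈ᵗ u → s ≈ᵗ u

    ++-cong : ∀ {s s′ t t′} → s ≈ᵗ s′ → t ≈ᵗ t′ → s ++ t ≈ᵗ s′ ++ t′
    ++-comm : ∀ s t → s ++ t ≈ᵗ t ++ s

    ⊗-cong     : ∀ {x x′ y y′} → x A.≈ x′ → y B.≈ y′ → [ x , y ] ≈ᵗ [ x′ , y′ ]
    ⊗-distribˡ : ∀ x y y′ → [ x , y B.+ y′ ] ≈ᵗ (x , y) ∷ (x , y′) ∷ []
    ⊗-distribʳ : ∀ x x′ y → [ x A.+ x′ , y ] ≈ᵗ (x , y) ∷ (x′ , y) ∷ []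
    ⊗-zeroˡ    : ∀ y → [ A.0# , y ] ≈ᵗ []
    ⊗-zeroʳ    : ∀ x → [ x , B.0# ] ≈ᵗ []
    ⊗-balanced : ∀ s x y → [ s A.• x , y ] ≈ᵗ [ x , s B.• y ]

  infixr 7 _⊗_

  _⊗_ : RawAlgebra R (a ⊔ b) (c ⊔ a ⊔ b ⊔ ℓ₁ ⊔ ℓ₂)
  _⊗_ = record
    { rawRing = record
      { Carrier = Tensors
      ; _≈_     = _≈ᵗ_
      ; _+_     = _++_
      ; _*_     = cartesianProductWith (λ (x , y) (x′ , y′) → x A.* x′ , y B.* y′)
      ; -_      = List.map (map₁ A.-_)
      ; 0#      = []
      ; 1#      = [ A.1# , B.1# ]
      }
    ; _•_ = λ s → List.map (map₁ (s A.•_))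
    }

------------------------------------------------------------------------
-- Representations of C_p ⊗ C_q and their quadratic mappings

module _ (ℝ : Reals c ℓ₁ ℓ₂) where
  private
    module ℝ = Reals ℝ
    ℂ : RawRing c ℓ₁
    ℂ = Complex ℝ.rawRing
    module Realᴸ = LinearAlgebra ℝ.rawRing
    module Complexᴸ = LinearAlgebra ℂ

  CliffordTensor : ℕ → ℕ → RawAlgebra ℝ.rawRing c (c ⊔ ℓ₁)
  CliffordTensor p q = Clifford ℝ.rawRing p ⊗ Clifford ℝ.rawRing q

  generator : ∀ p q → Vector (RawAlgebra.Carrier (CliffordTensor p q)) (p ℕ.+ q)
  generator p q = (λ i → [ e i , scalar ℝ.1# ]) Vector.++ (λ j → [ scalar ℝ.1# , e j ])

  record Representation (p q m : ℕ) : Set (c ⊔ ℓ₁) where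
    field
      ρ : RawAlgebra.Carrier (CliffordTensor p q) → Realᴸ.Matrix m
      isAlgebraHomomorphism :
        IsAlgebraHomomorphism (CliffordTensor p q) (Realᴸ.matrices m) ρ

    basisMatrices : Vector (Realᴸ.Matrix m) (p ℕ.+ q)
    basisMatrices i = ρ (generator p q i)

  module _ (p q : ℕ) {m : ℕ} (S : Vector (Realᴸ.Matrix m) (p ℕ.+ q)) where
    private
      Sℂ : Vector (Complexᴸ.Matrix m) (p ℕ.+ q)
      Sℂ i j l = S i j l , ℝ.0#

      Qℂ : Vector (RawRing.Carrier ℂ) m → Vector (RawRing.Carrier ℂ) (p ℕ.+ q)
      Qℂ = Complexᴸ.quadraticMap Sℂ

      Regular : Vector (RawRing.Carrier ℂ) m → Set ℓ₁
      Regular w = ¬ (RawRing._≈_ ℂ (Complexᴸ.P p q (Qℂ w)) (RawRing.0# ℂ))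

    NonDegenerate : Set (c ⊔ ℓ₁)
    NonDegenerate =
      (∃ λ w → Regular w) ×
      (∀ w → Regular w → Complexᴸ.HasRank (Complexᴸ.differential Sℂ w) (p ℕ.+ q))

    Degenerate : Set (c ⊔ ℓ₁)
    Degenerate = ¬ NonDegenerate

    cliffordQuartic : Vector ℝ.Carrier m → ℝ.Carrier
    cliffordQuartic w = Realᴸ.P p q (Realᴸ.quadraticMap S w)

    QuarticVanishes : Set (c ⊔ ℓ₁)
    QuarticVanishes = ∀ w → cliffordQuartic w ℝ.≈ ℝ.0#

    HasLinearRelation : Set (c ⊔ ℓ₁)
    HasLinearRelation = ∃ λ (f : Vector (Vector ℝ.Carrier m → ℝ.Carrier) (p ℕ.+ q)) →
      (∀ i → Realᴸ.IsLinearForm (f i)) ×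
      ¬ (∀ i w → f i w ℝ.≈ ℝ.0#) ×
      (∀ w → Realᴸ.sum (λ i → S i Realᴸ.⟦ w ⟧ ℝ.* f i w) ℝ.≈ ℝ.0#)

  exceptionalTriples : List (ℕ × ℕ × ℕ)
  exceptionalTriples =
    (2 , 1 , 2) ∷ (3 , 1 , 4) ∷ (5 , 1 , 8) ∷ (9 , 1 , 16) ∷
    (2 , 2 , 4) ∷ (3 , 3 , 8) ∷ (5 , 5 , 16) ∷ []

  EqualUpToSign : ∀ {m} p q → Vector (Realᴸ.Matrix m) (p ℕ.+ q) → Set ℓ₁
  EqualUpToSign {m} p q S = ∃ λ (pq≡11 : (p , q) ≡ (1 , 1)) → S₁=±S₂ pq≡11 S
    where
    S₁=±S₂ : ∀ {p q} → (p , q) ≡ (1 , 1) → Vector (Realᴸ.Matrix m) (p ℕ.+ q) → Set ℓ₁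
    S₁=±S₂ refl S = (S zero Realᴸ.≋ₘ S (suc zero)) ⊎
                    (S zero Realᴸ.≋ₘ RawAlgebra.-_ (Realᴸ.matrices m) (S (suc zero)))

  Exceptional : ∀ p q {m} → Vector (Realᴸ.Matrix m) (p ℕ.+ q) → Set ℓ₁
  Exceptional p q {m} S = (p , q , m) ∈ exceptionalTriples ⊎ EqualUpToSign p q S

{-# OPTIONS --safe #-}

-- Put n = p + q and let ε i = ±1 be the sign of the i-th square in P, so that
-- S i S k = - ε i ε k S k S i for i ≠ k.
--
-- (i) ⇔ (ii): Suppose ∑ᵢ cᵢ S i w = 0. Pairing with S i S k w gives
-- cᵢ εₖ Qₖ(w) = cₖ εᵢ Qᵢ(w), and applying ∑ᵢ εᵢ cᵢ S i gives P(c) w = 0; together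
-- cᵢ² P(Q(w)) w = 0. So the S i w are independent, and dQ has rank n at w, as soon
-- as P(Q(w)) ≠ 0. Conversely, if P ∘ Q vanishes on ℝᵐ, then so do the coefficients
-- of P(Q(x + t y)) as a polynomial in t, and P ∘ Q vanishes at x + i y.
--
-- (ii) ⇒ (iii): differentiate P ∘ Q.
--
-- (iii) ⇒ (iv) ⇒ (ii) for p ≥ 2: here tr (S i S k) = 0 for i ≠ k. Contracting the
-- polarisation of ∑ᵢ S i [w] (gᵢ · w) = 0 with S k shows that
-- (m + 4) gₖ = 2 εₖ S k G with G = ∑ᵢ εᵢ S i gᵢ, hence (m + 4) G = 2 n G, so m + 4 = 2 n.
-- Let Φ be the symmetrisation of 3 ∑ᵢ εᵢ S i ⊗ S i. Its contraction with S k is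
-- εₖ (m + 4 - 2 n) S k. If m + 4 = 2 n, then Φ is orthogonal to every S k ⊗ S k, whence
-- |Φ|² = 0, Φ = 0 and P ∘ Q = 0. Moreover, contracting Φ = 0 with the identity yields
-- p = q unless q = 1, and contracting it with S 1 S 2 S 3 S 4 yields p = q + 8 when
-- p ≥ 4 and p ≠ 5. Only the seven listed triples satisfy all three conditions.
--
-- (iii) ⇒ (iv) for p = q = 1: with K = S 1 S 2 and s = ±1, the same contraction gives
-- x (x + 4) (g₁ + s g₂) = 0 for x = m + s tr K = |1 + s K|² / 2,
-- so that either both gᵢ vanish or 1 + s K = 0 for some s.
module Submission where

import Defs
open import Defs using (Reals; Complex; RawAlgebra; IsAlgebraHomomorphism; module LinearAlgebra;
  CliffordTensor; generator; Representation; Degenerate; QuarticVanishes;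
  HasLinearRelation; exceptionalTriples; EqualUpToSign; Exceptional)
open import Level using (_⊔_)
open import Algebra.Bundles using (CommutativeRing; RawRing)
open import Algebra.Module.Morphism.Structures using (module LeftModuleMorphisms)
open import Algebra.Morphism.Structures using (module RingMorphisms)
import Algebra.Solver.Ring
open import Algebra.Solver.Ring.AlmostCommutativeRing
  using (fromCommutativeRing; _-Raw-AlmostCommutative⟶_)
open import Data.Bool.Base using (if_then_else_)
open import Data.Fin.Base using (Fin; zero; suc; _↑ˡ_; _↑ʳ_; splitAt; join; fromℕ<)
open import Data.Fin.Patterns using (0F; 1F; 2F; 3F)
open import Data.Fin.Properties using (_≟_; any?; join-splitAt; ↑ˡ-injective; ↑ʳ-injective)
open import Data.Integer.Base as ℤ using (ℤ; -[1+_]; _⊖_; _◃_; sign; ∣_∣)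
import Data.Integer.Properties as ℤₚ
open import Data.List.Base using ([_])
open import Data.List.Membership.Propositional using (_∈_)
open import Data.List.Relation.Unary.Any using (here; there)
open import Data.Maybe.Base using (Maybe; just; nothing)
open import Data.Nat.Base as ℕ using (ℕ; zero; suc; z≤n; s≤s)
import Data.Nat.Properties as ℕₚ
open import Data.Product.Base using (∃; _×_; _,_; proj₁; proj₂)
open import Data.Sign.Base as Sign using (Sign; opposite)
open import Data.Sum.Base using (_⊎_; inj₁; inj₂)
open import Data.Vec.Functional as Vector using (Vector)
open import Data.Vec.Functional.Properties using (lookup-++ˡ; lookup-++ʳ)
open import Function.Bundles using (_⇔_; mk⇔)
open import Relation.Binary.Bundles using (Setoid)
open import Relation.Binary.Definitions using (tri<; tri≈; tri>; Decidable)
open import Relation.Binary.PropositionalEquality.Core as ≡ using (_≡_; _≢_)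
import Relation.Binary.Reasoning.Setoid
open import Relation.Binary.Structures using (IsStrictTotalOrder)
open import Relation.Nullary.Decidable.Core using (does; yes; no; ¬?; _×-dec_)
open import Relation.Nullary.Negation using (¬_; contradiction)

-- The factor m + 4 - 2 n arises twice, from a linear relation and from Φ; this ties (iii) to (ii).
-- Φ is built from the S k ⊗ S k by permuting indices and is itself symmetric, so |Φ|² is a sum of
-- contractions with the S k; since squares are nonnegative in ℝ, every entry of Φ then vanishes.
-- The contractions with 1 and with S 1 S 2 S 3 S 4 are instances of one statement about a symmetric
-- involution Z with S i Z = χᵢ Z S i: if every tr (S i Z) is 0, then ∑ᵢ εᵢ χᵢ = 0. The exceptions q
-- = 1 and p = 5 come from these traces: a lone negative generator has no anticommuting partner, and
-- for p = 5 the product S 1 S 2 S 3 S 4 S 5 commutes with every generator, so its trace may be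
-- nonzero. Likewise S 1 S 2 may have nonzero trace when p = q = 1, which is why that case is
-- separate. Independence is wanted over ℂ and positivity over ℝ, so the identities are proved over
-- commutative rings in which 2 can be cancelled. The order makes equality decidable in ℝ and in ℂ,
-- which allows (ii) to be recovered from the negation in (i).

-- The ring solver of the library needs coefficients with decidable equality;
-- the integers serve for an arbitrary commutative ring.
module IntegerSolver {c ℓ} (K : CommutativeRing c ℓ) where
  open CommutativeRing K
  open import Algebra.Properties.Ring ring
    using (-‿distribˡ-*; -‿distribʳ-*; -0#≈0#; -‿involutive; -‿+-comm)
  open import Algebra.Properties.Semiring.Mult.TCOptimised semiring
    using (1+×; ×-homo-+; ×1-homo-*) renaming (_×_ to _×′_)
  open import Relation.Binary.Reasoning.Setoid setoid

  fromℕ : ℕ → Carrier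
  fromℕ n = n ×′ 1#

  fromℕ-+ : ∀ m n → fromℕ (m ℕ.+ n) ≈ fromℕ m + fromℕ n
  fromℕ-+ = ×-homo-+ 1#

  fromℕ-* : ∀ m n → fromℕ (m ℕ.* n) ≈ fromℕ m * fromℕ n
  fromℕ-* = ×1-homo-*

  fromℤ : ℤ → Carrier
  fromℤ (ℤ.+ n)  = fromℕ n
  fromℤ -[1+ n ] = - fromℕ (suc n)

  fromSign : Sign → Carrier
  fromSign Sign.+ = 1#
  fromSign Sign.- = - 1#

  fromℤ-neg : ∀ i → fromℤ (ℤ.- i) ≈ - fromℤ i
  fromℤ-neg (ℤ.+ zero)  = sym -0#≈0#
  fromℤ-neg (ℤ.+ suc n) = refl
  fromℤ-neg -[1+ n ]    = sym (-‿involutive _)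

  fromℤ-⊖ : ∀ m n → fromℤ (m ⊖ n) ≈ fromℕ m + - fromℕ n
  fromℤ-⊖ m zero = sym (trans (+-congˡ -0#≈0#) (+-identityʳ _))
  fromℤ-⊖ zero (suc n) = sym (+-identityˡ _)
  fromℤ-⊖ (suc m) (suc n) = begin
    fromℤ (suc m ⊖ suc n)                   ≡⟨ ≡.cong fromℤ (ℤₚ.[1+m]⊖[1+n]≡m⊖n m n) ⟩
    fromℤ (m ⊖ n)                           ≈⟨ fromℤ-⊖ m n ⟩
    fromℕ m + - fromℕ n                     ≈⟨ +-congʳ (+-identityˡ _) ⟨
    (0# + fromℕ m) + - fromℕ n              ≈⟨ +-congʳ (+-congʳ (-‿inverseʳ 1#)) ⟨
    ((1# + - 1#) + fromℕ m) + - fromℕ n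
        ≈⟨ +-congʳ (trans (+-assoc _ _ _) (trans (+-congˡ (+-comm _ _)) (sym (+-assoc _ _ _)))) ⟩
    ((1# + fromℕ m) + - 1#) + - fromℕ n     ≈⟨ +-assoc _ _ _ ⟩
    (1# + fromℕ m) + (- 1# + - fromℕ n)     ≈⟨ +-cong (sym (1+× m 1#)) (-‿+-comm _ _) ⟩
    fromℕ (suc m) + - (1# + fromℕ n)        ≈⟨ +-congˡ (-‿cong (1+× n 1#)) ⟨
    fromℕ (suc m) + - fromℕ (suc n)         ∎

  fromℤ-+ : ∀ i j → fromℤ (i ℤ.+ j) ≈ fromℤ i + fromℤ j
  fromℤ-+ (ℤ.+ m) (ℤ.+ n)   = fromℕ-+ m n
  fromℤ-+ (ℤ.+ m) -[1+ n ]  = fromℤ-⊖ m (suc n)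
  fromℤ-+ -[1+ m ] (ℤ.+ n)  = trans (fromℤ-⊖ n (suc m)) (+-comm _ _)
  fromℤ-+ -[1+ m ] -[1+ n ] = begin
    - fromℕ (suc (suc (m ℕ.+ n)))          ≡⟨ ≡.cong (λ k → - fromℕ (suc k)) (≡.sym (ℕₚ.+-suc m n)) ⟩
    - fromℕ (suc m ℕ.+ suc n)              ≈⟨ -‿cong (fromℕ-+ (suc m) (suc n)) ⟩
    - (fromℕ (suc m) + fromℕ (suc n))      ≈⟨ -‿+-comm _ _ ⟨
    - fromℕ (suc m) + - fromℕ (suc n)      ∎
    where import Data.Nat.Properties as ℕₚ

  fromSign-* : ∀ s t → fromSign (s Sign.* t) ≈ fromSign s * fromSign t
  fromSign-* Sign.+ t      = sym (*-identityˡ _)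
  fromSign-* Sign.- Sign.+ = sym (*-identityʳ _)
  fromSign-* Sign.- Sign.- =
    sym (trans (sym (-‿distribˡ-* _ _)) (trans (-‿cong (*-identityˡ _)) (-‿involutive _)))

  fromℤ-◃ : ∀ s n → fromℤ (s ◃ n) ≈ fromSign s * fromℕ n
  fromℤ-◃ s      zero    = sym (zeroʳ _)
  fromℤ-◃ Sign.+ (suc n) = sym (*-identityˡ _)
  fromℤ-◃ Sign.- (suc n) = trans (-‿cong (sym (*-identityˡ _))) (-‿distribˡ-* _ _)

  fromℤ-* : ∀ i j → fromℤ (i ℤ.* j) ≈ fromℤ i * fromℤ j
  fromℤ-* i j = begin
    fromℤ ((s Sign.* t) ◃ (a ℕ.* b))                 ≈⟨ fromℤ-◃ (s Sign.* t) (a ℕ.* b) ⟩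
    fromSign (s Sign.* t) * fromℕ (a ℕ.* b)          ≈⟨ *-cong (fromSign-* s t) (fromℕ-* a b) ⟩
    (fromSign s * fromSign t) * (fromℕ a * fromℕ b)  ≈⟨ *-assoc _ _ _ ⟩
    fromSign s * (fromSign t * (fromℕ a * fromℕ b))
        ≈⟨ *-congˡ (trans (sym (*-assoc _ _ _)) (trans (*-congʳ (*-comm _ _)) (*-assoc _ _ _))) ⟩
    fromSign s * (fromℕ a * (fromSign t * fromℕ b))  ≈⟨ *-assoc _ _ _ ⟨
    (fromSign s * fromℕ a) * (fromSign t * fromℕ b)  ≈⟨ *-cong (back i) (back j) ⟩
    fromℤ i * fromℤ j                                ∎
    where
    s = sign i
    t = sign j
    a = ∣ i ∣
    b = ∣ j ∣
    back : ∀ k → fromSign (sign k) * fromℕ ∣ k ∣ ≈ fromℤ k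
    back k = trans (sym (fromℤ-◃ (sign k) ∣ k ∣)) (reflexive (≡.cong fromℤ (ℤₚ.◃-inverse k)))

  private
    morphism : ℤ.+-*-rawRing -Raw-AlmostCommutative⟶ fromCommutativeRing K
    morphism = record
      { ⟦_⟧    = fromℤ
      ; +-homo = fromℤ-+
      ; *-homo = fromℤ-*
      ; -‿homo = fromℤ-neg
      ; 0-homo = refl
      ; 1-homo = refl
      }

    coeff≟ : ∀ i j → Maybe (fromℤ i ≈ fromℤ j)
    coeff≟ i j with i ℤₚ.≟ j
    ... | yes i≡j = just (reflexive (≡.cong fromℤ i≡j))
    ... | no _    = nothing

  open Algebra.Solver.Ring ℤ.+-*-rawRing (fromCommutativeRing K) morphism coeff≟ public
    using (Polynomial; solve; _:=_; _:+_; _:*_; :-_; con)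

  :0 :1 : ∀ {n} → Polynomial n
  :0 = con (ℤ.+ 0)
  :1 = con (ℤ.+ 1)

-- Finite sums, signed matrix relations and traces over a commutative ring.

module Matrices {c ℓ} (K : CommutativeRing c ℓ) where
  open CommutativeRing K public hiding (zero)
  open IntegerSolver K public
  open import Algebra.Properties.Semiring.Sum semiring public
    hiding (sum)
  open LinearAlgebra rawRing public
  open import Algebra.Properties.Ring ring public
    using (-‿distribˡ-*; -‿distribʳ-*; -0#≈0#; -‿involutive; -‿+-comm; x∙y⁻¹≈ε⇒x≈y)
  open import Algebra.Properties.Semiring.Mult.TCOptimised semiring using (1+×)
  module ≈-Reasoning = Relation.Binary.Reasoning.Setoid setoid

  ∑-zero : ∀ {n} {f : Vector Carrier n} → (∀ i → f i ≈ 0#) → sum f ≈ 0#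
  ∑-zero {n} f≈0 = trans (sum-cong-≋ f≈0) (sum-replicate-zero n)

  ∑-neg : ∀ {n} (f : Vector Carrier n) → ∑[ i < n ] (- f i) ≈ - sum f
  ∑-neg {zero}  f = sym -0#≈0#
  ∑-neg {suc n} f = trans (+-congˡ (∑-neg (λ i → f (suc i)))) (-‿+-comm _ _)

  ∑-const : ∀ n x → ∑[ i < n ] x ≈ fromℕ n * x
  ∑-const zero    x = sym (zeroˡ x)
  ∑-const (suc n) x = let open ≈-Reasoning in begin
    x + ∑[ i < n ] x        ≈⟨ +-cong (sym (*-identityˡ x)) (∑-const n x) ⟩
    1# * x + fromℕ n * x    ≈⟨ distribʳ x _ _ ⟨
    (1# + fromℕ n) * x      ≈⟨ *-congʳ (1+× n 1#) ⟨
    fromℕ (suc n) * x       ∎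

  ∑-split : ∀ p {q} (f : Vector Carrier (p ℕ.+ q)) →
            sum f ≈ ∑[ i < p ] f (i ↑ˡ q) + ∑[ j < q ] f (p ↑ʳ j)
  ∑-split zero    f = sym (+-identityˡ _)
  ∑-split (suc p) f = trans (+-congˡ (∑-split p (λ i → f (suc i)))) (sym (+-assoc _ _ _))

  δ : ∀ {n} → Fin n → Fin n → Carrier
  δ i j = if does (i ≟ j) then 1# else 0#

  δ-refl : ∀ {n} (i : Fin n) → δ i i ≈ 1#
  δ-refl zero    = refl
  δ-refl (suc i) = δ-refl i

  δ-≢ : ∀ {n} {i j : Fin n} → i ≢ j → δ i j ≈ 0#
  δ-≢ {i = zero}  {zero}  i≢j = contradiction ≡.refl i≢j
  δ-≢ {i = zero}  {suc j} i≢j = refl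
  δ-≢ {i = suc i} {zero}  i≢j = refl
  δ-≢ {i = suc i} {suc j} i≢j = δ-≢ (λ i≡j → i≢j (≡.cong suc i≡j))

  δ-sym : ∀ {n} (i j : Fin n) → δ i j ≈ δ j i
  δ-sym zero    zero    = refl
  δ-sym zero    (suc j) = refl
  δ-sym (suc i) zero    = refl
  δ-sym (suc i) (suc j) = δ-sym i j

  ∑-δ : ∀ {n} (i : Fin n) (f : Vector Carrier n) → ∑[ j < n ] (δ i j * f j) ≈ f i
  ∑-δ zero f =
    trans (+-cong (*-identityˡ _) (∑-zero (λ j → zeroˡ (f (suc j))))) (+-identityʳ _)
  ∑-δ (suc i) f =
    trans (+-cong (zeroˡ _) (∑-δ i (λ j → f (suc j)))) (+-identityˡ _)

  ∑-δʳ : ∀ {n} (i : Fin n) (f : Vector Carrier n) → ∑[ j < n ] (f j * δ j i) ≈ f i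
  ∑-δʳ i f = trans (sum-cong-≋ (λ j → trans (*-comm _ _) (*-congʳ (δ-sym j i)))) (∑-δ i f)

  ∑∑-cong : ∀ {m n} {f g : Fin m → Fin n → Carrier} → (∀ i j → f i j ≈ g i j) →
            ∑[ i < m ] ∑[ j < n ] f i j ≈ ∑[ i < m ] ∑[ j < n ] g i j
  ∑∑-cong f≈g = sum-cong-≋ (λ i → sum-cong-≋ (f≈g i))

  ∑∑-distrib-+ : ∀ {m n} (f g : Fin m → Fin n → Carrier) →
                 ∑[ i < m ] ∑[ j < n ] (f i j + g i j) ≈
                 ∑[ i < m ] ∑[ j < n ] f i j + ∑[ i < m ] ∑[ j < n ] g i j
  ∑∑-distrib-+ {m} f g =
    trans (sum-cong-≋ {m} (λ i → ∑-distrib-+ (f i) (g i))) (∑-distrib-+ {m} _ _)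

  ∑∑-distribˡ : ∀ {m n} x (f : Fin m → Fin n → Carrier) →
                ∑[ i < m ] ∑[ j < n ] (x * f i j) ≈ x * ∑[ i < m ] ∑[ j < n ] f i j
  ∑∑-distribˡ {m} x f =
    trans (sum-cong-≋ {m} (λ i → sym (*-distribˡ-sum x (f i)))) (sym (*-distribˡ-sum {m} x _))

  ∑-comm₃ : ∀ {k m n} (f : Fin k → Fin m → Fin n → Carrier) →
            ∑[ a < m ] ∑[ b < n ] ∑[ i < k ] f i a b ≈
            ∑[ i < k ] ∑[ a < m ] ∑[ b < n ] f i a b
  ∑-comm₃ f = trans (sum-cong-≋ (λ a → ∑-comm (λ b i → f i a b))) (∑-comm (λ a i → sum (f i a)))

  private variable m n : ℕ

  infixl 7 _∙_
  infixr 8 _⊙_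

  1ₘ : Matrix m
  1ₘ = δ

  _∙_ : Matrix m → Matrix m → Matrix m
  (A ∙ B) i j = ∑[ l < _ ] (A i l * B l j)

  -ₘ_ : Matrix m → Matrix m
  (-ₘ A) i j = - A i j

  -- The scalars in the matrix relations are signs. Keeping them in `Sign` lets their products
  -- reduce by computation.
  _⊙_ : Sign → Matrix m → Matrix m
  (σ ⊙ A) i j = fromSign σ * A i j

  matrixSetoid : ℕ → Setoid c ℓ
  matrixSetoid m = record
    { Carrier = Matrix m
    ; _≈_ = _≋ₘ_
    ; isEquivalence = record
      { refl  = λ i j → refl
      ; sym   = λ A≋B i j → sym (A≋B i j)
      ; trans = λ A≋B B≋C i j → trans (A≋B i j) (B≋C i j)
      }
    }

  module _ {m : ℕ} where
    open Setoid (matrixSetoid m) public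
      using () renaming (refl to ≋-refl; sym to ≋-sym; trans to ≋-trans)

  module ≋-Reasoning {m : ℕ} = Relation.Binary.Reasoning.Setoid (matrixSetoid m)

  ∙-cong : {A A′ B B′ : Matrix m} → A ≋ₘ A′ → B ≋ₘ B′ → A ∙ B ≋ₘ A′ ∙ B′
  ∙-cong A≋A′ B≋B′ i j = sum-cong-≋ (λ l → *-cong (A≋A′ i l) (B≋B′ l j))

  ∙-congˡ : {A B B′ : Matrix m} → B ≋ₘ B′ → A ∙ B ≋ₘ A ∙ B′
  ∙-congˡ {A = A} B≋B′ = ∙-cong {A = A} (≋-refl {x = A}) B≋B′

  ∙-congʳ : {A A′ B : Matrix m} → A ≋ₘ A′ → A ∙ B ≋ₘ A′ ∙ B
  ∙-congʳ {B = B} A≋A′ = ∙-cong {B = B} A≋A′ (≋-refl {x = B})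

  -- One rearrangement of a double sum serves both the associativity of `_∙_` and its action on
  -- vectors.
  ∑∑-assoc : (u v : Vector Carrier m) (B : Matrix m) →
             ∑[ l < m ] (∑[ k < m ] (u k * B k l) * v l) ≈
             ∑[ k < m ] (u k * ∑[ l < m ] (B k l * v l))
  ∑∑-assoc {m} u v B = let open ≈-Reasoning in begin
    ∑[ l < m ] (∑[ k < m ] (u k * B k l) * v l)   ≈⟨ sum-cong-≋ {m} (λ l → *-distribʳ-sum {m} (v l) _) ⟩
    ∑[ l < m ] ∑[ k < m ] (u k * B k l * v l)     ≈⟨ ∑-comm {m} {m} _ ⟩
    ∑[ k < m ] ∑[ l < m ] (u k * B k l * v l)     ≈⟨ ∑∑-cong {m} {m} (λ k l → *-assoc _ _ _) ⟩
    ∑[ k < m ] ∑[ l < m ] (u k * (B k l * v l))   ≈⟨ sum-cong-≋ {m} (λ k → *-distribˡ-sum {m} (u k) _) ⟨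
    ∑[ k < m ] (u k * ∑[ l < m ] (B k l * v l))   ∎

  ∙-assoc : (A B C : Matrix m) → (A ∙ B) ∙ C ≋ₘ A ∙ (B ∙ C)
  ∙-assoc A B C i j = ∑∑-assoc (A i) (λ l → C l j) B

  ∙-identityˡ : (A : Matrix m) → 1ₘ ∙ A ≋ₘ A
  ∙-identityˡ A i j = ∑-δ i (λ l → A l j)

  ∙-identityʳ : (A : Matrix m) → A ∙ 1ₘ ≋ₘ A
  ∙-identityʳ A i j = ∑-δʳ j (A i)

  ⊙-cong : ∀ σ {A B : Matrix m} → A ≋ₘ B → σ ⊙ A ≋ₘ σ ⊙ B
  ⊙-cong σ A≋B i j = *-congˡ (A≋B i j)

  ⊙-∙ˡ : ∀ σ (A B : Matrix m) → (σ ⊙ A) ∙ B ≋ₘ σ ⊙ (A ∙ B)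
  ⊙-∙ˡ {m} σ A B i j =
    trans (sum-cong-≋ {m} (λ l → *-assoc _ _ _)) (sym (*-distribˡ-sum {m} (fromSign σ) _))

  ⊙-∙ʳ : ∀ σ (A B : Matrix m) → A ∙ (σ ⊙ B) ≋ₘ σ ⊙ (A ∙ B)
  ⊙-∙ʳ {m} σ A B i j =
    trans (sum-cong-≋ {m} (λ l → trans (sym (*-assoc _ _ _)) (trans (*-congʳ (*-comm _ _)) (*-assoc _ _ _))))
          (sym (*-distribˡ-sum {m} (fromSign σ) _))

  ⊙-* : ∀ σ τ (A : Matrix m) → σ ⊙ τ ⊙ A ≋ₘ (σ Sign.* τ) ⊙ A
  ⊙-* σ τ A i j = trans (sym (*-assoc _ _ _)) (*-congʳ (sym (fromSign-* σ τ)))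

  fromSign-square : ∀ σ → fromSign σ * fromSign σ ≈ 1#
  fromSign-square Sign.+ = *-identityˡ 1#
  fromSign-square Sign.- = sym (fromSign-* Sign.- Sign.-)

  ⊙-involutive : ∀ σ (A : Matrix m) → σ ⊙ σ ⊙ A ≋ₘ A
  ⊙-involutive σ A i j =
    trans (sym (*-assoc _ _ _)) (trans (*-congʳ (fromSign-square σ)) (*-identityˡ _))

  Involution : Matrix m → Set ℓ
  Involution A = A ∙ A ≋ₘ 1ₘ

  -- Commutation and anticommutation in one predicate, so that the sign for a product of matrices is
  -- the product of the signs.
  Commutes : Sign → Matrix m → Matrix m → Set ℓ
  Commutes σ A B = A ∙ B ≋ₘ σ ⊙ (B ∙ A)

  Commutes-sym : ∀ {σ} {A B : Matrix m} → Commutes σ A B → Commutes σ B A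
  Commutes-sym {σ = σ} {A} {B} AB =
    ≋-trans (≋-sym (⊙-involutive σ (B ∙ A))) (⊙-cong σ (≋-sym AB))

  Commutes-refl : (A : Matrix m) → Commutes Sign.+ A A
  Commutes-refl A i j = sym (*-identityˡ _)

  Commutes-1 : (A : Matrix m) → Commutes Sign.+ A 1ₘ
  Commutes-1 A i j = trans (∙-identityʳ A i j) (sym (trans (*-identityˡ _) (∙-identityˡ A i j)))

  Commutes-∙ : ∀ {σ τ} {N A B : Matrix m} → Commutes σ N A → Commutes τ N B →
               Commutes (σ Sign.* τ) N (A ∙ B)
  Commutes-∙ {σ = σ} {τ} {N} {A} {B} NA NB = let open ≋-Reasoning in begin
    N ∙ (A ∙ B)                   ≈⟨ ∙-assoc N A B ⟨
    (N ∙ A) ∙ B                   ≈⟨ ∙-congʳ {B = B} NA ⟩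
    (σ ⊙ (A ∙ N)) ∙ B             ≈⟨ ⊙-∙ˡ σ (A ∙ N) B ⟩
    σ ⊙ ((A ∙ N) ∙ B)             ≈⟨ ⊙-cong σ (∙-assoc A N B) ⟩
    σ ⊙ (A ∙ (N ∙ B))             ≈⟨ ⊙-cong σ (∙-congˡ {A = A} NB) ⟩
    σ ⊙ (A ∙ (τ ⊙ (B ∙ N)))       ≈⟨ ⊙-cong σ (⊙-∙ʳ τ A (B ∙ N)) ⟩
    σ ⊙ τ ⊙ (A ∙ (B ∙ N))         ≈⟨ ⊙-* σ τ (A ∙ (B ∙ N)) ⟩
    (σ Sign.* τ) ⊙ (A ∙ (B ∙ N))  ≈⟨ ⊙-cong (σ Sign.* τ) (∙-assoc A B N) ⟨
    (σ Sign.* τ) ⊙ ((A ∙ B) ∙ N)  ∎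

  Commutes-conj : ∀ {σ} {N A : Matrix m} → Involution N → Commutes σ N A → N ∙ (A ∙ N) ≋ₘ σ ⊙ A
  Commutes-conj {σ = σ} {N} {A} NN NA = let open ≋-Reasoning in begin
    N ∙ (A ∙ N)       ≈⟨ ∙-assoc N A N ⟨
    (N ∙ A) ∙ N       ≈⟨ ∙-congʳ {B = N} NA ⟩
    (σ ⊙ (A ∙ N)) ∙ N ≈⟨ ⊙-∙ˡ σ (A ∙ N) N ⟩
    σ ⊙ ((A ∙ N) ∙ N) ≈⟨ ⊙-cong σ (∙-assoc A N N) ⟩
    σ ⊙ (A ∙ (N ∙ N)) ≈⟨ ⊙-cong σ (∙-congˡ {A = A} NN) ⟩
    σ ⊙ (A ∙ 1ₘ)      ≈⟨ ⊙-cong σ (∙-identityʳ A) ⟩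
    σ ⊙ A             ∎

  Symmetric-∙ : ∀ {σ} {A B : Matrix m} → Symmetric A → Symmetric B → Commutes σ A B →
                ∀ i j → (A ∙ B) i j ≈ (σ ⊙ (A ∙ B)) j i
  Symmetric-∙ {A = A} {B} symA symB AB i j =
    trans (AB i j) (*-congˡ (sum-cong-≋ (λ l → trans (*-comm _ _) (*-cong (symA l j) (symB i l)))))

  tr : Matrix m → Carrier
  tr A = ∑[ i < _ ] A i i

  tr-cong : {A B : Matrix m} → A ≋ₘ B → tr A ≈ tr B
  tr-cong A≋B = sum-cong-≋ (λ i → A≋B i i)

  tr-comm : (A B : Matrix m) → tr (A ∙ B) ≈ tr (B ∙ A)
  tr-comm {m} A B = trans (∑-comm {m} {m} _) (∑∑-cong {m} {m} (λ i l → *-comm _ _))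

  tr-⊙ : ∀ σ (A : Matrix m) → tr (σ ⊙ A) ≈ fromSign σ * tr A
  tr-⊙ {m} σ A = sym (*-distribˡ-sum {m} (fromSign σ) _)

  tr-1 : tr (1ₘ {m}) ≈ fromℕ m
  tr-1 {m} = trans (sum-cong-≋ {m} δ-refl) (trans (∑-const m 1#) (*-identityʳ _))

  _*ᵥ-cong_ : {A B : Matrix m} {v w : Vector Carrier m} → A ≋ₘ B → v ≋ w → A *ᵥ v ≋ B *ᵥ w
  (A≋B *ᵥ-cong v≋w) i = sum-cong-≋ (λ l → *-cong (A≋B i l) (v≋w l))

  ∙-*ᵥ : (A B : Matrix m) (w : Vector Carrier m) → (A ∙ B) *ᵥ w ≋ A *ᵥ (B *ᵥ w)
  ∙-*ᵥ A B w i = ∑∑-assoc (A i) w B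

  1-*ᵥ : (w : Vector Carrier m) → 1ₘ *ᵥ w ≋ w
  1-*ᵥ w i = ∑-δ i w

  ⟦⟧-cong : {A B : Matrix m} {w : Vector Carrier m} → A ≋ₘ B → A ⟦ w ⟧ ≈ B ⟦ w ⟧
  ⟦⟧-cong {w = w} A≋B = sum-cong-≋ (λ i → *-congˡ (sum-cong-≋ (λ l → *-congʳ (A≋B i l))))

  ⟦⟧-⊙ : ∀ σ (A : Matrix m) w → (σ ⊙ A) ⟦ w ⟧ ≈ fromSign σ * A ⟦ w ⟧
  ⟦⟧-⊙ {m} σ A w = begin
    ∑[ i < _ ] (w i * ∑[ l < _ ] (fromSign σ * A i l * w l))
        ≈⟨ sum-cong-≋ {m} (λ i → *-congˡ (trans (sum-cong-≋ {m} (λ l → *-assoc _ _ _))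
        (sym (*-distribˡ-sum {m} (fromSign σ) _)))) ⟩
    ∑[ i < _ ] (w i * (fromSign σ * ∑[ l < _ ] (A i l * w l)))
        ≈⟨ sum-cong-≋ {m} (λ i → solve 3 (λ x y z → x :* (y :* z) := y :* (x :* z)) refl (w i) (fromSign σ)
        _) ⟩
    ∑[ i < _ ] (fromSign σ * (w i * ∑[ l < _ ] (A i l * w l)))  ≈⟨ *-distribˡ-sum {m} (fromSign σ) _ ⟨
    fromSign σ * A ⟦ w ⟧                                        ∎
    where open ≈-Reasoning

  ·-comm : (x y : Vector Carrier m) → x · y ≈ y · x
  ·-comm {m} x y = sum-cong-≋ {m} (λ a → *-comm _ _)

  ·-*ᵥ-transpose : (A : Matrix m) (x y : Vector Carrier m) →
                   x · (A *ᵥ y) ≈ y · ((λ i j → A j i) *ᵥ x)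
  ·-*ᵥ-transpose {m} A x y = begin
    x · (A *ᵥ y)                                ≈⟨ sum-cong-≋ {m} (λ i → *-distribˡ-sum {m} (x i) _) ⟩
    ∑[ i < m ] ∑[ l < m ] (x i * (A i l * y l)) ≈⟨ ∑-comm {m} {m} _ ⟩
    ∑[ l < m ] ∑[ i < m ] (x i * (A i l * y l))
      ≈⟨ ∑∑-cong {m} {m} (λ l i → solve 3 (λ x y z → x :* (y :* z) := z :* (y :* x)) refl (x i) (A i l)
          (y l)) ⟩
    ∑[ l < m ] ∑[ i < m ] (y l * (A i l * x i)) ≈⟨ sum-cong-≋ {m} (λ l → *-distribˡ-sum {m} (y l) _) ⟨
    y · ((λ i j → A j i) *ᵥ x)                  ∎
    where open ≈-Reasoning

  ·-*ᵥ-symmetric : {A : Matrix m} → Symmetric A → (x y : Vector Carrier m) → x · (A *ᵥ y) ≈ y · (A *ᵥ x)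
  ·-*ᵥ-symmetric {m} {A} symA x y = trans (·-*ᵥ-transpose A x y)
    (sum-cong-≋ {m} (λ a → *-congˡ (sum-cong-≋ {m} (λ b → *-congʳ (symA b a)))))

  -- Cancelling 2 takes the place of dividing by 2. Both ℝ and ℂ allow it, so each argument of the
  -- kind x = - x is made once for both.
  module TwoRegular (x+x≈0⇒x≈0 : ∀ x → x + x ≈ 0# → x ≈ 0#) where

    x≈-x⇒x≈0 : ∀ {x} → x ≈ - x → x ≈ 0#
    x≈-x⇒x≈0 {x} x≈-x = x+x≈0⇒x≈0 x (trans (+-congˡ x≈-x) (-‿inverseʳ x))

    -- Inserting N N = 1 and cycling the trace replaces `A` by N A N, which is - A.
    tr-anticommuting : {N A : Matrix m} → Involution N → Commutes Sign.- N A → tr A ≈ 0#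
    tr-anticommuting {N = N} {A} NN NA = x≈-x⇒x≈0 (begin
      tr A                   ≈⟨ tr-cong (∙-identityʳ A) ⟨
      tr (A ∙ 1ₘ)            ≈⟨ tr-cong (∙-congˡ {A = A} NN) ⟨
      tr (A ∙ (N ∙ N))       ≈⟨ tr-cong (∙-assoc A N N) ⟨
      tr ((A ∙ N) ∙ N)       ≈⟨ tr-comm (A ∙ N) N ⟩
      tr (N ∙ (A ∙ N))       ≈⟨ tr-cong (Commutes-conj {σ = Sign.-} NN NA) ⟩
      tr (Sign.- ⊙ A)        ≈⟨ tr-⊙ Sign.- A ⟩
      - 1# * tr A            ≈⟨ solve 1 (λ x → (:- :1) :* x := :- x) refl (tr A) ⟩
      - tr A                 ∎)
      where open ≈-Reasoning

    ⟦⟧-skew : (A : Matrix m) → (∀ i j → A i j ≈ - A j i) → ∀ w → A ⟦ w ⟧ ≈ 0#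
    ⟦⟧-skew A skew w = x≈-x⇒x≈0 (begin
      A ⟦ w ⟧                               ≈⟨ ·-*ᵥ-transpose A w w ⟩
      (λ i j → A j i) ⟦ w ⟧
          ≈⟨ ⟦⟧-cong (λ i j → trans (skew j i) (sym (solve 1 (λ x → (:- :1) :* x := :- x) refl (A i j)))) ⟩
      (Sign.- ⊙ A) ⟦ w ⟧                    ≈⟨ ⟦⟧-⊙ Sign.- A w ⟩
      - 1# * A ⟦ w ⟧                        ≈⟨ solve 1 (λ x → (:- :1) :* x := :- x) refl (A ⟦ w ⟧) ⟩
      - (A ⟦ w ⟧)                           ∎)
      where open ≈-Reasoning

-- Clifford families: identities valid over a commutative ring.

module Families {c ℓ} (K : CommutativeRing c ℓ) where
  open Matrices K public

  private variable m n : ℕ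

  transpose-∙ : (A B : Matrix m) → ∀ i j → (A ∙ B) i j ≈ ((λ k l → B l k) ∙ (λ k l → A l k)) j i
  transpose-∙ {m} A B i j = sum-cong-≋ {m} (λ l → *-comm _ _)

  ·-combination : (x : Vector Carrier m) (c : Vector Carrier n) (r : Vector (Vector Carrier m) n) →
                  x · combination c r ≈ ∑[ l < n ] (c l * (x · r l))
  ·-combination {m} {n} x c r = begin
    ∑[ a < m ] (x a * ∑[ l < n ] (c l * r l a))    ≈⟨ sum-cong-≋ {m} (λ a → *-distribˡ-sum {n} (x a) _) ⟩
    ∑[ a < m ] ∑[ l < n ] (x a * (c l * r l a))    ≈⟨ ∑-comm {m} {n} _ ⟩
    ∑[ l < n ] ∑[ a < m ] (x a * (c l * r l a))
        ≈⟨ ∑∑-cong {n} {m} (λ l a → solve 3 (λ x y z → x :* (y :* z) := y :* (x :* z)) refl (x a) (c l)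
        (r l a)) ⟩
    ∑[ l < n ] ∑[ a < m ] (c l * (x a * r l a))    ≈⟨ sum-cong-≋ {n} (λ l → *-distribˡ-sum {m} (c l) _) ⟨
    ∑[ l < n ] (c l * (x · r l))                     ∎
    where open ≈-Reasoning

  ·-zeroʳ : (x : Vector Carrier m) {y : Vector Carrier m} → y ≋ (λ _ → 0#) → x · y ≈ 0#
  ·-zeroʳ x y≋0 = ∑-zero (λ a → trans (*-congˡ (y≋0 a)) (zeroʳ _))

  -- The trace form tr (ᵗZ F). With `Φ a b` or `Ψ g a` as `F`, it contracts the last two indices of
  -- the tensor with `Z`.
  pair : Matrix m → Matrix m → Carrier
  pair {m} Z F = ∑[ c < m ] ∑[ d < m ] (Z c d * F c d)

  pair-cong : {Z F G : Matrix m} → F ≋ₘ G → pair Z F ≈ pair Z G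
  pair-cong {m} F≋G = ∑∑-cong {m} {m} (λ c d → *-congˡ (F≋G c d))

  pair-+ : (Z F G : Matrix m) → pair Z (λ c d → F c d + G c d) ≈ pair Z F + pair Z G
  pair-+ {m} Z F G = trans (∑∑-cong {m} {m} (λ c d → distribˡ _ _ _)) (∑∑-distrib-+ {m} {m} _ _)

  pair-* : (Z F : Matrix m) (x : Carrier) → pair Z (λ c d → x * F c d) ≈ x * pair Z F
  pair-* {m} Z F x = trans
    (∑∑-cong {m} {m} (λ c d → solve 3 (λ x y z → x :* (y :* z) := y :* (x :* z)) refl (Z c d) x (F c d)))
    (∑∑-distribˡ {m} {m} x _)

  pair-∑ : (Z : Matrix m) (F : Fin n → Matrix m) →
           pair Z (λ c d → ∑[ i < n ] F i c d) ≈ ∑[ i < n ] pair Z (F i)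
  pair-∑ {m} {n} Z F =
    trans (∑∑-cong {m} {m} (λ c d → *-distribˡ-sum {n} (Z c d) _)) (∑-comm₃ {n} {m} {m} _)

  pair-⊗ : (Z : Matrix m) (x y : Vector Carrier m) → pair Z (λ c d → x c * y d) ≈ x · (Z *ᵥ y)
  pair-⊗ {m} Z x y = sum-cong-≋ {m} (λ c → trans
    (sum-cong-≋ {m} (λ d → solve 3 (λ x y z → x :* (y :* z) := y :* (x :* z)) refl (Z c d) (x c) (y d)))
    (sym (*-distribˡ-sum {m} (x c) _)))

  pair-⊗ᵀ : {Z : Matrix m} → Symmetric Z → (x y : Vector Carrier m) →
            pair Z (λ c d → x d * y c) ≈ x · (Z *ᵥ y)
  pair-⊗ᵀ {m} {Z} symZ x y = trans
    (trans (∑-comm {m} {m} _) (∑∑-cong {m} {m} (λ d c → *-congʳ (symZ c d))))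
    (pair-⊗ Z x y)

  pair-tr : (Z : Matrix m) {S : Matrix m} → Symmetric S → pair Z S ≈ tr (S ∙ Z)
  pair-tr {m} Z {S} symS = trans (∑-comm {m} {m} _)
    (∑∑-cong {m} {m} (λ d c → trans (*-comm _ _) (*-congʳ (symS c d))))

  -- Generators of equal sign anticommute and generators of unequal sign commute, so one rule covers
  -- both tensor factors. The ring is arbitrary so that the complexified matrices form such a family
  -- too.
  record IsCliffordFamily (ε : Vector Sign n) (S : Vector (Matrix m) n) : Set ℓ where
    field
      symmetric  : ∀ i → Symmetric (S i)
      involution : ∀ i → Involution (S i)
      commutes   : ∀ {i k} → i ≢ k → Commutes (opposite (ε i Sign.* ε k)) (S i) (S k)

  -- Each of the three signs occurs in two factors and cancels; three negations remain.
  opposite-triple : ∀ a b c → opposite (a Sign.* b) Sign.* (opposite (c Sign.* b) Sign.* opposite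
      (c Sign.* a)) ≡ Sign.-
  opposite-triple Sign.+ Sign.+ Sign.+ = ≡.refl
  opposite-triple Sign.+ Sign.+ Sign.- = ≡.refl
  opposite-triple Sign.+ Sign.- Sign.+ = ≡.refl
  opposite-triple Sign.+ Sign.- Sign.- = ≡.refl
  opposite-triple Sign.- Sign.+ Sign.+ = ≡.refl
  opposite-triple Sign.- Sign.+ Sign.- = ≡.refl
  opposite-triple Sign.- Sign.- Sign.+ = ≡.refl
  opposite-triple Sign.- Sign.- Sign.- = ≡.refl

  fromSign-opposite : ∀ σ → fromSign (opposite σ) ≈ - fromSign σ
  fromSign-opposite Sign.+ = refl
  fromSign-opposite Sign.- = sym (-‿involutive 1#)

  module CliffordFamily (x+x≈0⇒x≈0 : ∀ x → x + x ≈ 0# → x ≈ 0#)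
      {n m : ℕ} {ε : Vector Sign n} {S : Vector (Matrix m) n} (isCliffordFamily : IsCliffordFamily ε S) where
    open IsCliffordFamily isCliffordFamily public
    open TwoRegular x+x≈0⇒x≈0 public

    e : Vector Carrier n
    e i = fromSign (ε i)

    Q : Vector Carrier m → Vector Carrier n
    Q = quadraticMap S

    quadric : Vector Carrier n → Carrier
    quadric v = ∑[ i < n ] (e i * (v i * v i))

    e² : ∀ i → e i * e i ≈ 1#
    e² i = fromSign-square (ε i)

    fromSign-commutes : ∀ i k → fromSign (opposite (ε i Sign.* ε k)) ≈ - (e i * e k)
    fromSign-commutes i k = trans (fromSign-opposite (ε i Sign.* ε k)) (-‿cong (fromSign-* (ε i) (ε k)))

    -- Transposing reverses the three symmetric factors. Restoring their order takes three
    -- exchanges, whose signs multiply to -1.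
    symmetric-∙∙ : ∀ {i k l} → i ≢ k → l ≢ k → l ≢ i →
                   ∀ a b → ((S k ∙ S i) ∙ S l) a b ≈ - ((S k ∙ S i) ∙ S l) b a
    symmetric-∙∙ {i} {k} {l} i≢k l≢k l≢i a b = begin
      ((S k ∙ S i) ∙ S l) a b                        ≈⟨ transpose-∙ (S k ∙ S i) (S l) a b ⟩
      ((λ u v → S l v u) ∙ (λ u v → (S k ∙ S i) v u)) b a
        ≈⟨ ∙-cong (λ u v → symmetric l v u) (λ u v → trans (transpose-∙ (S k) (S i) v u)
             (∙-cong (λ u v → symmetric i v u) (λ u v → symmetric k v u) u v)) b a ⟩
      (S l ∙ (S i ∙ S k)) b a                        ≈⟨ ∙-congˡ {A = S l} (commutes i≢k) b a ⟩
      (S l ∙ (σ ⊙ (S k ∙ S i))) b a                  ≈⟨ ⊙-∙ʳ σ (S l) (S k ∙ S i) b a ⟩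
      (σ ⊙ (S l ∙ (S k ∙ S i))) b a
          ≈⟨ ⊙-cong σ (Commutes-∙ {σ = τ} {τ = υ} (commutes l≢k) (commutes l≢i)) b a ⟩
      (σ ⊙ (τ Sign.* υ) ⊙ ((S k ∙ S i) ∙ S l)) b a   ≈⟨ ⊙-* σ (τ Sign.* υ) ((S k ∙ S i) ∙ S l) b a ⟩
      ((σ Sign.* (τ Sign.* υ)) ⊙ ((S k ∙ S i) ∙ S l)) b a
        ≡⟨ ≡.cong (λ s → (s ⊙ ((S k ∙ S i) ∙ S l)) b a) (opposite-triple (ε i) (ε k) (ε l)) ⟩
      - 1# * ((S k ∙ S i) ∙ S l) b a                 ≈⟨ solve 1 (λ x → (:- :1) :* x := :- x) refl _ ⟩
      - ((S k ∙ S i) ∙ S l) b a                      ∎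
      where
      open ≈-Reasoning
      σ = opposite (ε i Sign.* ε k)
      τ = opposite (ε l Sign.* ε k)
      υ = opposite (ε l Sign.* ε i)

    -- For l = i the involution collapses the product to S k, for l = k conjugation gives a multiple
    -- of S i, and for any other `l` the product is skew. Writing the cases with `δ` lets a sum over
    -- `l` collapse.
    triple-value : ∀ {i k} → i ≢ k → ∀ w l →
      ((S k ∙ S i) ∙ S l) ⟦ w ⟧ ≈ δ i l * Q w k + δ k l * (- (e k * e i) * Q w i)
    triple-value {i} {k} i≢k w l with l ≟ i | l ≟ k
    ... | yes ≡.refl | _ = begin
      ((S k ∙ S i) ∙ S i) ⟦ w ⟧
          ≈⟨ ⟦⟧-cong (≋-trans (∙-assoc (S k) (S i) (S i)) (≋-trans (∙-congˡ {A = S k} (involution i))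
          (∙-identityʳ (S k)))) ⟩
      Q w k                       ≈⟨ solve 2 (λ x y → x := :1 :* x :+ :0 :* y) refl (Q w k) _ ⟩
      1# * Q w k + 0# * _         ≈⟨ +-cong (*-congʳ (δ-refl i)) (*-congʳ (δ-≢ (λ k≡i → i≢k (≡.sym k≡i)))) ⟨
      δ i i * Q w k + δ k i * _   ∎
      where open ≈-Reasoning
    ... | no _ | yes ≡.refl = begin
      ((S k ∙ S i) ∙ S k) ⟦ w ⟧
          ≈⟨ ⟦⟧-cong (≋-trans (∙-assoc (S k) (S i) (S k)) (Commutes-conj {σ = σ} (involution k)
          (commutes (λ k≡i → i≢k (≡.sym k≡i))))) ⟩
      (σ ⊙ S i) ⟦ w ⟧             ≈⟨ ⟦⟧-⊙ σ (S i) w ⟩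
      fromSign σ * Q w i          ≈⟨ *-congʳ (fromSign-commutes k i) ⟩
      - (e k * e i) * Q w i       ≈⟨ solve 2 (λ x y → y := :0 :* x :+ :1 :* y) refl (Q w k) _ ⟩
      0# * Q w k + 1# * _         ≈⟨ +-cong (*-congʳ (δ-≢ i≢k)) (*-congʳ (δ-refl k)) ⟨
      δ i k * Q w k + δ k k * _   ∎
      where open ≈-Reasoning
            σ = opposite (ε k Sign.* ε i)
    ... | no l≢i | no l≢k = begin
      ((S k ∙ S i) ∙ S l) ⟦ w ⟧   ≈⟨ ⟦⟧-skew _ (symmetric-∙∙ i≢k l≢k l≢i) w ⟩
      0#                          ≈⟨ solve 2 (λ x y → :0 := :0 :* x :+ :0 :* y) refl (Q w k) _ ⟩
      0# * Q w k + 0# * _         ≈⟨ +-cong (*-congʳ (δ-≢ (λ i≡l → l≢i (≡.sym i≡l))))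
          (*-congʳ (δ-≢ (λ k≡l → l≢k (≡.sym k≡l)))) ⟨
      δ i l * Q w k + δ k l * _   ∎
      where open ≈-Reasoning

    module Kernel {w : Vector Carrier m} {c : Vector Carrier n}
                  (kernel : combination c (λ l → S l *ᵥ w) ≋ (λ _ → 0#)) where
      open ≈-Reasoning

      -- Pairing the relation with S i S k w isolates the i-th and k-th terms,
      -- the other products S k S i S l being skew-symmetric.
      kernel-pair : ∀ {i k} → i ≢ k → c i * Q w k ≈ e i * e k * (c k * Q w i)
      kernel-pair {i} {k} i≢k = x∙y⁻¹≈ε⇒x≈y _ _ (begin
        c i * v k + - (e i * e k * (c k * v i))
          ≈⟨ solve 6 (λ x y z t p q → x :* y :+ :- (p :* q :* (z :* t)) := x :* y :+ z :* (:- (q :* p) :* t))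
              refl (c i) (v k) (c k) (v i) (e i) (e k) ⟩
        c i * v k + c k * (- (e k * e i) * v i)
          ≈⟨ +-cong (∑-δ i (λ l → c l * v k)) (∑-δ k (λ l → c l * (- (e k * e i) * v i))) ⟨
        ∑[ l < n ] (δ i l * (c l * v k)) + ∑[ l < n ] (δ k l * (c l * (- (e k * e i) * v i)))
          ≈⟨ ∑-distrib-+ {n} _ _ ⟨
        ∑[ l < n ] (δ i l * (c l * v k) + δ k l * (c l * (- (e k * e i) * v i)))
          ≈⟨ sum-cong-≋ {n} (λ l → solve 5 (λ x y z t s → x :* (y :* z) :+ t :* (y :* s) := y :*
              (x :* z :+ t :* s)) refl (δ i l) (c l) (v k) (δ k l) _) ⟩
        ∑[ l < n ] (c l * (δ i l * v k + δ k l * (- (e k * e i) * v i)))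
          ≈⟨ sum-cong-≋ {n} (λ l → *-congˡ (triple-value i≢k w l)) ⟨
        ∑[ l < n ] (c l * ((S k ∙ S i) ∙ S l) ⟦ w ⟧)
          ≈⟨ sum-cong-≋ {n} (λ l → *-congˡ (sum-cong-≋ {m} (λ a → *-congˡ (∙-*ᵥ (S k ∙ S i) (S l) w a)))) ⟩
        ∑[ l < n ] (c l * (w · ((S k ∙ S i) *ᵥ (S l *ᵥ w))))
          ≈⟨ ·-combination {m} {n} w c _ ⟨
        w · combination c (λ l → (S k ∙ S i) *ᵥ (S l *ᵥ w))
          ≈⟨ ·-zeroʳ {m} w (λ a → trans (sym (·-combination {m} {n} ((S k ∙ S i) a) c _))
              (·-zeroʳ {m} ((S k ∙ S i) a) kernel)) ⟩
        0# ∎)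
        where v = Q w

      -- Squaring `kernel-pair` removes the signs, and the identity so obtained also holds for i =
      -- k. It can thus be summed over all `k` against `e k`, which produces both quadrics.
      kernel-squares : ∀ i k → c i * c i * (Q w k * Q w k) ≈ Q w i * Q w i * (c k * c k)
      kernel-squares i k with i ≟ k
      ... | yes ≡.refl = *-comm _ _
      ... | no i≢k = begin
        c i * c i * (v k * v k)
            ≈⟨ solve 2 (λ x y → x :* x :* (y :* y) := (x :* y) :* (x :* y)) refl (c i) (v k) ⟩
        (c i * v k) * (c i * v k)                            ≈⟨ *-cong (kernel-pair i≢k) (kernel-pair i≢k) ⟩
        (e i * e k * (c k * v i)) * (e i * e k * (c k * v i))
          ≈⟨ solve 4 (λ p q x y → (p :* q :* (x :* y)) :* (p :* q :* (x :* y)) := (p :* p) :* (q :* q) :*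
              (y :* y :* (x :* x))) refl (e i) (e k) (c k) (v i) ⟩
        (e i * e i) * (e k * e k) * (v i * v i * (c k * c k))
            ≈⟨ *-congʳ (trans (*-cong (e² i) (e² k)) (*-identityˡ 1#)) ⟩
        1# * (v i * v i * (c k * c k))                       ≈⟨ *-identityˡ _ ⟩
        v i * v i * (c k * c k)                              ∎
        where v = Q w

      kernel-quadric : ∀ i → c i * c i * quadric (Q w) ≈ Q w i * Q w i * quadric c
      kernel-quadric i = begin
        c i * c i * quadric v                         ≈⟨ *-distribˡ-sum {n} _ _ ⟩
        ∑[ k < n ] (c i * c i * (e k * (v k * v k)))  ≈⟨ sum-cong-≋ {n} (λ k → trans
          (solve 3 (λ x y z → x :* (y :* z) := y :* (x :* z)) refl (c i * c i) (e k) (v k * v k))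
              (trans (*-congˡ (kernel-squares i k))
          (solve 3 (λ x y z → y :* (x :* z) := x :* (y :* z)) refl (v i * v i) (e k) (c k * c k)))) ⟩
        ∑[ k < n ] (v i * v i * (e k * (c k * c k)))  ≈⟨ *-distribˡ-sum {n} _ _ ⟨
        v i * v i * quadric c                         ∎
        where v = Q w

      private
        -- The terms of (∑ e i c i S i) (∑ c k S k) w. Because `e i` stands on one side only, e i S
        -- i S k + e k S k S i = 0 for i ≠ k, by S i S k = - e i e k S k S i and e i e i = 1.
        X : Fin m → Fin n → Fin n → Carrier
        X a i k = e i * (c i * (c k * ((S i ∙ S k) *ᵥ w) a))

        X-symmetrised : ∀ a i k → X a i k + X a k i ≈ δ i k * ((1# + 1#) * (e k * (c k * c k)) * w a)
        X-symmetrised a i k with i ≟ k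
        ... | yes ≡.refl = begin
          X a i i + X a i i  ≈⟨ +-cong eq eq ⟩
          e i * (c i * (c i * w a)) + e i * (c i * (c i * w a))
            ≈⟨ solve 3 (λ x y z → x :* (y :* (y :* z)) :+ x :* (y :* (y :* z)) := :1 :*
                ((:1 :+ :1) :* (x :* (y :* y)) :* z)) refl (e i) (c i) (w a) ⟩
          1# * ((1# + 1#) * (e i * (c i * c i)) * w a) ∎
          where
          eq : X a i i ≈ e i * (c i * (c i * w a))
          eq = *-congˡ (*-congˡ (*-congˡ (trans (sum-cong-≋ {m} (λ l → *-congʳ (involution i a l)))
              (1-*ᵥ w a))))
        ... | no i≢k = begin
          X a i k + X a k i
            ≈⟨ +-congʳ (*-congˡ (*-congˡ (*-congˡ anti))) ⟩
          e i * (c i * (c k * (- (e i * e k) * y))) + e k * (c k * (c i * y))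
            ≈⟨ solve 5 (λ p q x y z → p :* (x :* (y :* (:- (p :* q) :* z))) :+ q :* (y :* (x :* z)) :=
                (:1 :+ :- (p :* p)) :* (q :* x :* y :* z)) refl (e i) (e k) (c i) (c k) y ⟩
          (1# + - (e i * e i)) * (e k * c i * c k * y)
              ≈⟨ *-congʳ (trans (+-congˡ (-‿cong (e² i))) (-‿inverseʳ 1#)) ⟩
          0# * (e k * c i * c k * y)                    ≈⟨ trans (zeroˡ _) (sym (zeroˡ _)) ⟩
          0# * _                                        ∎
          where
          y = ((S k ∙ S i) *ᵥ w) a
          anti : ((S i ∙ S k) *ᵥ w) a ≈ - (e i * e k) * y
          anti = trans (sum-cong-≋ {m}
              (λ l → trans (*-congʳ (trans (commutes i≢k a l) (*-congʳ (fromSign-commutes i k))))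
              (*-assoc _ _ _)))
                       (sym (*-distribˡ-sum {m} _ _))

        ∑∑X≈0 : ∀ a → ∑[ i < n ] ∑[ k < n ] X a i k ≈ 0#
        ∑∑X≈0 a = ∑-zero {n} (λ i → begin
          ∑[ k < n ] (e i * (c i * (c k * ((S i ∙ S k) *ᵥ w) a)))  ≈⟨ *-distribˡ-sum {n} (e i) _ ⟨
          e i * ∑[ k < n ] (c i * (c k * ((S i ∙ S k) *ᵥ w) a))    ≈⟨ *-congˡ (*-distribˡ-sum {n} (c i) _) ⟨
          e i * (c i * ∑[ k < n ] (c k * ((S i ∙ S k) *ᵥ w) a))
            ≈⟨ *-congˡ (*-congˡ (sum-cong-≋ {n} (λ k → *-congˡ (∙-*ᵥ (S i) (S k) w a)))) ⟩
          e i * (c i * ∑[ k < n ] (c k * (S i a · (S k *ᵥ w))))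
              ≈⟨ *-congˡ (*-congˡ (·-combination {m} {n} (S i a) c _)) ⟨
          e i * (c i * (S i a · combination c (λ k → S k *ᵥ w)))
              ≈⟨ *-congˡ (*-congˡ (·-zeroʳ {m} (S i a) kernel)) ⟩
          e i * (c i * 0#)                                         ≈⟨ trans (*-congˡ (zeroʳ _)) (zeroʳ _) ⟩
          0#                                                       ∎)

      -- Apply ∑ e i * c i * S i to the relation: the mixed terms cancel.
      quadric-kernel : ∀ a → quadric c * w a ≈ 0#
      quadric-kernel a = x+x≈0⇒x≈0 _ (begin
        quadric c * w a + quadric c * w a
          ≈⟨ solve 2 (λ x y → x :* y :+ x :* y := (:1 :+ :1) :* x :* y) refl (quadric c) (w a) ⟩
        (1# + 1#) * quadric c * w a
          ≈⟨ *-congʳ (*-distribˡ-sum {n} _ _) ⟩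
        (∑[ k < n ] ((1# + 1#) * (e k * (c k * c k)))) * w a
          ≈⟨ *-distribʳ-sum {n} (w a) _ ⟩
        ∑[ k < n ] ((1# + 1#) * (e k * (c k * c k)) * w a)
          ≈⟨ sum-cong-≋ {n} (λ i → ∑-δ i _) ⟨
        ∑[ i < n ] ∑[ k < n ] (δ i k * ((1# + 1#) * (e k * (c k * c k)) * w a))
          ≈⟨ ∑∑-cong {n} {n} (X-symmetrised a) ⟨
        ∑[ i < n ] ∑[ k < n ] (X a i k + X a k i)
          ≈⟨ ∑∑-distrib-+ {n} {n} _ _ ⟩
        ∑[ i < n ] ∑[ k < n ] X a i k + ∑[ i < n ] ∑[ k < n ] X a k i
          ≈⟨ +-cong (∑∑X≈0 a) (trans (∑-comm {n} {n} _) (∑∑X≈0 a)) ⟩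
        0# + 0#  ≈⟨ +-identityˡ 0# ⟩
        0#       ∎)

      kernel-vanishes : ∀ i a → c i * c i * quadric (Q w) * w a ≈ 0#
      kernel-vanishes i a = begin
        c i * c i * quadric (Q w) * w a     ≈⟨ *-congʳ (kernel-quadric i) ⟩
        Q w i * Q w i * quadric c * w a     ≈⟨ *-assoc _ _ _ ⟩
        Q w i * Q w i * (quadric c * w a)   ≈⟨ *-congˡ (quadric-kernel a) ⟩
        Q w i * Q w i * 0#                  ≈⟨ zeroʳ _ ⟩
        0#                                  ∎

    -- The symmetric tensor with Φ(w,w,w,w) = 3 * quadric (Q w).
    Φ : Fin m → Fin m → Matrix m
    Φ a b c d = ∑[ i < n ] (e i * (S i a b * S i c d + (S i a c * S i b d + S i a d * S i b c)))

    -- The polarisation of ∑ᵢ Q w i * (g i · w).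
    Ψ : Vector (Vector Carrier m) n → Fin m → Matrix m
    Ψ g a b c = ∑[ i < n ] (S i b c * g i a + (S i a b * g i c + S i a c * g i b))

    module _ {Z : Matrix m} (symZ : Symmetric Z) where
      open ≈-Reasoning

      S∙Z∙S : ∀ i a b → S i a · (Z *ᵥ S i b) ≈ (S i ∙ (Z ∙ S i)) a b
      S∙Z∙S i a b = sum-cong-≋ {m} (λ c → *-congˡ (sum-cong-≋ {m} (λ d → *-congˡ (symmetric i b d))))

      -- The first of the three pairings of indices gives a trace. The other two both give S i Z S i
      -- because `Z` is symmetric, whence the factor 2.
      Φ-contraction : ∀ a b → pair Z (Φ a b) ≈
        ∑[ i < n ] (e i * (S i a b * tr (S i ∙ Z) + (1# + 1#) * (S i ∙ (Z ∙ S i)) a b))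
      Φ-contraction a b = trans (pair-∑ {m} {n} Z _) (sum-cong-≋ {n} (λ i → begin
        pair Z (λ c d → e i * (S i a b * S i c d + (S i a c * S i b d + S i a d * S i b c)))
          ≈⟨ pair-* Z _ (e i) ⟩
        e i * pair Z (λ c d → S i a b * S i c d + (S i a c * S i b d + S i a d * S i b c))
          ≈⟨ *-congˡ (trans (pair-+ Z _ _) (+-congˡ (pair-+ Z _ _))) ⟩
        e i * (pair Z (λ c d → S i a b * S i c d) +
          (pair Z (λ c d → S i a c * S i b d) + pair Z (λ c d → S i a d * S i b c)))
          ≈⟨ *-congˡ (+-cong (trans (pair-* Z (S i) (S i a b)) (*-congˡ (pair-tr Z (symmetric i))))
               (+-cong (trans (pair-⊗ Z (S i a) (S i b)) (S∙Z∙S i a b)) (trans (pair-⊗ᵀ symZ (S i a) (S i b))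
                   (S∙Z∙S i a b)))) ⟩
        e i * (S i a b * tr (S i ∙ Z) + ((S i ∙ (Z ∙ S i)) a b + (S i ∙ (Z ∙ S i)) a b))
          ≈⟨ solve 3 (λ x y z → x :* (y :+ (z :+ z)) := x :* (y :+ (:1 :+ :1) :* z)) refl (e i) _ _ ⟩
        e i * (S i a b * tr (S i ∙ Z) + (1# + 1#) * (S i ∙ (Z ∙ S i)) a b) ∎))

      Ψ-contraction : ∀ g a → pair Z (Ψ g a) ≈
        ∑[ i < n ] (tr (S i ∙ Z) * g i a + (1# + 1#) * (S i *ᵥ (Z *ᵥ g i)) a)
      Ψ-contraction g a = trans (pair-∑ {m} {n} Z _) (sum-cong-≋ {n} (λ i → begin
        pair Z (λ b c → S i b c * g i a + (S i a b * g i c + S i a c * g i b))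
          ≈⟨ trans (pair-+ Z _ _) (+-congˡ (pair-+ Z _ _)) ⟩
        pair Z (λ b c → S i b c * g i a) + (pair Z (λ b c → S i a b * g i c) + pair Z
            (λ b c → S i a c * g i b))
          ≈⟨ +-cong (trans (pair-cong {Z = Z} (λ b c → *-comm _ _)) (trans (pair-* Z (S i) (g i a))
              (trans (*-comm _ _) (*-congʳ (pair-tr Z (symmetric i))))))
               (+-cong (pair-⊗ Z (S i a) (g i)) (pair-⊗ᵀ symZ (S i a) (g i))) ⟩
        tr (S i ∙ Z) * g i a + ((S i *ᵥ (Z *ᵥ g i)) a + (S i *ᵥ (Z *ᵥ g i)) a)
          ≈⟨ solve 2 (λ x y → x :+ (y :+ y) := x :+ (:1 :+ :1) :* y) refl _ _ ⟩
        tr (S i ∙ Z) * g i a + (1# + 1#) * (S i *ᵥ (Z *ᵥ g i)) a ∎))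

    -- The three products run over the three ways to pair four indices, so exchanging two indices
    -- only permutes them.
    Φ-swap₂₃ : ∀ a b c d → Φ a b c d ≈ Φ a c b d
    Φ-swap₂₃ a b c d = sum-cong-≋ {n} (λ i → *-congˡ (trans
      (+-congˡ (+-congˡ (*-congˡ (symmetric i b c))))
      (solve 3 (λ x y z → x :+ (y :+ z) := y :+ (x :+ z)) refl _ _ _)))

    Φ-swap₃₄ : ∀ a b c d → Φ a b c d ≈ Φ a b d c
    Φ-swap₃₄ a b c d = sum-cong-≋ {n} (λ i → *-congˡ
      (+-cong (*-congˡ (symmetric i c d)) (+-comm _ _)))

    ∑⁴ : (Fin m → Fin m → Fin m → Fin m → Carrier) → Carrier
    ∑⁴ F = ∑[ a < m ] ∑[ b < m ] ∑[ c < m ] ∑[ d < m ] F a b c d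

    ∑⁴-cong : ∀ {F G} → (∀ a b c d → F a b c d ≈ G a b c d) → ∑⁴ F ≈ ∑⁴ G
    ∑⁴-cong F≈G = ∑∑-cong {m} {m} (λ a b → ∑∑-cong {m} {m} (F≈G a b))

    module _ (contraction≈0 : ∀ k a b → pair (S k) (Φ a b) ≈ 0#) where
      open ≈-Reasoning

      -- One factor `Φ` is expanded into its three pairings. The symmetry of the other factor makes
      -- the three sums equal, and the first contains a contraction of `Φ` with S i in the last two
      -- indices.
      Φ-norm≈0 : ∑⁴ (λ a b c d → Φ a b c d * Φ a b c d) ≈ 0#
      Φ-norm≈0 = begin
        ∑⁴ (λ a b c d → Φ a b c d * Φ a b c d)
          ≈⟨ ∑⁴-cong (λ a b c d → trans (*-distribˡ-sum {n} (Φ a b c d) _) (sum-cong-≋ {n} (λ i →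
               solve 5 (λ p e x y z → p :* (e :* (x :+ (y :+ z))) := e :* (p :* x) :+
                   (e :* (p :* y) :+ e :* (p :* z))) refl
                 (Φ a b c d) (e i) (S i a b * S i c d) (S i a c * S i b d) (S i a d * S i b c)))) ⟩
        ∑⁴ (λ a b c d → ∑[ i < n ] (X i a b c d + (Y i a b c d + Z i a b c d)))
          ≈⟨ ∑∑-cong {m} {m} (λ a b → ∑-comm₃ {n} {m} {m} _) ⟩
        ∑[ a < m ] ∑[ b < m ] ∑[ i < n ] ∑[ c < m ] ∑[ d < m ] (X i a b c d + (Y i a b c d + Z i a b c d))
          ≈⟨ ∑-comm₃ {n} {m} {m} _ ⟩
        ∑[ i < n ] ∑⁴ (λ a b c d → X i a b c d + (Y i a b c d + Z i a b c d))
          ≈⟨ ∑-zero {n} (λ i → trans (∑⁴-+ (X i) _)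
              (trans (+-cong (∑X≈0 i) (trans (∑⁴-+ (Y i) (Z i)) (trans (+-cong (∑Y≈0 i) (∑Z≈0 i))
              (+-identityˡ 0#)))) (+-identityˡ 0#))) ⟩
        0# ∎
        where
        X Y Z : Fin n → Fin m → Fin m → Fin m → Fin m → Carrier
        X i a b c d = e i * (Φ a b c d * (S i a b * S i c d))
        Y i a b c d = e i * (Φ a b c d * (S i a c * S i b d))
        Z i a b c d = e i * (Φ a b c d * (S i a d * S i b c))

        ∑⁴-+ : ∀ F G → ∑⁴ (λ a b c d → F a b c d + G a b c d) ≈ ∑⁴ F + ∑⁴ G
        ∑⁴-+ F G = trans (∑∑-cong {m} {m} (λ a b → ∑∑-distrib-+ {m} {m} (F a b) (G a b)))
            (∑∑-distrib-+ {m} {m} _ _)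

        ∑X≈0 : ∀ i → ∑⁴ (X i) ≈ 0#
        ∑X≈0 i = ∑-zero {m} (λ a → ∑-zero {m} (λ b → begin
          ∑[ c < m ] ∑[ d < m ] X i a b c d
            ≈⟨ ∑∑-cong {m} {m} (λ c d → solve 4 (λ e p x y → e :* (p :* (x :* y)) := (e :* x) :* (y :* p))
                refl (e i) (Φ a b c d) (S i a b) (S i c d)) ⟩
          ∑[ c < m ] ∑[ d < m ] ((e i * S i a b) * (S i c d * Φ a b c d))
            ≈⟨ ∑∑-distribˡ {m} {m} (e i * S i a b) _ ⟩
          (e i * S i a b) * pair (S i) (Φ a b)
            ≈⟨ trans (*-congˡ (contraction≈0 i a b)) (zeroʳ _) ⟩
          0# ∎))

        ∑Y≈0 : ∀ i → ∑⁴ (Y i) ≈ 0#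
        ∑Y≈0 i = begin
          ∑⁴ (Y i)
            ≈⟨ sum-cong-≋ {m} (λ a → ∑-comm {m} {m} _) ⟩
          ∑⁴ (λ a c b d → Y i a b c d)
            ≈⟨ ∑⁴-cong (λ a c b d → *-congˡ (*-congʳ (Φ-swap₂₃ a b c d))) ⟩
          ∑⁴ (X i)
            ≈⟨ ∑X≈0 i ⟩
          0# ∎

        ∑Z≈0 : ∀ i → ∑⁴ (Z i) ≈ 0#
        ∑Z≈0 i = begin
          ∑⁴ (Z i)
            ≈⟨ ∑∑-cong {m} {m} (λ a b → ∑-comm {m} {m} _) ⟩
          ∑⁴ (λ a b d c → Z i a b c d)
            ≈⟨ ∑⁴-cong (λ a b d c → *-congˡ (*-congʳ (Φ-swap₃₄ a b c d))) ⟩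
          ∑⁴ (Y i)
            ≈⟨ ∑Y≈0 i ⟩
          0# ∎

    -- Under q ≤ p and 1 ≤ p + q only (1,1) can violate this: for (1,0) there is no pair of distinct
    -- indices, and for p ≥ 2 a further generator forces the traces to vanish.
    module TraceOrthogonal (trace-orthogonal : ∀ {i k} → i ≢ k → tr (S i ∙ S k) ≈ 0#) where
      open ≈-Reasoning

      two four defect : Carrier
      two    = 1# + 1#
      four   = two + two
      defect = fromℕ m + four + - (two * fromℕ n)

      tr-S∙S : ∀ i k → tr (S i ∙ S k) ≈ δ k i * fromℕ m
      tr-S∙S i k with k ≟ i
      ... | yes ≡.refl = trans (trans (tr-cong (involution k)) (tr-1 {m})) (sym (*-identityˡ _))
      ... | no k≢i     = trans (trace-orthogonal (λ i≡k → k≢i (≡.sym i≡k))) (sym (zeroˡ _))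

      -- The term i = k is written as the generic value - e k plus a correction 2 e k carried by
      -- `δ k i`, so that the sum over `i` is (2 - n) e k S k.
      e*S∙S∙S : ∀ i k a b → e i * (S i ∙ (S k ∙ S i)) a b ≈ (- e k + δ k i * (two * e k)) * S k a b
      e*S∙S∙S i k a b with k ≟ i
      ... | yes ≡.refl = trans
        (*-congˡ (trans (Commutes-conj {σ = Sign.+} (involution k) (Commutes-refl (S k)) a b)
            (*-identityˡ _)))
        (solve 2 (λ e s → e :* s := (:- e :+ :1 :* ((:1 :+ :1) :* e)) :* s) refl (e k) (S k a b))
      ... | no k≢i = begin
        e i * (S i ∙ (S k ∙ S i)) a b
          ≈⟨ *-congˡ (Commutes-conj {σ = opposite (ε i Sign.* ε k)} (involution i)
              (commutes (λ i≡k → k≢i (≡.sym i≡k))) a b) ⟩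
        e i * (fromSign (opposite (ε i Sign.* ε k)) * S k a b)
          ≈⟨ *-congˡ (*-congʳ (fromSign-commutes i k)) ⟩
        e i * (- (e i * e k) * S k a b)
          ≈⟨ solve 3 (λ p q s → p :* (:- (p :* q) :* s) := :- ((p :* p) :* q) :* s) refl (e i) (e k) _ ⟩
        - (e i * e i * e k) * S k a b
          ≈⟨ *-congʳ (-‿cong (trans (*-congʳ (e² i)) (*-identityˡ _))) ⟩
        - e k * S k a b
          ≈⟨ solve 2 (λ q s → :- q :* s := (:- q :+ :0 :* ((:1 :+ :1) :* q)) :* s) refl (e k) _ ⟩
        (- e k + 0# * (two * e k)) * S k a b ∎

      S-contraction : ∀ k a b → pair (S k) (Φ a b) ≈ defect * (e k * S k a b)
      S-contraction k a b = begin
        pair (S k) (Φ a b)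
          ≈⟨ Φ-contraction (symmetric k) a b ⟩
        ∑[ i < n ] (e i * (S i a b * tr (S i ∙ S k) + two * (S i ∙ (S k ∙ S i)) a b))
          ≈⟨ sum-cong-≋ {n} (λ i → trans
               (solve 4 (λ e s t u → e :* (s :* t :+ (:1 :+ :1) :* u) := t :* (e :* s) :+ (:1 :+ :1) :*
                   (e :* u)) refl (e i) (S i a b) _ _)
               (+-cong (trans (*-congʳ (tr-S∙S i k)) (*-assoc _ _ _)) (trans (*-congˡ (e*S∙S∙S i k a b))
               (solve 3 (λ d e s → (:1 :+ :1) :* ((:- e :+ d :* ((:1 :+ :1) :* e)) :* s) := d :*
                   ((:1 :+ :1 :+ (:1 :+ :1)) :* (e :* s)) :+ :- ((:1 :+ :1) :* (e :* s))) refl (δ k i) (e k)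
                   (S k a b))))) ⟩
        ∑[ i < n ] (δ k i * (fromℕ m * (e i * S i a b)) + (δ k i * (four * (e k * S k a b)) + -
            (two * (e k * S k a b))))
          ≈⟨ trans (∑-distrib-+ {n} _ _) (+-congˡ (∑-distrib-+ {n} _ _)) ⟩
        ∑[ i < n ] (δ k i * (fromℕ m * (e i * S i a b))) + (∑[ i < n ] (δ k i * (four * (e k * S k a b))) + ∑[
            i < n ] (- (two * (e k * S k a b))))
          ≈⟨ +-cong (∑-δ k _) (+-cong (∑-δ k _) (∑-const n _)) ⟩
        fromℕ m * (e k * S k a b) + (four * (e k * S k a b) + fromℕ n * - (two * (e k * S k a b)))
          ≈⟨ solve 3 (λ m n s → m :* s :+ ((:1 :+ :1 :+ (:1 :+ :1)) :* s :+ n :* :- ((:1 :+ :1) :* s)) :=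
              (m :+ (:1 :+ :1 :+ (:1 :+ :1)) :+ :- ((:1 :+ :1) :* n)) :* s) refl (fromℕ m) (fromℕ n)
              (e k * S k a b) ⟩
        defect * (e k * S k a b) ∎

      module _ {g : Vector (Vector Carrier m) n} (Ψ≈0 : ∀ a b c → Ψ g a b c ≈ 0#) where

        G : Vector Carrier m
        G = combination e (λ i → S i *ᵥ g i)

        -- Again a generic term and a correction at i = k; the generic terms add up to - e k S k G.
        S*ᵥS*ᵥ : ∀ i k a → (S i *ᵥ (S k *ᵥ g i)) a ≈
                 - e k * (e i * (S k *ᵥ (S i *ᵥ g i)) a) + δ k i * (two * g i a)
        S*ᵥS*ᵥ i k a with k ≟ i
        ... | yes ≡.refl = begin
          (S k *ᵥ (S k *ᵥ g k)) a    ≈⟨ SS ⟩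
          g k a                      ≈⟨ solve 1 (λ x → x := :- (:1 :* x) :+ :1 :* ((:1 :+ :1) :* x)) refl
              (g k a) ⟩
          - (1# * g k a) + 1# * (two * g k a)
            ≈⟨ +-congʳ (-‿cong (*-cong (e² k) SS)) ⟨
          - ((e k * e k) * (S k *ᵥ (S k *ᵥ g k)) a) + 1# * (two * g k a)
            ≈⟨ solve 3 (λ p x y → :- ((p :* p) :* x) :+ y := :- p :* (p :* x) :+ y) refl (e k) _ _ ⟩
          - e k * (e k * (S k *ᵥ (S k *ᵥ g k)) a) + 1# * (two * g k a) ∎
          where
          SS : (S k *ᵥ (S k *ᵥ g k)) a ≈ g k a
          SS = trans (sym (∙-*ᵥ (S k) (S k) (g k) a)) (trans ((involution k *ᵥ-cong (λ _ → refl)) a)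
              (1-*ᵥ (g k) a))
        ... | no k≢i = begin
          (S i *ᵥ (S k *ᵥ g i)) a    ≈⟨ ∙-*ᵥ (S i) (S k) (g i) a ⟨
          ((S i ∙ S k) *ᵥ g i) a
              ≈⟨ sum-cong-≋ {m} (λ l → trans (*-congʳ (trans (commutes (λ i≡k → k≢i (≡.sym i≡k)) a l)
              (*-congʳ (fromSign-commutes i k)))) (*-assoc _ _ _)) ⟩
          ∑[ l < m ] (- (e i * e k) * ((S k ∙ S i) a l * g i l))  ≈⟨ *-distribˡ-sum {m} _ _ ⟨
          - (e i * e k) * ((S k ∙ S i) *ᵥ g i) a                  ≈⟨ *-congˡ (∙-*ᵥ (S k) (S i) (g i) a) ⟩
          - (e i * e k) * (S k *ᵥ (S i *ᵥ g i)) a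
            ≈⟨ solve 4 (λ p q x y → :- (p :* q) :* x := :- q :* (p :* x) :+ :0 :* y) refl (e i) (e k) _
                (two * g i a) ⟩
          - e k * (e i * (S k *ᵥ (S i *ᵥ g i)) a) + 0# * (two * g i a) ∎

        relation-vector : ∀ k a → (fromℕ m + four) * g k a ≈ two * e k * (S k *ᵥ G) a
        relation-vector k a = x∙y⁻¹≈ε⇒x≈y _ _ (begin
          (fromℕ m + four) * g k a + - (two * e k * (S k *ᵥ G) a)
            ≈⟨ solve 4 (λ m x e y → (m :+ (:1 :+ :1 :+ (:1 :+ :1))) :* x :+ :- ((:1 :+ :1) :* e :* y) :=
                (m :* x :+ (:1 :+ :1 :+ (:1 :+ :1)) :* x) :+ :- ((:1 :+ :1) :* e) :* y) refl (fromℕ m) (g k a)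
                (e k) _ ⟩
          (fromℕ m * g k a + four * g k a) + - (two * e k) * (S k *ᵥ G) a
            ≈⟨ +-cong (+-cong (∑-δ k (λ i → fromℕ m * g i a)) (∑-δ k (λ i → four * g i a)))
                (*-congˡ (sym (·-combination {m} {n} (S k a) e _))) ⟨
          (∑[ i < n ] (δ k i * (fromℕ m * g i a)) + ∑[ i < n ] (δ k i * (four * g i a))) + - (two * e k) * ∑[
              i < n ] (e i * (S k *ᵥ (S i *ᵥ g i)) a)
            ≈⟨ +-cong (sym (∑-distrib-+ {n} _ _)) (*-distribˡ-sum {n} _ _) ⟩
          ∑[ i < n ] (δ k i * (fromℕ m * g i a) + δ k i * (four * g i a)) + ∑[ i < n ]
              (- (two * e k) * (e i * (S k *ᵥ (S i *ᵥ g i)) a))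
            ≈⟨ ∑-distrib-+ {n} _ _ ⟨
          ∑[ i < n ] (δ k i * (fromℕ m * g i a) + δ k i * (four * g i a) + - (two * e k) *
              (e i * (S k *ᵥ (S i *ᵥ g i)) a))
            ≈⟨ sum-cong-≋ {n} (λ i → solve 5 (λ d m x e y → d :* (m :* x) :+ d :* ((:1 :+ :1 :+ (:1 :+ :1)) :*
                x) :+ :- ((:1 :+ :1) :* e) :* y := (d :* m) :* x :+ (:1 :+ :1) :*
                (:- e :* y :+ d :* ((:1 :+ :1) :* x))) refl
                 (δ k i) (fromℕ m) (g i a) (e k) (e i * (S k *ᵥ (S i *ᵥ g i)) a)) ⟩
          ∑[ i < n ] ((δ k i * fromℕ m) * g i a + two * (- e k * (e i * (S k *ᵥ (S i *ᵥ g i)) a) + δ k i *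
              (two * g i a)))
            ≈⟨ sum-cong-≋ {n} (λ i → +-cong (*-congʳ (tr-S∙S i k)) (*-congˡ (S*ᵥS*ᵥ i k a))) ⟨
          ∑[ i < n ] (tr (S i ∙ S k) * g i a + two * (S i *ᵥ (S k *ᵥ g i)) a)
            ≈⟨ Ψ-contraction (symmetric k) g a ⟨
          pair (S k) (Ψ g a)
            ≈⟨ ∑-zero {m} (λ b → ∑-zero {m} (λ c → trans (*-congˡ (Ψ≈0 a b c)) (zeroʳ _))) ⟩
          0# ∎)

        -- Applying e k S k to `relation-vector` gives (m + 4) e k S k g k = 2 G, with the same
        -- right-hand side for every `k`; summing over `k` turns the left-hand side into (m + 4) G.
        defect*G : ∀ b → defect * G b ≈ 0#
        defect*G b = begin
          defect * G b
            ≈⟨ solve 3 (λ m n x → (m :+ (:1 :+ :1 :+ (:1 :+ :1)) :+ :- ((:1 :+ :1) :* n)) :* x :=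
                (m :+ (:1 :+ :1 :+ (:1 :+ :1))) :* x :+ :- (n :* ((:1 :+ :1) :* x))) refl (fromℕ m) (fromℕ n)
                (G b) ⟩
          (fromℕ m + four) * G b + - (fromℕ n * (two * G b))
            ≈⟨ +-cong (*-distribˡ-sum {n} _ _) (-‿cong (sym (∑-const n _))) ⟩
          ∑[ k < n ] ((fromℕ m + four) * (e k * (S k *ᵥ g k) b)) + - ∑[ k < n ] (two * G b)
            ≈⟨ +-congʳ (sum-cong-≋ {n} step) ⟩
          ∑[ k < n ] (two * G b) + - ∑[ k < n ] (two * G b)
            ≈⟨ -‿inverseʳ _ ⟩
          0# ∎
          where
          step : ∀ k → (fromℕ m + four) * (e k * (S k *ᵥ g k) b) ≈ two * G b
          step k = begin
            (fromℕ m + four) * (e k * (S k *ᵥ g k) b)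
              ≈⟨ solve 3 (λ x y z → x :* (y :* z) := y :* (x :* z)) refl (fromℕ m + four) (e k) _ ⟩
            e k * ((fromℕ m + four) * (S k *ᵥ g k) b)
              ≈⟨ *-congˡ (*-distribˡ-sum {m} _ _) ⟩
            e k * ∑[ l < m ] ((fromℕ m + four) * (S k b l * g k l))
              ≈⟨ *-congˡ (sum-cong-≋ {m} (λ l → trans (solve 3 (λ x y z → x :* (y :* z) := y :* (x :* z)) refl
                  (fromℕ m + four) (S k b l) (g k l)) (trans (*-congˡ (relation-vector k l))
                  (solve 3 (λ x y z → y :* (x :* z) := x :* (y :* z)) refl (two * e k) (S k b l) _)))) ⟩
            e k * ∑[ l < m ] (two * e k * (S k b l * (S k *ᵥ G) l))
              ≈⟨ *-congˡ (*-distribˡ-sum {m} _ _) ⟨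
            e k * (two * e k * (S k *ᵥ (S k *ᵥ G)) b)
              ≈⟨ solve 2 (λ e x → e :* ((:1 :+ :1) :* e :* x) := (e :* e) :* ((:1 :+ :1) :* x)) refl (e k) _ ⟩
            e k * e k * (two * (S k *ᵥ (S k *ᵥ G)) b)
              ≈⟨ *-cong (e² k) (*-congˡ (trans (sym (∙-*ᵥ (S k) (S k) G b))
                  (trans ((involution k *ᵥ-cong (λ _ → refl)) b) (1-*ᵥ G b)))) ⟩
            1# * (two * G b)
              ≈⟨ *-identityˡ _ ⟩
            two * G b ∎

        -- `relation-vector` passes the vanishing on from `G` to each g k, at the cost of the factor
        -- m + 4, which will be cancelled over ℝ.
        defect*g : ∀ k a → (fromℕ m + four) * (defect * g k a) ≈ 0#
        defect*g k a = begin
          (fromℕ m + four) * (defect * g k a)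
            ≈⟨ solve 3 (λ x y z → x :* (y :* z) := y :* (x :* z)) refl (fromℕ m + four) defect (g k a) ⟩
          defect * ((fromℕ m + four) * g k a)
            ≈⟨ *-congˡ (relation-vector k a) ⟩
          defect * (two * e k * (S k *ᵥ G) a)
            ≈⟨ solve 3 (λ x y z → x :* (y :* z) := y :* (x :* z)) refl defect (two * e k) _ ⟩
          two * e k * (defect * (S k *ᵥ G) a)
            ≈⟨ *-congˡ (*-distribˡ-sum {m} _ _) ⟩
          two * e k * ∑[ l < m ] (defect * (S k a l * G l))
            ≈⟨ *-congˡ (∑-zero {m} (λ l → trans (solve 3 (λ x y z → x :* (y :* z) := y :* (x :* z)) refl
                defect (S k a l) (G l)) (trans (*-congˡ (defect*G l)) (zeroʳ _)))) ⟩
          two * e k * 0#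
            ≈⟨ zeroʳ _ ⟩
          0# ∎

    module _ (Φ≈0 : ∀ a b c d → Φ a b c d ≈ 0#) where
      open ≈-Reasoning

      pair-Φ≈0 : ∀ (Z : Matrix m) a b → pair Z (Φ a b) ≈ 0#
      pair-Φ≈0 Z a b = ∑-zero {m} (λ c → ∑-zero {m} (λ d → trans (*-congˡ (Φ≈0 a b c d)) (zeroʳ _)))

      -- Since S i Z S i = χ i Z and the traces are 0, contracting Φ = 0 with `Z` says 2 (∑ e i χ i)
      -- Z = 0. Multiplying by `Z` leaves the scalar at the diagonal entry `a` of Z Z = 1; the index
      -- `a` records m ≥ 1.
      conjugation-signature : Fin m → ∀ {Z} → Symmetric Z → Involution Z →
        (χ : Vector Sign n) → (∀ i → Commutes (χ i) (S i) Z) → (∀ i → tr (S i ∙ Z) ≈ 0#) →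
        ∑[ i < n ] (e i * fromSign (χ i)) ≈ 0#
      conjugation-signature a {Z} symZ ZZ χ SZ tr≈0 = begin
        x                                ≈⟨ *-identityʳ x ⟨
        x * 1#                           ≈⟨ *-congˡ (trans (ZZ a a) (δ-refl a)) ⟨
        x * (Z ∙ Z) a a                  ≈⟨ *-distribˡ-sum {m} x _ ⟩
        ∑[ l < m ] (x * (Z a l * Z l a))
            ≈⟨ ∑-zero {m} (λ l → trans (sym (*-assoc _ _ _)) (trans (*-congʳ (x*Z≈0 a l)) (zeroˡ _))) ⟩
        0#                               ∎
        where
        x = ∑[ i < n ] (e i * fromSign (χ i))
        x*Z≈0 : ∀ a b → x * Z a b ≈ 0#
        x*Z≈0 a b = x+x≈0⇒x≈0 _ (begin
          x * Z a b + x * Z a b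
            ≈⟨ solve 2 (λ x z → x :* z :+ x :* z := x :* ((:1 :+ :1) :* z)) refl x (Z a b) ⟩
          x * ((1# + 1#) * Z a b)
            ≈⟨ *-distribʳ-sum {n} _ _ ⟩
          ∑[ i < n ] (e i * fromSign (χ i) * ((1# + 1#) * Z a b))
            ≈⟨ sum-cong-≋ {n} (λ i → begin
                 e i * fromSign (χ i) * ((1# + 1#) * Z a b)
                   ≈⟨ solve 4 (λ e f z s → e :* f :* ((:1 :+ :1) :* z) := e :* (s :* :0 :+ (:1 :+ :1) :*
                       (f :* z))) refl (e i) (fromSign (χ i)) (Z a b) (S i a b) ⟩
                 e i * (S i a b * 0# + (1# + 1#) * (fromSign (χ i) * Z a b))
                   ≈⟨ *-congˡ (+-cong (*-congˡ (tr≈0 i))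
                       (*-congˡ (Commutes-conj {σ = χ i} (involution i) (SZ i) a b))) ⟨
                 e i * (S i a b * tr (S i ∙ Z) + (1# + 1#) * (S i ∙ (Z ∙ S i)) a b) ∎) ⟩
          ∑[ i < n ] (e i * (S i a b * tr (S i ∙ Z) + (1# + 1#) * (S i ∙ (Z ∙ S i)) a b))
            ≈⟨ Φ-contraction symZ a b ⟨
          pair Z (Φ a b)
            ≈⟨ pair-Φ≈0 Z a b ⟩
          0# ∎)

      -- Contracting `Φ` twice with W = w ᵗw evaluates it at (w,w,w,w), where each of the three
      -- pairings contributes the square of `Q w i`.
      quadric-Q-triple : ∀ w → (1# + 1# + 1#) * quadric (Q w) ≈ 0#
      quadric-Q-triple w = begin
        (1# + 1# + 1#) * quadric (Q w)
          ≈⟨ *-distribˡ-sum {n} _ _ ⟩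
        ∑[ i < n ] ((1# + 1# + 1#) * (e i * (Q w i * Q w i)))
          ≈⟨ sum-cong-≋ {n} (λ i → begin
               (1# + 1# + 1#) * (e i * (Q w i * Q w i))
                 ≈⟨ solve 2 (λ e q → (:1 :+ :1 :+ :1) :* (e :* (q :* q)) := e :*
                     (q :* q :+ (:1 :+ :1) :* (q :* q))) refl (e i) (Q w i) ⟩
               e i * (Q w i * Q w i + two * (Q w i * Q w i))
                 ≈⟨ *-congˡ (+-cong (*-congˡ (pair-W i))
                     (*-congˡ (trans (pair-WW _ _) (*-congʳ (·-comm _ w))))) ⟨
               e i * (Q w i * pair W (S i) + two * pair W (λ a b → r i a * r i b))
                 ≈⟨ *-congˡ (+-cong (pair-* W (S i) (Q w i)) (pair-* W _ two)) ⟨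
               e i * (pair W (λ a b → Q w i * S i a b) + pair W (λ a b → two * (r i a * r i b)))
                 ≈⟨ *-congˡ (pair-+ W _ _) ⟨
               e i * pair W (λ a b → Q w i * S i a b + two * (r i a * r i b))
                 ≈⟨ pair-* W _ (e i) ⟨
               pair W (λ a b → e i * (Q w i * S i a b + two * (r i a * r i b))) ∎) ⟩
        ∑[ i < n ] pair W (λ a b → e i * (Q w i * S i a b + two * (r i a * r i b)))
          ≈⟨ pair-∑ {m} {n} W _ ⟨
        pair W (λ a b → ∑[ i < n ] (e i * (Q w i * S i a b + two * (r i a * r i b))))
          ≈⟨ pair-cong {Z = W} (λ a b → sum-cong-≋ {n} (λ i → *-congˡ (+-cong
               (trans (*-comm _ _) (*-congˡ (trans (sym (pair-W i)) (pair-tr W (symmetric i)))))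
               (*-congˡ (trans (sym (trans (W*ᵥ (S i a) (S i b)) (*-congˡ (·-comm w (S i b)))))
                   (S∙Z∙S symW i a b)))))) ⟩
        pair W (λ a b → ∑[ i < n ] (e i * (S i a b * tr (S i ∙ W) + two * (S i ∙ (W ∙ S i)) a b)))
          ≈⟨ pair-cong {Z = W} (λ a b → Φ-contraction symW a b) ⟨
        pair W (λ a b → pair W (Φ a b))
          ≈⟨ ∑-zero {m} (λ a → ∑-zero {m} (λ b → trans (*-congˡ (pair-Φ≈0 W a b)) (zeroʳ _))) ⟩
        0# ∎
        where
        two = 1# + 1#
        W : Matrix m
        W a b = w a * w b
        r : Fin n → Vector Carrier m
        r i = S i *ᵥ w

        symW : Symmetric W
        symW a b = *-comm _ _

        pair-W : ∀ i → pair W (S i) ≈ Q w i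
        pair-W i = trans (∑∑-cong {m} {m} (λ a b → *-comm _ _)) (pair-⊗ (S i) w w)

        W*ᵥ : (x y : Vector Carrier m) → x · (W *ᵥ y) ≈ (x · w) * (w · y)
        W*ᵥ x y = trans (sum-cong-≋ {m}
            (λ a → trans (*-congˡ (trans (sum-cong-≋ {m} (λ b → *-assoc _ _ _))
            (sym (*-distribˡ-sum {m} (w a) _)))) (sym (*-assoc _ _ _))))
                        (sym (*-distribʳ-sum {m} (w · y) _))

        pair-WW : (x y : Vector Carrier m) → pair W (λ a b → x a * y b) ≈ (x · w) * (w · y)
        pair-WW x y = trans (pair-⊗ W x y) (W*ᵥ x y)

-- Discrete fields: dual bases and the rank of the differential.

record IsDiscreteField {c ℓ} (K : CommutativeRing c ℓ) : Set (c ⊔ ℓ) where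
  open CommutativeRing K
  infix 4 _≈?_
  field
    _≈?_    : Decidable _≈_
    inverse : ∀ x → ¬ (x ≈ 0#) → ∃ λ y → x * y ≈ 1#
    2≉0     : ¬ (1# + 1# ≈ 0#)

module DiscreteField {c ℓ} {K : CommutativeRing c ℓ} (isDiscreteField : IsDiscreteField K) where
  open IsDiscreteField isDiscreteField public
  open Families K
  open ≈-Reasoning

  private variable m n : ℕ

  integral : ∀ {x y} → ¬ (x ≈ 0#) → x * y ≈ 0# → y ≈ 0#
  integral {x} {y} x≉0 xy≈0 with inverse x x≉0
  ... | z , xz≈1 = begin
    y            ≈⟨ *-identityˡ y ⟨
    1# * y       ≈⟨ *-congʳ xz≈1 ⟨
    x * z * y    ≈⟨ solve 3 (λ x z y → x :* z :* y := z :* (x :* y)) refl x z y ⟩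
    z * (x * y)  ≈⟨ trans (*-congˡ xy≈0) (zeroʳ z) ⟩
    0#           ∎

  square≈0 : ∀ {x} → x * x ≈ 0# → x ≈ 0#
  square≈0 {x} x²≈0 with x ≈? 0#
  ... | yes x≈0 = x≈0
  ... | no x≉0  = integral x≉0 x²≈0

  x+x≈0⇒x≈0 : ∀ x → x + x ≈ 0# → x ≈ 0#
  x+x≈0⇒x≈0 x x+x≈0 = integral 2≉0 (trans (solve 1 (λ x → (:1 :+ :1) :* x := x :+ x) refl x) x+x≈0)

  1≉0 : ¬ (1# ≈ 0#)
  1≉0 1≈0 = 2≉0 (trans (+-cong 1≈0 1≈0) (+-identityˡ 0#))

  ·-linear : (s : Carrier) (x y z : Vector Carrier m) → (λ a → x a + s * y a) · z ≈ x · z + s * (y · z)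
  ·-linear {m} s x y z = begin
    ∑[ a < m ] ((x a + s * y a) * z a)
        ≈⟨ sum-cong-≋ {m} (λ a → solve 4 (λ x s y z → (x :+ s :* y) :* z := x :* z :+ s :* (y :* z)) refl
        (x a) s (y a) (z a)) ⟩
    ∑[ a < m ] (x a * z a + s * (y a * z a))    ≈⟨ ∑-distrib-+ {m} _ _ ⟩
    x · z + ∑[ a < m ] (s * (y a * z a))        ≈⟨ +-congˡ (*-distribˡ-sum {m} s _) ⟨
    x · z + s * (y · z)                         ∎

  -- If every coordinate of `R zero` were 0, then `δ zero` would be the coefficients of a nontrivial
  -- relation. So some coordinate is invertible, and `u` is that coordinate functional, rescaled.
  independent-head : {R : Vector (Vector Carrier m) (suc n)} → LinearlyIndependent R →
                     ∃ λ u → u · R zero ≈ 1#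
  independent-head {m} {n} {R} indep with any? (λ a → ¬? (R zero a ≈? 0#))
  ... | yes (a , Ra≉0) with inverse (R zero a) Ra≉0
  ...   | z , Raz≈1 = (λ b → δ a b * z) , (begin
    ∑[ b < m ] (δ a b * z * R zero b)    ≈⟨ sum-cong-≋ {m} (λ b → *-assoc _ _ _) ⟩
    ∑[ b < m ] (δ a b * (z * R zero b))  ≈⟨ ∑-δ a _ ⟩
    z * R zero a                         ≈⟨ trans (*-comm _ _) Raz≈1 ⟩
    1#                                   ∎)
  independent-head {m} {n} {R} indep | no ∄a = contradiction (indep (δ zero) (λ a → begin
    ∑[ j < suc n ] (δ zero j * R j a)    ≈⟨ ∑-δ {suc n} zero (λ j → R j a) ⟩
    R zero a                             ≈⟨ R₀≈0 a ⟩
    0#                                   ∎) zero) 1≉0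
    where
    R₀≈0 : ∀ a → R zero a ≈ 0#
    R₀≈0 a with R zero a ≈? 0#
    ... | yes Ra≈0 = Ra≈0
    ... | no Ra≉0  = contradiction (a , Ra≉0) ∄a

  -- Gram–Schmidt without positivity: project the remaining vectors along the
  -- first one, using a functional u with u · R zero ≈ 1#.
  dual-basis : (R : Vector (Vector Carrier m) n) → LinearlyIndependent R →
               ∃ λ (h : Vector (Vector Carrier m) n) → ∀ i j → h j · R i ≈ δ i j
  dual-basis {m} {zero}  R indep = (λ ()) , λ ()
  dual-basis {m} {suc n} R indep = h , h-dual
    where
    u : Vector Carrier m
    u = proj₁ (independent-head {R = R} indep)
    uR₀≈1 : u · R zero ≈ 1#
    uR₀≈1 = proj₂ (independent-head {R = R} indep)
    R′ : Vector (Vector Carrier m) n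
    R′ i a = R (suc i) a + - (u · R (suc i)) * R zero a

    indep′ : LinearlyIndependent R′
    indep′ x xR′≈0 i = indep y yR≈0 (suc i)
      where
      y : Vector Carrier (suc n)
      -- The multiples of `R zero` subtracted in `R′` are gathered into one coefficient, giving a
      -- relation among the original vectors.
      y zero    = ∑[ j < n ] (x j * - (u · R (suc j)))
      y (suc j) = x j
      yR≈0 : combination y R ≋ (λ _ → 0#)
      yR≈0 a = begin
        y zero * R zero a + ∑[ j < n ] (x j * R (suc j) a)
          ≈⟨ trans (+-comm _ _) (+-congˡ (*-distribʳ-sum {n} _ _)) ⟩
        ∑[ j < n ] (x j * R (suc j) a) + ∑[ j < n ] (x j * - (u · R (suc j)) * R zero a)
          ≈⟨ ∑-distrib-+ {n} _ _ ⟨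
        ∑[ j < n ] (x j * R (suc j) a + x j * - (u · R (suc j)) * R zero a)
          ≈⟨ sum-cong-≋ {n} (λ j → solve 4 (λ x r s t → x :* r :+ x :* s :* t := x :* (r :+ s :* t)) refl
              (x j) (R (suc j) a) (- (u · R (suc j))) (R zero a)) ⟩
        ∑[ j < n ] (x j * R′ j a)
          ≈⟨ xR′≈0 a ⟩
        0# ∎

    h′ : Vector (Vector Carrier m) n
    h′ = proj₁ (dual-basis R′ indep′)
    h′-dual : ∀ i j → h′ j · R′ i ≈ δ i j
    h′-dual = proj₂ (dual-basis R′ indep′)

    -- As u · R zero = 1, the correction makes the pairing with `R zero` vanish. On the other
    -- vectors, projecting `h′` has the same effect as projecting `R` to `R′`, so the duality of
    -- `h′` and `R′` carries over.
    hₛ : Vector (Vector Carrier m) n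
    hₛ j a = h′ j a + - (h′ j · R zero) * u a

    hₛ-zero : ∀ j → hₛ j · R zero ≈ 0#
    hₛ-zero j = begin
      hₛ j · R zero                                       ≈⟨ ·-linear _ (h′ j) u (R zero) ⟩
      h′ j · R zero + - (h′ j · R zero) * (u · R zero)    ≈⟨ +-congˡ (*-congˡ uR₀≈1) ⟩
      h′ j · R zero + - (h′ j · R zero) * 1#              ≈⟨ solve 1 (λ x → x :+ :- x :* :1 := :0) refl _ ⟩
      0#                                                  ∎

    hₛ-suc : ∀ i j → hₛ j · R (suc i) ≈ δ i j
    hₛ-suc i j = begin
      hₛ j · R (suc i)
        ≈⟨ ·-linear _ (h′ j) u (R (suc i)) ⟩
      h′ j · R (suc i) + - (h′ j · R zero) * (u · R (suc i))
        ≈⟨ solve 3 (λ x y z → x :+ :- y :* z := x :+ :- z :* y) refl _ _ _ ⟩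
      h′ j · R (suc i) + - (u · R (suc i)) * (h′ j · R zero)
        ≈⟨ +-cong (·-comm (h′ j) (R (suc i))) (*-congˡ (·-comm (h′ j) (R zero))) ⟩
      R (suc i) · h′ j + - (u · R (suc i)) * (R zero · h′ j)
        ≈⟨ ·-linear _ (R (suc i)) (R zero) (h′ j) ⟨
      R′ i · h′ j
        ≈⟨ trans (·-comm (R′ i) (h′ j)) (h′-dual i j) ⟩
      δ i j ∎

    -- The values of `u` on the remaining vectors are removed by means of `hₛ`; since `hₛ` vanishes
    -- on `R zero`, the value 1 there survives.
    h₀ : Vector Carrier m
    h₀ a = u a + - 1# * combination (λ j → u · R (suc j)) hₛ a

    h₀-value : ∀ r → h₀ · r ≈ u · r + - (∑[ j < n ] ((u · R (suc j)) * (hₛ j · r)))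
    h₀-value r = begin
      h₀ · r
        ≈⟨ ·-linear (- 1#) u _ r ⟩
      u · r + - 1# * (combination (λ j → u · R (suc j)) hₛ · r)
        ≈⟨ +-congˡ (trans (solve 1 (λ x → (:- :1) :* x := :- x) refl _)
            (-‿cong (trans (·-comm _ r) (trans (·-combination {m} {n} r _ hₛ)
            (sum-cong-≋ {n} (λ j → *-congˡ (·-comm r (hₛ j)))))))) ⟩
      u · r + - (∑[ j < n ] ((u · R (suc j)) * (hₛ j · r))) ∎

    h : Vector (Vector Carrier m) (suc n)
    h zero    = h₀
    h (suc j) = hₛ j

    h-dual : ∀ i j → h j · R i ≈ δ i j
    h-dual zero    (suc j) = hₛ-zero j
    h-dual (suc i) (suc j) = hₛ-suc i j
    h-dual zero    zero    = begin
      h₀ · R zero   ≈⟨ h₀-value (R zero) ⟩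
      u · R zero + - (∑[ j < n ] ((u · R (suc j)) * (hₛ j · R zero)))
        ≈⟨ +-cong uR₀≈1 (-‿cong (∑-zero {n} (λ j → trans (*-congˡ (hₛ-zero j)) (zeroʳ _)))) ⟩
      1# + - 0#     ≈⟨ trans (+-congˡ -0#≈0#) (+-identityʳ 1#) ⟩
      1#            ∎
    h-dual (suc i) zero    = begin
      h₀ · R (suc i)   ≈⟨ h₀-value (R (suc i)) ⟩
      u · R (suc i) + - (∑[ j < n ] ((u · R (suc j)) * (hₛ j · R (suc i))))
        ≈⟨ +-congˡ (-‿cong (trans (sum-cong-≋ {n} (λ j → trans (*-comm _ _) (*-congʳ (hₛ-suc i j))))
            (∑-δ i _))) ⟩
      u · R (suc i) + - (u · R (suc i))
        ≈⟨ -‿inverseʳ _ ⟩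
      0#               ∎

  half : ∃ λ h → (1# + 1#) * h ≈ 1#
  half = inverse (1# + 1#) 2≉0

  differential-value : {S : Vector (Matrix m) n} → (∀ i → Symmetric (S i)) → ∀ w h i →
                       differential S w h i ≈ (1# + 1#) * (h · (S i *ᵥ w))
  differential-value {m} {n} {S} symS w h i = begin
    h · (S i *ᵥ w) + w · (S i *ᵥ h)
      ≈⟨ +-congˡ (·-*ᵥ-symmetric (symS i) w h) ⟩
    h · (S i *ᵥ w) + h · (S i *ᵥ w)
      ≈⟨ solve 1 (λ x → x :+ x := (:1 :+ :1) :* x) refl _ ⟩
    (1# + 1#) * (h · (S i *ᵥ w)) ∎

  -- The differential in the direction `h` is 2 (h · S i w). Halving a basis dual to the vectors S i
  -- w therefore gives directions that are mapped to the standard basis.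
  independent⇒HasRank : {S : Vector (Matrix m) n} → (∀ i → Symmetric (S i)) → ∀ w →
    LinearlyIndependent (λ i → S i *ᵥ w) → HasRank (differential S w) n
  independent⇒HasRank {m} {n} {S} symS w indep = h , independent , spanning
    where
    h₀ = proj₁ (dual-basis {n = n} _ indep)
    h : Vector (Vector Carrier m) n
    h j a = proj₁ half * h₀ j a

    L = differential S w

    L-h : ∀ i j → L (h j) i ≈ δ i j
    L-h i j = begin
      L (h j) i
        ≈⟨ differential-value symS w (h j) i ⟩
      (1# + 1#) * (h j · (S i *ᵥ w))
        ≈⟨ *-congˡ (trans (sum-cong-≋ {m} (λ a → *-assoc _ _ _)) (sym (*-distribˡ-sum {m} _ _))) ⟩
      (1# + 1#) * (proj₁ half * (h₀ j · (S i *ᵥ w)))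
        ≈⟨ trans (sym (*-assoc _ _ _)) (*-congʳ (proj₂ half)) ⟩
      1# * (h₀ j · (S i *ᵥ w))
        ≈⟨ trans (*-identityˡ _) (proj₂ (dual-basis {n = n} _ indep) i j) ⟩
      δ i j ∎

    coordinates : ∀ x i → combination x (λ j → L (h j)) i ≈ x i
    coordinates x i = trans (sum-cong-≋ {n} (λ j → trans (*-congˡ (L-h i j)) (*-comm _ _))) (∑-δ i x)

    independent : LinearlyIndependent (λ j → L (h j))
    independent x Lx≈0 i = trans (sym (coordinates x i)) (Lx≈0 i)

    spanning : ∀ v → ∃ λ x → L v ≋ combination x (λ j → L (h j))
    spanning v = L v , λ i → sym (coordinates (L v) i)

  -- By `kernel-vanishes`, a nonzero coefficient together with P(Q(w)) ≠ 0 makes every coordinate of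
  -- `w` vanish; but then Q w = 0, a contradiction.
  regular⇒independent : {ε : Vector Sign n} {S : Vector (Matrix m) n} (F : IsCliffordFamily ε S) →
    let open CliffordFamily x+x≈0⇒x≈0 F in
    ∀ w → ¬ (quadric (Q w) ≈ 0#) → LinearlyIndependent (λ i → S i *ᵥ w)
  regular⇒independent {n} {m} {S = S} F w Pw≉0 c kernel i with c i ≈? 0#
  ... | yes ci≈0 = ci≈0
  ... | no ci≉0  = contradiction Pw≈0 Pw≉0
    where
    open CliffordFamily x+x≈0⇒x≈0 F
    open Kernel kernel
    w≈0 : ∀ a → w a ≈ 0#
    w≈0 a = integral Pw≉0 (integral (λ c²≈0 → ci≉0 (square≈0 c²≈0)) (trans (sym (*-assoc _ _ _))
        (kernel-vanishes i a)))
    Pw≈0 : quadric (Q w) ≈ 0#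
    Pw≈0 = ∑-zero {n} (λ k → trans
        (*-congˡ (trans (*-congʳ (∑-zero {m} (λ a → trans (*-congʳ (w≈0 a)) (zeroˡ _)))) (zeroˡ _)))
        (zeroʳ _))

-- The sign pattern of P.

signature : ∀ p q → Vector Sign (p ℕ.+ q)
signature p q = (λ (_ : Fin p) → Sign.+) Vector.++ (λ (_ : Fin q) → Sign.-)

signature-↑ˡ : ∀ p q i → signature p q (i ↑ˡ q) ≡ Sign.+
signature-↑ˡ p q i = lookup-++ˡ {m = p} _ _ i

signature-↑ʳ : ∀ p q j → signature p q (p ↑ʳ j) ≡ Sign.-
signature-↑ʳ p q j = lookup-++ʳ {m = p} {n = q} (λ _ → Sign.+) _ j

module Signature {c ℓ} (K : CommutativeRing c ℓ) (p q : ℕ) where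
  open Families K

  ∑-signature : (f : Vector Carrier (p ℕ.+ q)) → ∑[ i < p ℕ.+ q ] (fromSign (signature p q i) * f i) ≈
                ∑[ i < p ] f (i ↑ˡ q) + - (∑[ j < q ] f (p ↑ʳ j))
  ∑-signature f = trans (∑-split p _) (+-cong
    (sum-cong-≋ {p} (λ i → trans (*-congʳ (reflexive (≡.cong fromSign (signature-↑ˡ p q i))))
        (*-identityˡ _)))
    (trans (sum-cong-≋ {q} (λ j → trans (*-congʳ (reflexive (≡.cong fromSign (signature-↑ʳ p q j))))
        (solve 1 (λ x → (:- :1) :* x := :- x) refl _)))
           (∑-neg {q} _)))

  P≈quadric : ∀ v → P p q v ≈ ∑[ i < p ℕ.+ q ] (fromSign (signature p q i) * (v i * v i))
  P≈quadric v = sym (∑-signature (λ i → v i * v i))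

-- Positivity and characteristic zero in ℝ.

module RealField {c ℓ₁ ℓ₂} (ℝ : Reals c ℓ₁ ℓ₂) where
  open Reals ℝ using (commutativeRing; _<_; 0<1; +-monoˡ-<; *-pos; isStrictTotalOrder; inverse)
  open IsStrictTotalOrder isStrictTotalOrder using (compare; <-respˡ-≈; <-respʳ-≈)
    renaming (_≟_ to _≈?_; irrefl to <-irrefl; trans to <-trans; asym to <-asym)
  open Matrices commutativeRing

  Nonnegative : Carrier → Set ℓ₂
  Nonnegative x = ¬ (x < 0#)

  +-pos : ∀ {x y} → 0# < x → Nonnegative y → 0# < x + y
  +-pos {x} {y} 0<x y≮0 with compare y 0#
  ... | tri< y<0 _ _ = contradiction y<0 y≮0
  ... | tri≈ _ y≈0 _ = <-respʳ-≈ (sym (trans (+-congˡ y≈0) (+-identityʳ x))) 0<x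
  ... | tri> _ _ 0<y = <-trans 0<y (<-respˡ-≈ (+-identityˡ y) (+-monoˡ-< y 0<x))

  pos⇒nonneg : ∀ {x} → 0# < x → Nonnegative x
  pos⇒nonneg 0<x = <-asym 0<x

  nonneg-0 : ∀ {x} → x ≈ 0# → Nonnegative x
  nonneg-0 x≈0 x<0 = <-irrefl x≈0 x<0

  nonneg-resp : ∀ {x y} → x ≈ y → Nonnegative x → Nonnegative y
  nonneg-resp x≈y x≮0 y<0 = x≮0 (<-respˡ-≈ (sym x≈y) y<0)

  nonneg-+ : ∀ {x y} → Nonnegative x → Nonnegative y → Nonnegative (x + y)
  nonneg-+ {x} {y} x≮0 y≮0 with compare x 0#
  ... | tri< x<0 _ _ = contradiction x<0 x≮0
  ... | tri≈ _ x≈0 _ = nonneg-resp (sym (trans (+-congʳ x≈0) (+-identityˡ y))) y≮0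
  ... | tri> _ _ 0<x = pos⇒nonneg (+-pos 0<x y≮0)

  nonneg-square : ∀ x → Nonnegative (x * x)
  nonneg-square x with compare x 0#
  ... | tri< x<0 _ _ = pos⇒nonneg (<-respʳ-≈ (solve 1 (λ x → :- x :* :- x := x :* x) refl x)
      (*-pos 0<-x 0<-x))
    where
    0<-x : 0# < - x
    0<-x = <-respʳ-≈ (+-identityˡ (- x)) (<-respˡ-≈ (-‿inverseʳ x) (+-monoˡ-< (- x) x<0))
  ... | tri≈ _ x≈0 _ = nonneg-0 (trans (*-congʳ x≈0) (zeroˡ x))
  ... | tri> _ _ 0<x = pos⇒nonneg (*-pos 0<x 0<x)

  nonneg-+≈0ˡ : ∀ {x y} → Nonnegative x → Nonnegative y → x + y ≈ 0# → x ≈ 0#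
  nonneg-+≈0ˡ {x} {y} x≮0 y≮0 x+y≈0 with compare x 0#
  ... | tri< x<0 _ _ = contradiction x<0 x≮0
  ... | tri≈ _ x≈0 _ = x≈0
  ... | tri> _ _ 0<x = contradiction (+-pos 0<x y≮0) (<-irrefl (sym x+y≈0))

  nonneg-+≈0ʳ : ∀ {x y} → Nonnegative x → Nonnegative y → x + y ≈ 0# → y ≈ 0#
  nonneg-+≈0ʳ x≮0 y≮0 x+y≈0 = nonneg-+≈0ˡ y≮0 x≮0 (trans (+-comm _ _) x+y≈0)

  nonneg-∑ : ∀ {n} {f : Vector Carrier n} → (∀ i → Nonnegative (f i)) → Nonnegative (sum f)
  nonneg-∑ {zero}  f≮0 = nonneg-0 refl
  nonneg-∑ {suc n} f≮0 = nonneg-+ (f≮0 zero) (nonneg-∑ {n} (λ i → f≮0 (suc i)))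

  nonneg-∑≈0 : ∀ {n} {f : Vector Carrier n} → (∀ i → Nonnegative (f i)) → sum f ≈ 0# → ∀ i → f i ≈ 0#
  nonneg-∑≈0 {suc n} f≮0 ∑f≈0 zero    =
    nonneg-+≈0ˡ (f≮0 zero) (nonneg-∑ {n} (λ i → f≮0 (suc i))) ∑f≈0
  nonneg-∑≈0 {suc n} f≮0 ∑f≈0 (suc i) = nonneg-∑≈0 {n} (λ i → f≮0 (suc i))
    (nonneg-+≈0ʳ (f≮0 zero) (nonneg-∑ {n} (λ i → f≮0 (suc i))) ∑f≈0) i

  nonneg-fromℕ : ∀ n → Nonnegative (fromℕ n)
  nonneg-fromℕ n = nonneg-resp (trans (∑-const n 1#) (*-identityʳ _)) (nonneg-∑ {n} (λ _ → pos⇒nonneg 0<1))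

  fromℕ-suc : ∀ n → fromℕ (suc n) ≈ 1# + fromℕ n
  fromℕ-suc n = trans (sym (*-identityʳ _)) (trans (sym (∑-const (suc n) 1#))
      (+-congˡ (trans (∑-const n 1#) (*-identityʳ _))))

  fromℕ-suc≉0 : ∀ n → ¬ (fromℕ (suc n) ≈ 0#)
  fromℕ-suc≉0 n ≈0 = <-irrefl (sym ≈0) (<-respʳ-≈ (sym (fromℕ-suc n)) (+-pos 0<1 (nonneg-fromℕ n)))

  -- This turns the scalar identities obtained from contractions into equations between natural
  -- numbers.
  fromℕ-injective : ∀ m n → fromℕ m ≈ fromℕ n → m ≡ n
  fromℕ-injective zero    zero    eq = ≡.refl
  fromℕ-injective zero    (suc n) eq = contradiction (sym eq) (fromℕ-suc≉0 n)
  fromℕ-injective (suc m) zero    eq = contradiction eq (fromℕ-suc≉0 m)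
  fromℕ-injective (suc m) (suc n) eq = ≡.cong suc (fromℕ-injective m n (begin
    fromℕ m                  ≈⟨ solve 1 (λ x → x := :1 :+ x :+ :- :1) refl _ ⟩
    1# + fromℕ m + - 1#      ≈⟨ +-congʳ (trans (sym (fromℕ-suc m)) (trans eq (fromℕ-suc n))) ⟩
    1# + fromℕ n + - 1#      ≈⟨ solve 1 (λ x → x := :1 :+ x :+ :- :1) refl _ ⟨
    fromℕ n                  ∎))
    where open ≈-Reasoning

  isDiscreteField : IsDiscreteField commutativeRing
  isDiscreteField = record
    { _≈?_    = _≈?_
    ; inverse = inverse
    ; 2≉0     = fromℕ-suc≉0 1
    }

-- The complex numbers as a discrete field.

module ComplexField {c ℓ₁ ℓ₂} (ℝ : Reals c ℓ₁ ℓ₂) where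
  open Reals ℝ using (commutativeRing)
  open RealField ℝ hiding (isDiscreteField)
  open CommutativeRing commutativeRing hiding (zero)
  open IntegerSolver commutativeRing using (solve; _:=_; _:+_; _:*_; :-_; :0; :1)
  private
    module Realᶠ = DiscreteField (RealField.isDiscreteField ℝ)
    module ℂ = RawRing (Complex rawRing)

  -- The operations are those of `Complex`, so results about this ring apply literally to the
  -- matrices, the rank and the quartic in `Degenerate`.
  complexRing : CommutativeRing c ℓ₁
  complexRing = record
    { Carrier = ℂ.Carrier
    ; _≈_ = ℂ._≈_
    ; _+_ = ℂ._+_
    ; _*_ = ℂ._*_
    ; -_  = ℂ.-_
    ; 0#  = ℂ.0#
    ; 1#  = ℂ.1#
    ; isCommutativeRing = record
      { isRing = record
        { +-isAbelianGroup = record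
          { isGroup = record
            { isMonoid = record
              { isSemigroup = record
                { isMagma = record
                  { isEquivalence = record
                    { refl  = refl , refl
                    ; sym   = λ (p , q) → sym p , sym q
                    ; trans = λ (p , q) (r , s) → trans p r , trans q s
                    }
                  ; ∙-cong = λ (p , q) (r , s) → +-cong p r , +-cong q s
                  }
                ; assoc = λ (a , b) (c , d) (e , f) → +-assoc a c e , +-assoc b d f
                }
              ; identity = (λ (a , b) → +-identityˡ a , +-identityˡ b) , (λ (a , b) → +-identityʳ a ,
                  +-identityʳ b)
              }
            ; inverse = (λ (a , b) → -‿inverseˡ a , -‿inverseˡ b) , (λ (a , b) → -‿inverseʳ a , -‿inverseʳ b)
            ; ⁻¹-cong = λ (p , q) → -‿cong p , -‿cong q
            }
          ; comm = λ (a , b) (c , d) → +-comm a c , +-comm b d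
          }
        ; *-cong = λ (p , q) (r , s) → +-cong (*-cong p r) (-‿cong (*-cong q s)) , +-cong (*-cong p s)
            (*-cong q r)
        ; *-assoc = λ (a , b) (c , d) (e , f) →
            solve 6 (λ a b c d e f → (a :* c :+ :- (b :* d)) :* e :+ :- ((a :* d :+ b :* c) :* f) := a :*
                (c :* e :+ :- (d :* f)) :+ :- (b :* (c :* f :+ d :* e))) refl a b c d e f ,
            solve 6 (λ a b c d e f → (a :* c :+ :- (b :* d)) :* f :+ (a :* d :+ b :* c) :* e := a :*
                (c :* f :+ d :* e) :+ b :* (c :* e :+ :- (d :* f))) refl a b c d e f
        ; *-identity =
            (λ (a , b) → solve 2 (λ a b → :1 :* a :+ :- (:0 :* b) := a) refl a b , solve 2
                (λ a b → :1 :* b :+ :0 :* a := b) refl a b) ,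
            (λ (a , b) → solve 2 (λ a b → a :* :1 :+ :- (b :* :0) := a) refl a b , solve 2
                (λ a b → a :* :0 :+ b :* :1 := b) refl a b)
        ; distrib =
            (λ (a , b) (c , d) (e , f) →
              solve 6 (λ a b c d e f → a :* (c :+ e) :+ :- (b :* (d :+ f)) := (a :* c :+ :- (b :* d)) :+
                  (a :* e :+ :- (b :* f))) refl a b c d e f ,
              solve 6 (λ a b c d e f → a :* (d :+ f) :+ b :* (c :+ e) := (a :* d :+ b :* c) :+
                  (a :* f :+ b :* e)) refl a b c d e f) ,
            (λ (a , b) (c , d) (e , f) →
              solve 6 (λ a b c d e f → (c :+ e) :* a :+ :- ((d :+ f) :* b) := (c :* a :+ :- (d :* b)) :+
                  (e :* a :+ :- (f :* b))) refl a b c d e f ,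
              solve 6 (λ a b c d e f → (c :+ e) :* b :+ (d :+ f) :* a := (c :* b :+ d :* a) :+
                  (e :* b :+ f :* a)) refl a b c d e f)
        }
      ; *-comm = λ (a , b) (c , d) →
          solve 4 (λ a b c d → a :* c :+ :- (b :* d) := c :* a :+ :- (d :* b)) refl a b c d ,
          solve 4 (λ a b c d → a :* d :+ b :* c := c :* b :+ d :* a) refl a b c d
      }
    }

  open Families complexRing using () renaming (sum to sumℂ)
  open Families commutativeRing using (sum)

  ∑-complex : ∀ {n} (f : Vector ℂ.Carrier n) →
              sumℂ f ℂ.≈ (sum (λ i → proj₁ (f i)) , sum (λ i → proj₂ (f i)))
  ∑-complex {zero}  f = refl , refl
  ∑-complex {suc n} f with ∑-complex {n} (λ i → f (suc i))
  ... | p , q = +-congˡ p , +-congˡ q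

  isDiscreteField : IsDiscreteField complexRing
  isDiscreteField = record
    { _≈?_    = λ (a , b) (c , d) → (a Realᶠ.≈? c) ×-dec (b Realᶠ.≈? d)
    ; inverse = λ (a , b) ab≉0 → inverse a b ab≉0
    ; 2≉0     = λ (2≈0 , _) → Realᶠ.2≉0 2≈0
    }
    where
    inverse : ∀ a b → ¬ ((a , b) ℂ.≈ ℂ.0#) → ∃ λ z → (a , b) ℂ.* z ℂ.≈ ℂ.1#
    -- The norm a² + b² is invertible: a vanishing sum of two nonnegative squares has both terms 0.
    inverse a b ab≉0 with Realᶠ.inverse (a * a + b * b) (λ N≈0 → ab≉0
      (Realᶠ.square≈0 (nonneg-+≈0ˡ (nonneg-square a) (nonneg-square b) N≈0) ,
       Realᶠ.square≈0 (nonneg-+≈0ʳ (nonneg-square a) (nonneg-square b) N≈0)))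
    ... | r , Nr≈1 = (a * r , - b * r) ,
      trans (solve 3 (λ a b r → a :* (a :* r) :+ :- (b :* (:- b :* r)) := (a :* a :+ b :* b) :* r) refl a b r)
          Nr≈1 ,
      solve 3 (λ a b r → a :* (:- b :* r) :+ b :* (a :* r) := :0) refl a b r

-- Linear forms, polarisation and the coefficients of the real quartic.

module RealFamily {c ℓ₁ ℓ₂} (ℝ : Reals c ℓ₁ ℓ₂) where
  open RealField ℝ public
  open DiscreteField isDiscreteField public
  open Families (Reals.commutativeRing ℝ) public
  open ≈-Reasoning

  private variable m n : ℕ

  fromℕ-cancel : ∀ n {x} → fromℕ (suc n) * x ≈ 0# → x ≈ 0#
  fromℕ-cancel n = integral (fromℕ-suc≉0 n)

  ∑≈0-+ : {f g : Vector Carrier n} → sum f ≈ 0# → sum g ≈ 0# → ∑[ i < n ] (f i + g i) ≈ 0#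
  ∑≈0-+ {n} {f} {g} ∑f≈0 ∑g≈0 = trans (∑-distrib-+ f g) (trans (+-cong ∑f≈0 ∑g≈0) (+-identityˡ 0#))

  ∑≈0-neg : {f : Vector Carrier n} → sum f ≈ 0# → ∑[ i < n ] (- f i) ≈ 0#
  ∑≈0-neg {n} {f} ∑f≈0 = trans (∑-neg f) (trans (-‿cong ∑f≈0) -0#≈0#)

  linearForm-combination : {f : Vector Carrier m → Carrier} → IsLinearForm f →
    (c : Vector Carrier n) (v : Vector (Vector Carrier m) n) → f (combination c v) ≈ ∑[ j < n ]
        (c j * f (v j))
  linearForm-combination {n = zero} linear c v = LM.0ᴹ-homo
    where module LM = LeftModuleMorphisms.IsLeftModuleHomomorphism linear
  linearForm-combination {n = suc n} linear c v =
    trans (LM.+ᴹ-homo _ _) (+-cong (LM.*ₗ-homo _ _) (linearForm-combination {n = n} linear (λ j → c (suc j))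
        (λ j → v (suc j))))
    where module LM = LeftModuleMorphisms.IsLeftModuleHomomorphism linear

  linearForm-basis : {f : Vector Carrier m → Carrier} → IsLinearForm f → ∀ w →
                     f w ≈ ∑[ a < m ] (w a * f (δ a))
  linearForm-basis {m} linear w =
    trans (LM.⟦⟧-cong (λ b → sym (∑-δʳ b w))) (linearForm-combination {n = m} linear w δ)
    where module LM = LeftModuleMorphisms.IsLeftModuleHomomorphism linear

  coordinate-linear : (s : Carrier) (u : Vector Carrier m) → IsLinearForm (λ w → s * (u · w))
  coordinate-linear {m} s u = record
    { +ᴹ-isGroupHomomorphism = record
      { isMonoidHomomorphism = record
        { isMagmaHomomorphism = record
          { isRelHomomorphism = record { cong = λ v≋w → *-congˡ (sum-cong-≋ {m} (λ a → *-congˡ (v≋w a))) }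
          ; homo = λ v w → trans (*-congˡ (trans (sum-cong-≋ {m} (λ a → distribˡ _ _ _))
              (∑-distrib-+ {m} _ _))) (distribˡ _ _ _)
          }
        ; ε-homo = trans (*-congˡ (∑-zero {m} (λ a → zeroʳ _))) (zeroʳ _)
        }
      ; ⁻¹-homo = λ w → trans (*-congˡ (trans (sum-cong-≋ {m} (λ a → sym (-‿distribʳ-* _ _))) (∑-neg {m} _)))
          (sym (-‿distribʳ-* _ _))
      }
    ; *ₗ-homo = λ x w → trans
        (*-congˡ (trans (sum-cong-≋ {m} (λ a → solve 3 (λ u x w → u :* (x :* w) := x :* (u :* w)) refl (u a) x
            (w a))) (sym (*-distribˡ-sum {m} x _))))
        (solve 3 (λ s x y → s :* (x :* y) := x :* (s :* y)) refl s x _)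
    }

  module Polar {S : Vector (Matrix m) n} (symS : ∀ i → Symmetric (S i)) where

    polar : Fin n → Vector Carrier m → Vector Carrier m → Carrier
    polar i x y = x · (S i *ᵥ y)

    polar-comm : ∀ i x y → polar i x y ≈ polar i y x
    polar-comm i = ·-*ᵥ-symmetric (symS i)

    polar-linear : ∀ i x t y z → polar i (λ a → x a + t * y a) z ≈ polar i x z + t * polar i y z
    polar-linear i x t y z = ·-linear t x y (S i *ᵥ z)

    polar-basis : ∀ i a b → polar i (δ a) (δ b) ≈ S i a b
    polar-basis i a b = begin
      ∑[ c < m ] (δ a c * (S i c · δ b))   ≈⟨ ∑-δ a _ ⟩
      ∑[ c < m ] (S i a c * δ b c)         ≈⟨ trans (sum-cong-≋ {m} (λ c → *-comm _ _)) (∑-δ b _) ⟩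
      S i a b                              ∎

    Q-linear : ∀ i x t y → S i ⟦ (λ a → x a + t * y a) ⟧ ≈
               S i ⟦ x ⟧ + ((1# + 1#) * t * polar i x y + t * t * S i ⟦ y ⟧)
    Q-linear i x t y = begin
      polar i x+ty x+ty
        ≈⟨ polar-linear i x t y x+ty ⟩
      polar i x x+ty + t * polar i y x+ty
        ≈⟨ +-cong (trans (expand x) (+-congˡ (*-congˡ (polar-comm i y x)))) (*-congˡ (expand y)) ⟩
      (polar i x x + t * polar i x y) + t * (polar i x y + t * polar i y y)
        ≈⟨ solve 4 (λ p t b q → (p :+ t :* b) :+ t :* (b :+ t :* q) := p :+ ((:1 :+ :1) :* t :* b :+ t :* t :*
            q)) refl _ t _ _ ⟩
      polar i x x + ((1# + 1#) * t * polar i x y + t * t * polar i y y) ∎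
      where
      x+ty = λ a → x a + t * y a
      expand : ∀ z → polar i z x+ty ≈ polar i x z + t * polar i y z
      expand z = trans (polar-comm i z x+ty) (polar-linear i x t y z)

    module _ {f : Vector (Vector Carrier m → Carrier) n} (linear : ∀ i → IsLinearForm (f i))
             (relation : ∀ w → ∑[ i < n ] (S i ⟦ w ⟧ * f i w) ≈ 0#) where

      -- The third difference of the cubic form ∑ S i [w] f i (w) is twice its polarisation, and
      -- each of the seven values entering it is 0 by hypothesis.
      relation-polarised : ∀ x y z →
        ∑[ i < n ] (polar i y z * f i x + (polar i x y * f i z + polar i x z * f i y)) ≈ 0#
      relation-polarised x y z = x+x≈0⇒x≈0 _ (begin
        ∑[ i < n ] ψ i + ∑[ i < n ] ψ i
          ≈⟨ ∑-distrib-+ {n} ψ ψ ⟨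
        ∑[ i < n ] (ψ i + ψ i)
          ≈⟨ sum-cong-≋ {n} step ⟩
        ∑[ i < n ] (((F (x ⊞ y ⊞ z) i + F x i) + (F y i + F z i)) + - ((F (x ⊞ y) i + F (x ⊞ z) i) + F (y ⊞ z)
            i))
          ≈⟨ ∑≈0-+ {n} (∑≈0-+ {n} (∑≈0-+ {n} (relation _) (relation _)) (∑≈0-+ {n} (relation _) (relation _)))
                       (∑≈0-neg {n} (∑≈0-+ {n} (∑≈0-+ {n} (relation _) (relation _)) (relation _))) ⟩
        0# ∎)
        where
        infixl 6 _⊞_
        _⊞_ : Vector Carrier m → Vector Carrier m → Vector Carrier m
        (u ⊞ v) a = u a + 1# * v a
        F : Vector Carrier m → Fin n → Carrier
        F w i = S i ⟦ w ⟧ * f i w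
        ψ : Fin n → Carrier
        ψ i = polar i y z * f i x + (polar i x y * f i z + polar i x z * f i y)
        f-⊞ : ∀ i u v → f i (u ⊞ v) ≈ f i u + f i v
        f-⊞ i u v = trans (LM.+ᴹ-homo _ _) (+-congˡ (trans (LM.*ₗ-homo _ _) (*-identityˡ _)))
          where module LM = LeftModuleMorphisms.IsLeftModuleHomomorphism (linear i)
        Q-⊞ : ∀ i u v → S i ⟦ u ⊞ v ⟧ ≈ S i ⟦ u ⟧ + ((1# + 1#) * polar i u v + S i ⟦ v ⟧)
        Q-⊞ i u v = trans (Q-linear i u 1# v)
          (solve 3 (λ p b q → p :+ ((:1 :+ :1) :* :1 :* b :+ :1 :* :1 :* q) := p :+ ((:1 :+ :1) :* b :+ q))
              refl _ _ _)
        step : ∀ i → ψ i + ψ i ≈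
          ((F (x ⊞ y ⊞ z) i + F x i) + (F y i + F z i)) + - ((F (x ⊞ y) i + F (x ⊞ z) i) + F (y ⊞ z) i)
        step i = begin
          ψ i + ψ i
            ≈⟨ solve 9 (λ fx fy fz qx qy qz xy xz yz →
                 (yz :* fx :+ (xy :* fz :+ xz :* fy)) :+ (yz :* fx :+ (xy :* fz :+ xz :* fy)) :=
                 (((qx :+ ((:1 :+ :1) :* xy :+ qy)) :+ ((:1 :+ :1) :* (xz :+ :1 :* yz) :+ qz)) :*
                     ((fx :+ fy) :+ fz) :+ qx :* fx :+ (qy :* fy :+ qz :* fz)) :+
                 :- (((qx :+ ((:1 :+ :1) :* xy :+ qy)) :* (fx :+ fy) :+ (qx :+ ((:1 :+ :1) :* xz :+ qz)) :*
                     (fx :+ fz)) :+ (qy :+ ((:1 :+ :1) :* yz :+ qz)) :* (fy :+ fz)))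
                 refl (f i x) (f i y) (f i z) (S i ⟦ x ⟧) (S i ⟦ y ⟧) (S i ⟦ z ⟧) (polar i x y) (polar i x z)
                     (polar i y z) ⟩
          (((S i ⟦ x ⟧ + ((1# + 1#) * polar i x y + S i ⟦ y ⟧)) +
              ((1# + 1#) * (polar i x z + 1# * polar i y z) + S i ⟦ z ⟧)) * ((f i x + f i y) + f i z) + F x i
              + (F y i + F z i)) +
          - (((S i ⟦ x ⟧ + ((1# + 1#) * polar i x y + S i ⟦ y ⟧)) * (f i x + f i y) +
              (S i ⟦ x ⟧ + ((1# + 1#) * polar i x z + S i ⟦ z ⟧)) * (f i x + f i z)) +
              (S i ⟦ y ⟧ + ((1# + 1#) * polar i y z + S i ⟦ z ⟧)) * (f i y + f i z))
            ≈⟨ +-cong (+-congʳ (+-congʳ (*-cong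
                 (trans (Q-⊞ i (x ⊞ y) z) (+-cong (Q-⊞ i x y) (+-congʳ (*-congˡ (polar-linear i x 1# y z)))))
                 (trans (f-⊞ i (x ⊞ y) z) (+-congʳ (f-⊞ i x y))))))
                 (-‿cong (+-cong (+-cong (*-cong (Q-⊞ i x y) (f-⊞ i x y)) (*-cong (Q-⊞ i x z) (f-⊞ i x z)))
                     (*-cong (Q-⊞ i y z) (f-⊞ i y z)))) ⟨
          ((F (x ⊞ y ⊞ z) i + F x i) + (F y i + F z i)) + - ((F (x ⊞ y) i + F (x ⊞ z) i) + F (y ⊞ z) i) ∎

  module Quartic {ε : Vector Sign n} {S : Vector (Matrix m) n} (F : IsCliffordFamily ε S) where
    open CliffordFamily x+x≈0⇒x≈0 F public
    open Polar symmetric public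

    relation⇒Ψ≈0 : {f : Vector (Vector Carrier m → Carrier) n} → (∀ i → IsLinearForm (f i)) →
      (∀ w → ∑[ i < n ] (Q w i * f i w) ≈ 0#) → ∀ a b c → Ψ (λ i a → f i (δ a)) a b c ≈ 0#
    relation⇒Ψ≈0 linear relation a b c = trans
      (sum-cong-≋ {n} (λ i → sym (+-cong (*-congʳ (polar-basis i b c)) (+-cong (*-congʳ (polar-basis i a b))
          (*-congʳ (polar-basis i a c))))))
      (relation-polarised linear relation (δ a) (δ b) (δ c))

    module _ (quartic≈0 : ∀ w → quadric (Q w) ≈ 0#) (x y : Vector Carrier m) where
      private
        α β γ : Vector Carrier n
        α = Q x
        β i = polar i x y
        γ = Q y

        A B C D E : Carrier
        A = quadric α
        B = ∑[ i < n ] (e i * (α i * β i))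
        C = ∑[ i < n ] (e i * ((1# + 1#) * (β i * β i) + α i * γ i))
        D = ∑[ i < n ] (e i * (β i * γ i))
        E = quadric γ

        k : ℕ → Carrier
        k = fromℕ

        -- P(Q(x + t y)) is the signed sum of the squares of α i + 2 t β i + t² γ i; the numbers 4,
        -- 2, 4 normalise its middle coefficients.
        expansion : ∀ t → A + (k 4 * t * B + (k 2 * (t * t) * C + (k 4 * (t * t * t) * D + t * t * t * t *
            E))) ≈ 0#
        expansion t = begin
          A + (k 4 * t * B + (k 2 * (t * t) * C + (k 4 * (t * t * t) * D + t * t * t * t * E)))
            ≈⟨ +-congˡ (+-cong (*-distribˡ-sum {n} _ _) (+-cong (*-distribˡ-sum {n} _ _)
                (+-cong (*-distribˡ-sum {n} _ _) (*-distribˡ-sum {n} _ _)))) ⟩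
          ∑[ i < n ] _ + (∑[ i < n ] _ + (∑[ i < n ] _ + (∑[ i < n ] _ + ∑[ i < n ] _)))
            ≈⟨ trans (∑-distrib-+ {n} _ _)
                (+-congˡ (trans (∑-distrib-+ {n} _ _)
                (+-congˡ (trans (∑-distrib-+ {n} _ _) (+-congˡ (∑-distrib-+ {n} _ _)))))) ⟨
          ∑[ i < n ] (e i * (α i * α i) + (k 4 * t * (e i * (α i * β i)) +
              (k 2 * (t * t) * (e i * ((1# + 1#) * (β i * β i) + α i * γ i)) +
            (k 4 * (t * t * t) * (e i * (β i * γ i)) + t * t * t * t * (e i * (γ i * γ i))))))
            ≈⟨ sum-cong-≋ {n} (λ i → trans
                 (solve 5 (λ e t a b g → e :* (a :* a) :+ (con (ℤ.+ 4) :* t :* (e :* (a :* b)) :+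
                     (con (ℤ.+ 2) :* (t :* t) :* (e :* ((:1 :+ :1) :* (b :* b) :+ a :* g)) :+
                   (con (ℤ.+ 4) :* (t :* t :* t) :* (e :* (b :* g)) :+ t :* t :* t :* t :* (e :* (g :* g)))))
                       :=
                   e :* ((a :+ ((:1 :+ :1) :* t :* b :+ t :* t :* g)) :*
                       (a :+ ((:1 :+ :1) :* t :* b :+ t :* t :* g)))) refl (e i) t (α i) (β i) (γ i))
                 (*-congˡ (sym (*-cong (Q-linear i x t y) (Q-linear i x t y))))) ⟩
          quadric (Q (λ a → x a + t * y a))
            ≈⟨ quartic≈0 _ ⟩
          0# ∎

        -- Subtracting the expansion at t = -1 from that at t = 1 leaves 8 B + 8 D.
        odd : B + D ≈ 0#
        odd = fromℕ-cancel 7 (begin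
          k 8 * (B + D)
            ≈⟨ solve 5 (λ a b c d e → con (ℤ.+ 8) :* (b :+ d) :=
                 at a b c d e :1 :+ :- at a b c d e (:- :1)) refl A B C D E ⟩
          _ ≈⟨ trans (+-cong (expansion 1#) (-‿cong (expansion (- 1#)))) (trans (+-identityˡ _) -0#≈0#) ⟩
          0# ∎)
          where
          at : ∀ {j} → Polynomial j → Polynomial j → Polynomial j → Polynomial j → Polynomial j → Polynomial j
              → Polynomial j
          at a b c d e t = a :+ (con (ℤ.+ 4) :* t :* b :+ (con (ℤ.+ 2) :* (t :* t) :* c :+
              (con (ℤ.+ 4) :* (t :* t :* t) :* d :+ t :* t :* t :* t :* e)))

      -- Adding the expansions at t = 1 and t = -1 leaves 2 A + 4 C + 2 E, where A and E are the
      -- values of the quartic at `x` and `y`.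
      quartic-coefficient₂ : C ≈ 0#
      quartic-coefficient₂ = fromℕ-cancel 3 (begin
        k 4 * C
          ≈⟨ solve 5 (λ a b c d e → con (ℤ.+ 4) :* c :=
               (at a b c d e :1 :+ at a b c d e (:- :1)) :+ :- (con (ℤ.+ 2) :* a :+ con (ℤ.+ 2) :* e)) refl A
                   B C D E ⟩
        _ ≈⟨ +-cong (trans (+-cong (expansion 1#) (expansion (- 1#))) (+-identityˡ _))
            (-‿cong (trans (+-cong (trans (*-congˡ (quartic≈0 x)) (zeroʳ _)) (trans (*-congˡ (quartic≈0 y))
            (zeroʳ _))) (+-identityˡ _))) ⟩
        0# + - 0# ≈⟨ -‿inverseʳ 0# ⟩
        0# ∎)
        where
        at : ∀ {j} → Polynomial j → Polynomial j → Polynomial j → Polynomial j → Polynomial j → Polynomial j →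
            Polynomial j
        at a b c d e t = a :+ (con (ℤ.+ 4) :* t :* b :+ (con (ℤ.+ 2) :* (t :* t) :* c :+
            (con (ℤ.+ 4) :* (t :* t :* t) :* d :+ t :* t :* t :* t :* e)))

      -- The value t = 2 separates D from B: the expansion is A + 8 B + 8 C + 32 D + 16 E, and
      -- removing A, 8 C, 16 E and 8 (B + D) leaves 24 D.
      quartic-coefficient₃ : D ≈ 0#
      quartic-coefficient₃ = fromℕ-cancel 23 (begin
        k 24 * D
          ≈⟨ solve 5 (λ a b c d e → con (ℤ.+ 24) :* d :=
               ((a :+ (con (ℤ.+ 4) :* t :* b :+ (con (ℤ.+ 2) :* (t :* t) :* c :+ (con (ℤ.+ 4) :* (t :* t :* t)
                   :* d :+ t :* t :* t :* t :* e)))) :+ con (ℤ.- (ℤ.+ 8)) :* c)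
               :+ (con (ℤ.- (ℤ.+ 8)) :* (b :+ d) :+ (:- a :+ con (ℤ.- (ℤ.+ 16)) :* e))) refl A B C D E ⟩
        _ ≈⟨ +-cong (trans (+-cong (expansion (k 2)) (trans (*-congˡ quartic-coefficient₂) (zeroʳ _)))
            (+-identityˡ _))
               (trans (+-cong (trans (*-congˡ odd) (zeroʳ _))
                   (trans (+-cong (trans (-‿cong (quartic≈0 x)) -0#≈0#) (trans (*-congˡ (quartic≈0 y))
                   (zeroʳ _))) (+-identityˡ _))) (+-identityˡ _)) ⟩
        0# + 0# ≈⟨ +-identityˡ 0# ⟩
        0# ∎)
        where
        t : ∀ {j} → Polynomial j
        t = con (ℤ.+ 2)

      quartic-coefficient₁ : B ≈ 0#
      quartic-coefficient₁ = begin
        B      ≈⟨ +-identityʳ B ⟨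
        B + 0# ≈⟨ +-congˡ quartic-coefficient₃ ⟨
        B + D  ≈⟨ odd ⟩
        0#     ∎

-- Complexification of a real Clifford family.

module Complexification {c ℓ₁ ℓ₂} (ℝ : Reals c ℓ₁ ℓ₂) {n m : ℕ} where
  open RealFamily ℝ
  open ComplexField ℝ using (complexRing; ∑-complex)
  private
    module ℂ = Families complexRing
    module Complexᶠ = DiscreteField (ComplexField.isDiscreteField ℝ)

  ι : Carrier → ℂ.Carrier
  ι x = x , 0#

  ιₘ : Matrix m → ℂ.Matrix m
  ιₘ A i j = ι (A i j)

  ιₘ-∙ : (A B : Matrix m) → ιₘ A ℂ.∙ ιₘ B ℂ.≋ₘ ιₘ (A ∙ B)
  ιₘ-∙ A B i j = ℂ.trans (∑-complex {m} _)
    ( sum-cong-≋ {m} (λ l → solve 2 (λ a b → a :* b :+ :- (:0 :* :0) := a :* b) refl (A i l) (B l j))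
    , ∑-zero {m} (λ l → solve 2 (λ a b → a :* :0 :+ :0 :* b := :0) refl (A i l) (B l j)))

  ι-δ : ∀ i j → ι (δ i j) ℂ.≈ ℂ.δ {m} i j
  ι-δ i j with i ≟ j
  ... | yes _ = ℂ.refl
  ... | no _  = ℂ.refl

  ι-fromSign : ∀ σ → ι (fromSign σ) ℂ.≈ ℂ.fromSign σ
  ι-fromSign Sign.+ = ℂ.refl
  ι-fromSign Sign.- = refl , sym -0#≈0#

  ι-* : ∀ x y z → ι x ℂ.* (y , z) ℂ.≈ (x * y , x * z)
  ι-* x y z = solve 3 (λ x y z → x :* y :+ :- (:0 :* z) := x :* y) refl x y z ,
              solve 3 (λ x y z → x :* z :+ :0 :* y := x :* z) refl x y z

  ιₘ-⊙ : ∀ σ (A : Matrix m) → ιₘ (σ ⊙ A) ℂ.≋ₘ σ ℂ.⊙ ιₘ A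
  ιₘ-⊙ σ A i j = ℂ.sym (ℂ.trans (ℂ.*-congʳ (ℂ.sym (ι-fromSign σ))) (ℂ.trans (ι-* (fromSign σ) (A i j) 0#)
      (refl , zeroʳ _)))

  ι-family : {ε : Vector Sign n} {S : Vector (Matrix m) n} → IsCliffordFamily ε S → ℂ.IsCliffordFamily ε
      (λ i → ιₘ (S i))
  ι-family {ε} {S} F = record
    { symmetric  = λ i a b → symmetric i a b , refl
    ; involution = λ i a b → ℂ.trans (ιₘ-∙ (S i) (S i) a b) (ℂ.trans (involution i a b , refl) (ι-δ a b))
    ; commutes   = λ {i} {k} i≢k a b → ℂ.trans (ιₘ-∙ (S i) (S k) a b) (ℂ.trans (commutes i≢k a b , refl)
        (ℂ.trans (ιₘ-⊙ (opposite (ε i Sign.* ε k)) (S k ∙ S i) a b)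
            (ℂ.*-congˡ (ℂ.sym (ιₘ-∙ (S k) (S i) a b)))))
    }
    where open IsCliffordFamily F

  module _ {S : Vector (Matrix m) n} (symS : ∀ i → Symmetric (S i)) where
    open Polar symS

    ιₘ-⟦⟧ : ∀ i (x y : Vector Carrier m) → ιₘ (S i) ℂ.⟦ (λ a → x a , y a) ⟧ ℂ.≈
             (S i ⟦ x ⟧ + - (S i ⟦ y ⟧) , (1# + 1#) * polar i x y)
    ιₘ-⟦⟧ i x y = ℂ.trans
      (ℂ.sum-cong-≋ {m} (λ a → ℂ.*-congˡ (ℂ.trans (ℂ.sum-cong-≋ {m} (λ b → ι-* (S i a b) (x b) (y b)))
          (∑-complex {m} _))))
      (ℂ.trans (∑-complex {m} _)
        ( trans (∑-distrib-+ {m} _ _) (+-congˡ (∑-neg {m} _))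
        , trans (∑-distrib-+ {m} _ _) (trans (+-congˡ (polar-comm i y x))
            (solve 1 (λ x → x :+ x := (:1 :+ :1) :* x) refl _))))

  quadric-complex : (ε : Vector Sign n) (z : Vector ℂ.Carrier n) →
    ℂ.sum (λ i → ℂ.fromSign (ε i) ℂ.* (z i ℂ.* z i)) ℂ.≈
      ( ∑[ i < n ] (fromSign (ε i) * (proj₁ (z i) * proj₁ (z i) + - (proj₂ (z i) * proj₂ (z i))))
      , ∑[ i < n ] (fromSign (ε i) * (proj₁ (z i) * proj₂ (z i) + proj₂ (z i) * proj₁ (z i))))
  quadric-complex ε z = ℂ.trans
    (ℂ.sum-cong-≋ {n} (λ i → ℂ.trans (ℂ.*-congʳ (ℂ.sym (ι-fromSign (ε i)))) (ι-* (fromSign (ε i)) _ _)))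
    (∑-complex {n} _)

-- Degeneracy and the vanishing of the quartic.

module _ {c ℓ₁ ℓ₂} (ℝ : Reals c ℓ₁ ℓ₂) {p q m : ℕ} where
  open RealFamily ℝ
  open ComplexField ℝ using (complexRing)
  private
    module ℂ = Families complexRing
    module Complexᶠ = DiscreteField (ComplexField.isDiscreteField ℝ)
    n = p ℕ.+ q
    ε = signature p q
  open Complexification ℝ {n} {m}
  open ≈-Reasoning

  module _ {S : Vector (Matrix m) n} (F : IsCliffordFamily ε S) where
    open Quartic F

    QuarticVanishes⇒quadric : QuarticVanishes ℝ p q S → ∀ w → quadric (Q w) ≈ 0#
    QuarticVanishes⇒quadric vanishes w =
      trans (sym (Signature.P≈quadric (Reals.commutativeRing ℝ) p q (Q w))) (vanishes w)

    quadric⇒QuarticVanishes : (∀ w → quadric (Q w) ≈ 0#) → QuarticVanishes ℝ p q S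
    quadric⇒QuarticVanishes quadric≈0 w =
      trans (Signature.P≈quadric (Reals.commutativeRing ℝ) p q (Q w)) (quadric≈0 w)

    quarticVanishes⇒degenerate : QuarticVanishes ℝ p q S → Degenerate ℝ p q S
    quarticVanishes⇒degenerate vanishes ((w , regular) , _) = regular (ℂ.trans
      (Signature.P≈quadric complexRing p q Qw) (ℂ.trans (quadric-complex ε Qw) (ℂ.trans
      ( sum-cong-≋ {n} (λ i → *-congˡ (+-cong (*-cong (re i) (re i)) (-‿cong (*-cong (im i) (im i)))))
      , sum-cong-≋ {n} (λ i → *-congˡ (+-cong (*-cong (re i) (im i)) (*-cong (im i) (re i)))))
      (real-part , imaginary-part))))
      where
      x y : Vector Carrier m
      x a = proj₁ (w a)
      y a = proj₂ (w a)
      Qw = ℂ.quadraticMap (λ i → ιₘ (S i)) w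
      re : ∀ i → proj₁ (Qw i) ≈ Q x i + - Q y i
      re i = proj₁ (ιₘ-⟦⟧ symmetric i x y)
      im : ∀ i → proj₂ (Qw i) ≈ (1# + 1#) * polar i x y
      im i = proj₂ (ιₘ-⟦⟧ symmetric i x y)

      quadric≈0 = QuarticVanishes⇒quadric vanishes

      -- With A, 4 B, 2 C, 4 D, E the coefficients of P(Q(x + t y)), the substitution t = i gives
      -- real part A + E - 2 C and imaginary part 4 (B - D).
      real-part : ∑[ i < n ] (e i * ((Q x i + - Q y i) * (Q x i + - Q y i) + - ((1# + 1#) * polar i x y *
          ((1# + 1#) * polar i x y)))) ≈ 0#
      real-part = trans (sum-cong-≋ {n} (λ i → solve 4 (λ e a b g →
          e :* ((a :+ :- g) :* (a :+ :- g) :+ :- ((:1 :+ :1) :* b :* ((:1 :+ :1) :* b))) :=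
          (e :* (a :* a) :+ e :* (g :* g)) :+ :- (e :* ((:1 :+ :1) :* (b :* b) :+ a :* g) :+ e :*
              ((:1 :+ :1) :* (b :* b) :+ a :* g))) refl (e i) (Q x i) (polar i x y) (Q y i)))
        (∑≈0-+ {n} (∑≈0-+ {n} (quadric≈0 x) (quadric≈0 y)) (∑≈0-neg {n} (∑≈0-+ {n} C≈0 C≈0)))
        where C≈0 = quartic-coefficient₂ quadric≈0 x y

      imaginary-part : ∑[ i < n ] (e i * ((Q x i + - Q y i) * ((1# + 1#) * polar i x y) + (1# + 1#) * polar i
          x y * (Q x i + - Q y i))) ≈ 0#
      imaginary-part = trans (sum-cong-≋ {n} (λ i → solve 4 (λ e a b g →
          e :* ((a :+ :- g) :* ((:1 :+ :1) :* b) :+ (:1 :+ :1) :* b :* (a :+ :- g)) :=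
          con (ℤ.+ 4) :* (e :* (a :* b) :+ :- (e :* (b :* g)))) refl (e i) (Q x i) (polar i x y) (Q y i)))
        (trans (sym (*-distribˡ-sum {n} _ _)) (trans (*-congˡ
          (∑≈0-+ {n} (quartic-coefficient₁ quadric≈0 x y) (∑≈0-neg {n} (quartic-coefficient₃ quadric≈0 x y))))
              (zeroʳ _)))

    -- `Degenerate` being a negation, P(Q(w)) = 0 is decided: a real point with nonzero value would
    -- be a regular complex point, and the rank is full at every regular point.
    degenerate⇒quarticVanishes : Degenerate ℝ p q S → QuarticVanishes ℝ p q S
    degenerate⇒quarticVanishes degenerate w with LinearAlgebra.P (Reals.rawRing ℝ) p q (Q w) ≈? 0#
    ... | yes Pw≈0 = Pw≈0
    ... | no Pw≉0  = contradiction ((ιw , ιw-regular) , rank) degenerate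
      where
      ιw : Vector ℂ.Carrier m
      ιw a = ι (w a)
      Qw = ℂ.quadraticMap (λ i → ιₘ (S i)) ιw
      S⟦0⟧ : ∀ i → S i ⟦ (λ _ → 0#) ⟧ ≈ 0#
      S⟦0⟧ i = ∑-zero {m} (λ a → zeroˡ _)
      re : ∀ i → proj₁ (Qw i) ≈ Q w i
      re i = trans (proj₁ (ιₘ-⟦⟧ symmetric i w (λ _ → 0#))) (trans (+-congˡ (trans (-‿cong (S⟦0⟧ i)) -0#≈0#))
          (+-identityʳ _))
      im : ∀ i → proj₂ (Qw i) ≈ 0#
      im i = trans (proj₂ (ιₘ-⟦⟧ symmetric i w (λ _ → 0#)))
          (trans (*-congˡ (·-zeroʳ {m} w (λ a → ·-zeroʳ {m} (S i a) (λ _ → refl)))) (zeroʳ _))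

      ιw-regular : ¬ (ℂ.P p q Qw ℂ.≈ ℂ.0#)
      ιw-regular Pιw≈0 = Pw≉0 (begin
        P p q (Q w)
          ≈⟨ Signature.P≈quadric (Reals.commutativeRing ℝ) p q (Q w) ⟩
        quadric (Q w)
          ≈⟨ sum-cong-≋ {n} (λ i → *-congˡ
              (trans (+-cong (*-cong (re i) (re i)) (-‿cong (*-cong (im i) (im i))))
               (solve 1 (λ x → x :+ :- (:0 :* :0) := x) refl _))) ⟨
        ∑[ i < n ] (fromSign (ε i) * (proj₁ (Qw i) * proj₁ (Qw i) + - (proj₂ (Qw i) * proj₂ (Qw i))))
          ≈⟨ proj₁ (quadric-complex ε Qw) ⟨
        _ ≈⟨ proj₁ (ℂ.trans (ℂ.sym (Signature.P≈quadric complexRing p q Qw)) Pιw≈0) ⟩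
        0# ∎)

      rank : ∀ z → ¬ (ℂ.P p q (ℂ.quadraticMap (λ i → ιₘ (S i)) z) ℂ.≈ ℂ.0#) → _
      rank z regular = Complexᶠ.independent⇒HasRank (ℂ.IsCliffordFamily.symmetric Fℂ) z
        (Complexᶠ.regular⇒independent Fℂ z
            (λ quadric≈0 → regular (ℂ.trans (Signature.P≈quadric complexRing p q _) quadric≈0)))
        where Fℂ = ι-family F

-- From representations to Clifford families.

split-elim : ∀ {ℓ} p {q} {P : Fin (p ℕ.+ q) → Set ℓ} →
             (∀ a → P (a ↑ˡ q)) → (∀ b → P (p ↑ʳ b)) → ∀ i → P i
split-elim p {q} {P} left right i = ≡.subst P (join-splitAt p q i) (joined (splitAt p i))
  where
  joined : ∀ s → P (join p q s)
  joined (inj₁ a) = left a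
  joined (inj₂ b) = right b

module RepresentationFamily {c ℓ₁ ℓ₂} (ℝ : Reals c ℓ₁ ℓ₂) {p q m : ℕ} (φ : Representation ℝ p q m) where
  open RealFamily ℝ
  open Representation φ
  private
    C = CliffordTensor ℝ p q
    module C = RawAlgebra C
  open IsAlgebraHomomorphism isAlgebraHomomorphism
  open RingMorphisms C.rawRing (RawAlgebra.rawRing (matrices m)) using (module IsRingHomomorphism)
  open IsRingHomomorphism isRingHomomorphism using (+-homo; *-homo; 0#-homo; 1#-homo; -‿homo) renaming
      (⟦⟧-cong to ρ-cong)

  private
    x y : _ → C.Carrier
    x a = [ Defs.e a , Defs.scalar 1# ]
    y b = [ Defs.scalar 1# , Defs.e b ]

    generator-↑ˡ : ∀ a → generator ℝ p q (a ↑ˡ q) ≡ x a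
    generator-↑ˡ a = lookup-++ˡ {m = p} _ _ a

    generator-↑ʳ : ∀ b → generator ℝ p q (p ↑ʳ b) ≡ y b
    generator-↑ʳ b = lookup-++ʳ {m = p} _ _ b

    x² : ∀ a → x a C.* x a C.≈ C.1#
    x² a = Defs.⊗-cong (Defs.e-square a) (Defs.*-identityˡ _)

    y² : ∀ b → y b C.* y b C.≈ C.1#
    y² b = Defs.⊗-cong (Defs.*-identityˡ _) (Defs.e-square b)

    xx : ∀ {a a′} → a ≢ a′ → x a C.* x a′ C.≈ C.- (x a′ C.* x a)
    xx a≢a′ = Defs.⊗-cong (Defs.e-anticommute a≢a′) Defs.reflᶜ

    xy : ∀ a b → x a C.* y b C.≈ y b C.* x a
    xy a b = Defs.⊗-cong
      (Defs.transᶜ (Defs.*-identityʳ _) (Defs.symᶜ (Defs.*-identityˡ _)))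
      (Defs.transᶜ (Defs.*-identityˡ _) (Defs.symᶜ (Defs.*-identityʳ _)))

    -- Negation in the tensor product acts on the left factor, whereas this anticommutation takes
    -- place in the right one. It is therefore stated as a vanishing sum, which distributivity on
    -- the right brings into a single pure tensor.
    yy : ∀ {b b′} → b ≢ b′ → (y b C.* y b′) C.+ (y b′ C.* y b) C.≈ C.0#
    yy {b} {b′} b≢b′ = Defs.transᵗ
      (Defs.symᵗ (Defs.⊗-distribˡ (Defs.scalar 1# Defs.*ᶜ Defs.scalar 1#) (Defs.e b Defs.*ᶜ Defs.e b′)
          (Defs.e b′ Defs.*ᶜ Defs.e b)))
      (Defs.transᵗ (Defs.⊗-cong Defs.reflᶜ (Defs.transᶜ (Defs.+-cong (Defs.e-anticommute b≢b′) Defs.reflᶜ)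
          (Defs.+-inverseˡ _)))
      (Defs.⊗-zeroʳ _))

    ρ-square : ∀ u → u C.* u C.≈ C.1# → Involution (ρ u)
    ρ-square u u²≈1 = ≋-trans (≋-sym (*-homo u u)) (≋-trans (ρ-cong u²≈1) 1#-homo)

    ρ-anticommute : ∀ {u v} → ρ (u C.* v) ≋ₘ -ₘ ρ (v C.* u) → Commutes Sign.- (ρ u) (ρ v)
    ρ-anticommute {u} {v} eq i j =
      trans (sym (*-homo u v i j))
          (trans (eq i j) (trans (-‿cong (*-homo v u i j)) (solve 1 (λ x → :- x := (:- :1) :* x) refl _)))

    ρ-xx : ∀ {a a′} → a ≢ a′ → Commutes Sign.- (ρ (x a)) (ρ (x a′))
    ρ-xx {a} {a′} a≢a′ = ρ-anticommute {x a} {x a′} (≋-trans (ρ-cong (xx a≢a′)) (-‿homo (x a′ C.* x a)))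

    ρ-yy : ∀ {b b′} → b ≢ b′ → Commutes Sign.- (ρ (y b)) (ρ (y b′))
    ρ-yy {b} {b′} b≢b′ = ρ-anticommute {y b} {y b′} (λ i j → begin
      ρ (y b C.* y b′) i j   ≈⟨ solve 2 (λ u v → u := (u :+ v) :+ :- v) refl _ (ρ (y b′ C.* y b) i j) ⟩
      (ρ (y b C.* y b′) i j + ρ (y b′ C.* y b) i j) + - ρ (y b′ C.* y b) i j
        ≈⟨ +-congʳ (trans (sym (+-homo (y b C.* y b′) (y b′ C.* y b) i j)) (trans (ρ-cong (yy b≢b′) i j)
            (0#-homo i j))) ⟩
      0# + - ρ (y b′ C.* y b) i j ≈⟨ +-identityˡ _ ⟩
      - ρ (y b′ C.* y b) i j ∎)
      where open ≈-Reasoning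

    ρ-xy : ∀ a b → Commutes Sign.+ (ρ (x a)) (ρ (y b))
    ρ-xy a b i j = trans (sym (*-homo (x a) (y b) i j))
      (trans (ρ-cong (xy a b) i j) (trans (*-homo (y b) (x a) i j) (sym (*-identityˡ _))))

    Relation : Fin (p ℕ.+ q) → Fin (p ℕ.+ q) → Set ℓ₁
    Relation i k = i ≢ k → Commutes (opposite (signature p q i Sign.* signature p q k)) (basisMatrices i)
        (basisMatrices k)

    relation : ∀ i k → Relation i k
    relation = split-elim p
      (λ a → split-elim p
        (λ a′ i≢k → at (signature-↑ˡ p q a) (signature-↑ˡ p q a′) (generator-↑ˡ a) (generator-↑ˡ a′)
          (ρ-xx (λ a≡a′ → i≢k (≡.cong (_↑ˡ q) a≡a′))))
        (λ b _ → at (signature-↑ˡ p q a) (signature-↑ʳ p q b) (generator-↑ˡ a) (generator-↑ʳ b) (ρ-xy a b)))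
      (λ b → split-elim p
        (λ a _ → at (signature-↑ʳ p q b) (signature-↑ˡ p q a) (generator-↑ʳ b) (generator-↑ˡ a)
            (Commutes-sym {σ = Sign.+} (ρ-xy a b)))
        (λ b′ i≢k → at (signature-↑ʳ p q b) (signature-↑ʳ p q b′) (generator-↑ʳ b) (generator-↑ʳ b′)
          (ρ-yy (λ b≡b′ → i≢k (≡.cong (p ↑ʳ_) b≡b′)))))
      where
      at : ∀ {i k σ τ u v} → signature p q i ≡ σ → signature p q k ≡ τ →
           generator ℝ p q i ≡ u → generator ℝ p q k ≡ v → Commutes (opposite (σ Sign.* τ)) (ρ u) (ρ v) →
           Commutes (opposite (signature p q i Sign.* signature p q k)) (basisMatrices i) (basisMatrices k)
      at ≡.refl ≡.refl ≡.refl ≡.refl uv = uv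

  isCliffordFamily : (∀ i → Symmetric (basisMatrices i)) → IsCliffordFamily (signature p q) basisMatrices
  isCliffordFamily symS = record
    { symmetric  = symS
    ; involution = split-elim p
        (λ a → ≡.subst (λ u → Involution (ρ u)) (≡.sym (generator-↑ˡ a)) (ρ-square (x a) (x² a)))
        (λ b → ≡.subst (λ u → Involution (ρ u)) (≡.sym (generator-↑ʳ b)) (ρ-square (y b) (y² b)))
    ; commutes   = relation _ _
    }

another : ∀ {n} → n ≢ 1 → (i : Fin n) → ∃ λ i′ → i′ ≢ i
another {suc zero}    n≢1 i       = contradiction ≡.refl n≢1
another {suc (suc n)} n≢1 zero    = suc zero , λ ()
another {suc (suc n)} n≢1 (suc i) = zero , λ ()

-- Squares and transposes of products, up to sign.

module Products {c ℓ} (K : CommutativeRing c ℓ) where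
  open Families K

  private variable m : ℕ

  ∙-square : ∀ {α β σ} {A B : Matrix m} → A ∙ A ≋ₘ α ⊙ 1ₘ → B ∙ B ≋ₘ β ⊙ 1ₘ → Commutes σ B A →
             (A ∙ B) ∙ (A ∙ B) ≋ₘ (σ Sign.* (β Sign.* α)) ⊙ 1ₘ
  ∙-square {α = α} {β} {σ} {A} {B} A² B² BA = begin
    (A ∙ B) ∙ (A ∙ B)                 ≈⟨ ∙-assoc A B (A ∙ B) ⟩
    A ∙ (B ∙ (A ∙ B))                 ≈⟨ ∙-congˡ {A = A} (∙-assoc B A B) ⟨
    A ∙ ((B ∙ A) ∙ B)                 ≈⟨ ∙-congˡ {A = A} (∙-congʳ {B = B} BA) ⟩
    A ∙ ((σ ⊙ (A ∙ B)) ∙ B)           ≈⟨ ∙-congˡ {A = A} (⊙-∙ˡ σ (A ∙ B) B) ⟩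
    A ∙ (σ ⊙ ((A ∙ B) ∙ B))           ≈⟨ ⊙-∙ʳ σ A ((A ∙ B) ∙ B) ⟩
    σ ⊙ (A ∙ ((A ∙ B) ∙ B))           ≈⟨ ⊙-cong σ (∙-congˡ {A = A} (∙-assoc A B B)) ⟩
    σ ⊙ (A ∙ (A ∙ (B ∙ B)))           ≈⟨ ⊙-cong σ (∙-congˡ {A = A} (∙-congˡ {A = A} B²)) ⟩
    σ ⊙ (A ∙ (A ∙ (β ⊙ 1ₘ)))
        ≈⟨ ⊙-cong σ (∙-congˡ {A = A} (≋-trans (⊙-∙ʳ β A 1ₘ) (⊙-cong β (∙-identityʳ A)))) ⟩
    σ ⊙ (A ∙ (β ⊙ A))                 ≈⟨ ⊙-cong σ (≋-trans (⊙-∙ʳ β A A) (⊙-cong β A²)) ⟩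
    σ ⊙ β ⊙ α ⊙ 1ₘ                    ≈⟨ ⊙-cong σ (⊙-* β α 1ₘ) ⟩
    σ ⊙ (β Sign.* α) ⊙ 1ₘ             ≈⟨ ⊙-* σ (β Sign.* α) 1ₘ ⟩
    (σ Sign.* (β Sign.* α)) ⊙ 1ₘ      ∎
    where open ≋-Reasoning

  Transposes : Sign → Matrix m → Set ℓ
  Transposes σ A = (λ i j → A j i) ≋ₘ σ ⊙ A

  ∙-transposes : ∀ {α β σ} {A B : Matrix m} → Transposes α A → Transposes β B → Commutes σ B A →
                 Transposes (β Sign.* (α Sign.* σ)) (A ∙ B)
  ∙-transposes {α = α} {β} {σ} {A} {B} Aᵀ Bᵀ BA = begin
    (λ i j → (A ∙ B) j i)               ≈⟨ (λ i j → transpose-∙ A B j i) ⟩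
    (λ i j → B j i) ∙ (λ i j → A j i)   ≈⟨ ∙-cong Bᵀ Aᵀ ⟩
    (β ⊙ B) ∙ (α ⊙ A)                   ≈⟨ ≋-trans (⊙-∙ˡ β B (α ⊙ A)) (⊙-cong β (⊙-∙ʳ α B A)) ⟩
    β ⊙ α ⊙ (B ∙ A)                     ≈⟨ ⊙-cong β (⊙-cong α BA) ⟩
    β ⊙ α ⊙ σ ⊙ (A ∙ B)                 ≈⟨ ⊙-cong β (⊙-* α σ (A ∙ B)) ⟩
    β ⊙ (α Sign.* σ) ⊙ (A ∙ B)          ≈⟨ ⊙-* β (α Sign.* σ) (A ∙ B) ⟩
    (β Sign.* (α Sign.* σ)) ⊙ (A ∙ B)   ∎
    where open ≋-Reasoning

-- The dimension equation m + 4 = 2 n and the vanishing of Φ.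

module Classification {c ℓ₁ ℓ₂} (ℝ : Reals c ℓ₁ ℓ₂) {q m : ℕ} where
  open RealFamily ℝ
  open Products (Reals.commutativeRing ℝ)
  open ≈-Reasoning

  module _ {p : ℕ} {S : Vector (Matrix m) (p ℕ.+ q)} (F : IsCliffordFamily (signature p q) S) where
    open Quartic F

    anticommute-same : ∀ {i k} → i ≢ k → signature p q i ≡ signature p q k → Commutes Sign.- (S i) (S k)
    anticommute-same {i} {k} i≢k εi≡εk = ≡.subst (λ σ → Commutes σ (S i) (S k)) (sign≡ _ _ εi≡εk)
        (commutes i≢k)
      where
      sign≡ : ∀ σ τ → σ ≡ τ → opposite (σ Sign.* τ) ≡ Sign.-
      sign≡ Sign.+ _ ≡.refl = ≡.refl
      sign≡ Sign.- _ ≡.refl = ≡.refl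

    commute-mixed : ∀ a b → Commutes Sign.+ (S (a ↑ˡ q)) (S (p ↑ʳ b))
    commute-mixed a b = ≡.subst (λ σ → Commutes σ (S (a ↑ˡ q)) (S (p ↑ʳ b)))
      (≡.cong₂ (λ σ τ → opposite (σ Sign.* τ)) (signature-↑ˡ p q a) (signature-↑ʳ p q b)) (commutes distinct)
      where
      distinct : a ↑ˡ q ≢ p ↑ʳ b
      distinct eq with ≡.trans (≡.sym (signature-↑ˡ p q a)) (≡.trans (≡.cong (signature p q) eq)
          (signature-↑ʳ p q b))
      ... | ()

    anticommuteˡ : ∀ {a a′} → a ≢ a′ → Commutes Sign.- (S (a ↑ˡ q)) (S (a′ ↑ˡ q))
    anticommuteˡ {a} {a′} a≢a′ = anticommute-same (λ eq → a≢a′ (↑ˡ-injective q a a′ eq))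
      (≡.trans (signature-↑ˡ p q a) (≡.sym (signature-↑ˡ p q a′)))

    -- S i commutes with itself and anticommutes with S k, hence anticommutes with their product.
    tr-same : ∀ {i k} → i ≢ k → signature p q i ≡ signature p q k → tr (S i ∙ S k) ≈ 0#
    tr-same {i} {k} i≢k εi≡εk = tr-anticommuting (involution i)
      (Commutes-∙ {σ = Sign.+} {τ = Sign.-} (Commutes-refl (S i)) (anticommute-same i≢k εi≡εk))

    module _ (trace-orthogonal : ∀ {i k} → i ≢ k → tr (S i ∙ S k) ≈ 0#) where
      open TraceOrthogonal trace-orthogonal

      private n = p ℕ.+ q

      -- If `defect` were nonzero, both factors in `defect*g` could be cancelled, m + 4 being
      -- positive. Then all g k, and with them all the forms, would vanish.
      linearRelation⇒defect : HasLinearRelation ℝ p q S → defect ≈ 0#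
      linearRelation⇒defect (f , linear , f≉0 , relation) with defect ≈? 0#
      ... | yes defect≈0 = defect≈0
      ... | no defect≉0  = contradiction f≈0 f≉0
        where
        g : Vector (Vector Carrier m) n
        g i a = f i (δ a)
        Ψ≈0 : ∀ a b c → Ψ g a b c ≈ 0#
        Ψ≈0 = relation⇒Ψ≈0 linear relation
        m+4≉0 : ¬ (fromℕ m + four ≈ 0#)
        m+4≉0 m+4≈0 = fromℕ-suc≉0 3 (trans (solve 0 (con (ℤ.+ 4) := :1 :+ :1 :+ (:1 :+ :1)) refl)
          (nonneg-+≈0ʳ (nonneg-fromℕ m) (nonneg-+ (nonneg-fromℕ 2) (nonneg-fromℕ 2)) m+4≈0))
        f≈0 : ∀ i w → f i w ≈ 0#
        f≈0 i w = trans (linearForm-basis (linear i) w)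
          (∑-zero {m} (λ a → trans (*-congˡ (integral defect≉0 (integral m+4≉0 (defect*g {g = g} Ψ≈0 i a))))
              (zeroʳ _)))

      defect⇒dimension : defect ≈ 0# → m ℕ.+ 4 ≡ 2 ℕ.* n
      defect⇒dimension defect≈0 = fromℕ-injective _ _ (begin
        fromℕ (m ℕ.+ 4)    ≈⟨ fromℕ-+ m 4 ⟩
        fromℕ m + fromℕ 4  ≈⟨ +-congˡ (solve 0 (con (ℤ.+ 4) := :1 :+ :1 :+ (:1 :+ :1)) refl) ⟩
        fromℕ m + four     ≈⟨ x∙y⁻¹≈ε⇒x≈y _ _ defect≈0 ⟩
        two * fromℕ n      ≈⟨ fromℕ-* 2 n ⟨
        fromℕ (2 ℕ.* n)    ∎)

      dimension⇒defect : m ℕ.+ 4 ≡ 2 ℕ.* n → defect ≈ 0#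
      dimension⇒defect m+4≡2n = begin
        fromℕ m + four + - (two * fromℕ n)
          ≈⟨ +-cong (trans (+-congˡ (solve 0 (:1 :+ :1 :+ (:1 :+ :1) := con (ℤ.+ 4)) refl))
              (sym (fromℕ-+ m 4))) (-‿cong (sym (fromℕ-* 2 n))) ⟩
        fromℕ (m ℕ.+ 4) + - fromℕ (2 ℕ.* n)
          ≈⟨ +-congʳ (reflexive (≡.cong fromℕ m+4≡2n)) ⟩
        fromℕ (2 ℕ.* n) + - fromℕ (2 ℕ.* n)
          ≈⟨ -‿inverseʳ _ ⟩
        0# ∎

      module _ (m+4≡2n : m ℕ.+ 4 ≡ 2 ℕ.* n) where

        -- The dimension equation supplies the hypothesis of `Φ-norm≈0`; the vanishing fourfold sum
        -- of squares is then peeled off one index at a time.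
        Φ≈0 : ∀ a b c d → Φ a b c d ≈ 0#
        Φ≈0 a b c d = square≈0 (nonneg-∑≈0 {m} (λ d → nonneg-square _)
          (nonneg-∑≈0 {m} (λ c → nonneg-∑ {m} (λ d → nonneg-square _))
          (nonneg-∑≈0 {m} (λ b → nonneg-∑ {m} (λ c → nonneg-∑ {m} (λ d → nonneg-square _)))
          (nonneg-∑≈0 {m} (λ a → nonneg-∑ {m}
              (λ b → nonneg-∑ {m} (λ c → nonneg-∑ {m} (λ d → nonneg-square _))))
          (Φ-norm≈0 (λ k a b → trans (S-contraction k a b) (trans (*-congʳ (dimension⇒defect m+4≡2n))
              (zeroˡ _)))) a) b) c) d)

        dimension⇒quartic≈0 : ∀ w → quadric (Q w) ≈ 0#
        dimension⇒quartic≈0 w = fromℕ-cancel 2 (quadric-Q-triple Φ≈0 w)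

    -- The derivative of the quartic in the direction of the `a`-th basis vector is 4 ∑ Q k f k,
    -- where f k is the `a`-th coordinate of ε k S k w. The form f i is nonzero since its value at
    -- the `a`-th column of S i is ε i.
    quartic≈0⇒linearRelation : Fin (p ℕ.+ q) → Fin m → (∀ w → quadric (Q w) ≈ 0#) → HasLinearRelation ℝ p q S
    quartic≈0⇒linearRelation i a quartic≈0 = f , (λ k → coordinate-linear {m} (e k) (S k a)) , f≉0 , relation
      where
      f : Vector (Vector Carrier m → Carrier) (p ℕ.+ q)
      f k w = e k * (S k a · w)
      f≉0 : ¬ (∀ k w → f k w ≈ 0#)
      f≉0 f≈0 = 1≉0 (begin
        1#                                     ≈⟨ trans (involution i a a) (δ-refl a) ⟨
        S i a · (λ b → S i b a)                ≈⟨ trans (*-congʳ (e² i)) (*-identityˡ _) ⟨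
        e i * e i * (S i a · (λ b → S i b a))  ≈⟨ *-assoc _ _ _ ⟩
        e i * f i (λ b → S i b a)              ≈⟨ trans (*-congˡ (f≈0 i _)) (zeroʳ _) ⟩
        0#                                     ∎)
      relation : ∀ w → ∑[ k < p ℕ.+ q ] (Q w k * f k w) ≈ 0#
      relation w = begin
        ∑[ k < p ℕ.+ q ] (Q w k * (e k * (S k a · w)))
          ≈⟨ sum-cong-≋ {p ℕ.+ q} (λ k → trans (solve 3 (λ x y z → x :* (y :* z) := y :* (x :* z)) refl
              (Q w k) (e k) _)
               (*-congˡ (*-congˡ (sym (trans (polar-comm k w (δ a)) (∑-δ a _)))))) ⟩
        ∑[ k < p ℕ.+ q ] (e k * (Q w k * polar k w (δ a)))
          ≈⟨ quartic-coefficient₁ quartic≈0 w (δ a) ⟩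
        0# ∎

    fromℕ-difference≈0 : ∀ {x y} → fromℕ x + - fromℕ y ≈ 0# → x ≡ y
    fromℕ-difference≈0 eq = fromℕ-injective _ _ (x∙y⁻¹≈ε⇒x≈y _ _ eq)

    -- This is `conjugation-signature` for Z = 1: every χ i is +, and the ε i add up to p - q.
    traceless⇒p≡q : Fin m → (∀ a b c d → Φ a b c d ≈ 0#) → (∀ i → tr (S i) ≈ 0#) → p ≡ q
    traceless⇒p≡q a Φ≈0 tr≈0 = fromℕ-difference≈0 (begin
      fromℕ p + - fromℕ q
        ≈⟨ +-cong (trans (∑-const p 1#) (*-identityʳ _)) (-‿cong (trans (∑-const q 1#) (*-identityʳ _))) ⟨
      ∑[ i < p ] 1# + - (∑[ j < q ] 1#)
        ≈⟨ Signature.∑-signature (Reals.commutativeRing ℝ) p q (λ _ → 1#) ⟨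
      ∑[ i < p ℕ.+ q ] (e i * 1#)
        ≈⟨ conjugation-signature Φ≈0 a (λ i j → δ-sym i j) (∙-identityˡ 1ₘ) (λ _ → Sign.+)
            (λ i → Commutes-1 (S i))
             (λ i → trans (tr-cong (∙-identityʳ (S i))) (tr≈0 i)) ⟩
      0# ∎)

    another-same-sign : p ≢ 1 → q ≢ 1 → ∀ i → ∃ λ i′ → i′ ≢ i × signature p q i′ ≡ signature p q i
    another-same-sign p≢1 q≢1 = split-elim p
      (λ a → let a′ , a′≢a = another p≢1 a in a′ ↑ˡ q , (λ eq → a′≢a (↑ˡ-injective q a′ a eq)) ,
        ≡.trans (signature-↑ˡ p q a′) (≡.sym (signature-↑ˡ p q a)))
      (λ b → let b′ , b′≢b = another q≢1 b in p ↑ʳ b′ , (λ eq → b′≢b (↑ʳ-injective p b′ b eq)) ,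
        ≡.trans (signature-↑ʳ p q b′) (≡.sym (signature-↑ʳ p q b)))

    -- A second generator of the same tensor factor exists and anticommutes with S i.
    traceless : p ≢ 1 → q ≢ 1 → ∀ i → tr (S i) ≈ 0#
    traceless p≢1 q≢1 i with another-same-sign p≢1 q≢1 i
    ... | i′ , i′≢i , ε≡ = tr-anticommuting (involution i′) (anticommute-same i′≢i ε≡)

-- Trace orthogonality of the generators when p ≥ 2.

module TraceOrthogonality {c ℓ₁ ℓ₂} (ℝ : Reals c ℓ₁ ℓ₂) {q m p : ℕ} where
  open RealFamily ℝ
  open Classification ℝ {q} {m}

  module _ {S : Vector (Matrix m) (2 ℕ.+ p ℕ.+ q)} (F : IsCliffordFamily (signature (2 ℕ.+ p) q) S) where
    open Quartic F

    -- Among at least two positive generators there is another one; it anticommutes with the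
    -- positive factor and commutes with the negative one.
    tr-mixed : ∀ a b → tr (S (a ↑ˡ q) ∙ S ((2 ℕ.+ p) ↑ʳ b)) ≈ 0#
    tr-mixed a b with another (λ ()) a
    ... | a′ , a′≢a = tr-anticommuting (involution (a′ ↑ˡ q))
      (Commutes-∙ {σ = Sign.-} {τ = Sign.+} (anticommuteˡ F a′≢a) (commute-mixed F a′ b))

    trace-orthogonal : ∀ {i k} → i ≢ k → tr (S i ∙ S k) ≈ 0#
    trace-orthogonal {i} {k} = go i k
      where
      go : ∀ i k → i ≢ k → tr (S i ∙ S k) ≈ 0#
      go = split-elim (2 ℕ.+ p)
        (λ a → split-elim (2 ℕ.+ p)
          (λ a′ i≢k → tr-same F i≢k (≡.trans (signature-↑ˡ (2 ℕ.+ p) q a)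
              (≡.sym (signature-↑ˡ (2 ℕ.+ p) q a′))))
          (λ b _ → tr-mixed a b))
        (λ b → split-elim (2 ℕ.+ p)
          (λ a _ → trans (tr-comm (S ((2 ℕ.+ p) ↑ʳ b)) (S (a ↑ˡ q))) (tr-mixed a b))
          (λ b′ i≢k → tr-same F i≢k (≡.trans (signature-↑ʳ (2 ℕ.+ p) q b)
              (≡.sym (signature-↑ʳ (2 ℕ.+ p) q b′)))))

-- The product of four positive generators.

module Fourfold {c ℓ₁ ℓ₂} (ℝ : Reals c ℓ₁ ℓ₂) {q m p : ℕ} where
  open RealFamily ℝ
  open Products (Reals.commutativeRing ℝ)
  open Classification ℝ {q} {m}
  open ≈-Reasoning

  module _ {S : Vector (Matrix m) (4 ℕ.+ p ℕ.+ q)} (F : IsCliffordFamily (signature (4 ℕ.+ p) q) S) where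
    open Quartic F

    private
      pattern 4+ r = suc (suc (suc (suc r)))

      n = 4 ℕ.+ p ℕ.+ q

      pair′ : (i k : Fin n) → Matrix m
      pair′ i k = S i ∙ S k

      Z : Matrix m
      Z = pair′ 0F 1F ∙ pair′ 2F 3F

      -- The sign of moving S i past `Z`. If S i is one of the four factors, it anticommutes with
      -- the other three; otherwise it has the same sign with all four, and the fourth power of a
      -- sign is +.
      χ : Vector Sign n
      χ 0F     = Sign.-
      χ 1F     = Sign.-
      χ 2F     = Sign.-
      χ 3F     = Sign.-
      χ (4+ _) = Sign.+

      transposes : ∀ i → Transposes Sign.+ (S i)
      transposes i a b = trans (symmetric i b a) (sym (*-identityˡ _))

      square : ∀ i → S i ∙ S i ≋ₘ Sign.+ ⊙ 1ₘ
      square i a b = trans (involution i a b) (sym (*-identityˡ _))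

      product-commutes : ∀ {i j k l σ τ υ ω} → Commutes σ (S i) (S k) → Commutes τ (S i) (S l) →
        Commutes υ (S j) (S k) → Commutes ω (S j) (S l) →
        Commutes ((σ Sign.* υ) Sign.* (τ Sign.* ω)) (S k ∙ S l) (S i ∙ S j)
      product-commutes {i} {j} {k} {l} {σ} {τ} {υ} {ω} ik il jk jl = Commutes-sym
          {σ = (σ Sign.* υ) Sign.* (τ Sign.* ω)} {A = S i ∙ S j}
        (Commutes-∙ {σ = σ Sign.* υ} {τ = τ Sign.* ω} {N = S i ∙ S j}
          (flip {σ = σ Sign.* υ} (Commutes-∙ {σ = σ} {τ = υ} (flip {σ = σ} ik) (flip {σ = υ} jk)))
          (flip {σ = τ Sign.* ω} (Commutes-∙ {σ = τ} {τ = ω} (flip {σ = τ} il) (flip {σ = ω} jl))))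
        where
        flip : ∀ {σ} {A B : Matrix m} → Commutes σ A B → Commutes σ B A
        flip {σ} = Commutes-sym {σ = σ}

      anti : ∀ {i k} → i ≢ k → signature (4 ℕ.+ p) q i ≡ signature (4 ℕ.+ p) q k → Commutes Sign.- (S i) (S k)
      anti = anticommute-same F

      Y∙X : Commutes Sign.+ (pair′ 2F 3F) (pair′ 0F 1F)
      Y∙X = product-commutes {σ = Sign.-} {Sign.-} {Sign.-} {Sign.-}
        (anti (λ ()) ≡.refl) (anti (λ ()) ≡.refl) (anti (λ ()) ≡.refl) (anti (λ ()) ≡.refl)

      -- The two pairs in `Z` are skew, square to -1 and commute with each other; hence their
      -- product is symmetric and, in `Z²`, an involution.
      symZ : Symmetric Z
      symZ a b = sym (trans
        (∙-transposes {α = Sign.-} {Sign.-} {Sign.+} {A = pair′ 0F 1F} {B = pair′ 2F 3F}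
          (∙-transposes {α = Sign.+} {Sign.+} {Sign.-} (transposes 0F) (transposes 1F) (anti (λ ()) ≡.refl))
          (∙-transposes {α = Sign.+} {Sign.+} {Sign.-} (transposes 2F) (transposes 3F)
              (anti (λ ()) ≡.refl)) Y∙X a b)
        (*-identityˡ _))

      Z² : Involution Z
      Z² a b = trans
        (∙-square {α = Sign.-} {Sign.-} {Sign.+} {A = pair′ 0F 1F} {B = pair′ 2F 3F}
          (∙-square {α = Sign.+} {Sign.+} {Sign.-} (square 0F) (square 1F) (anti (λ ()) ≡.refl))
          (∙-square {α = Sign.+} {Sign.+} {Sign.-} (square 2F) (square 3F) (anti (λ ()) ≡.refl)) Y∙X a b)
        (*-identityˡ _)

      Z-commutes : ∀ {i σ τ υ ω} → Commutes σ (S i) (S 0F) → Commutes τ (S i) (S 1F) → Commutes υ (S i) (S 2F)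
          → Commutes ω (S i) (S 3F) →
                   Commutes ((σ Sign.* τ) Sign.* (υ Sign.* ω)) (S i) Z
      Z-commutes {i} {σ} {τ} {υ} {ω} i0 i1 i2 i3 =
        Commutes-∙ {σ = σ Sign.* τ} {τ = υ Sign.* ω} (Commutes-∙ {σ = σ} {τ = τ} i0 i1)
            (Commutes-∙ {σ = υ} {τ = ω} i2 i3)

      χ-commutes : ∀ i → Commutes (χ i) (S i) Z
      χ-commutes 0F = Z-commutes {σ = Sign.+} {Sign.-} {Sign.-} {Sign.-} (Commutes-refl (S 0F))
          (anti (λ ()) ≡.refl) (anti (λ ()) ≡.refl) (anti (λ ()) ≡.refl)
      χ-commutes 1F = Z-commutes {σ = Sign.-} {Sign.+} {Sign.-} {Sign.-}
          (anti (λ ()) ≡.refl) (Commutes-refl (S 1F)) (anti (λ ()) ≡.refl) (anti (λ ()) ≡.refl)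
      χ-commutes 2F = Z-commutes {σ = Sign.-} {Sign.-} {Sign.+} {Sign.-}
          (anti (λ ()) ≡.refl) (anti (λ ()) ≡.refl) (Commutes-refl (S 2F)) (anti (λ ()) ≡.refl)
      χ-commutes 3F = Z-commutes {σ = Sign.-} {Sign.-} {Sign.-} {Sign.+}
          (anti (λ ()) ≡.refl) (anti (λ ()) ≡.refl) (anti (λ ()) ≡.refl) (Commutes-refl (S 3F))
      χ-commutes (4+ r) = ≡.subst (λ s → Commutes s (S (4+ r)) Z) (fourth σ)
        (Z-commutes {σ = σ} {σ} {σ} {σ}
            (commutes {4+ r} {0F} (λ ())) (commutes {4+ r} {1F} (λ ())) (commutes {4+ r} {2F} (λ ()))
            (commutes {4+ r} {3F} (λ ())))
        where
        σ = opposite (signature (4 ℕ.+ p) q (4+ r) Sign.* Sign.+)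
        fourth : ∀ σ → (σ Sign.* σ) Sign.* (σ Sign.* σ) ≡ Sign.+
        fourth Sign.+ = ≡.refl
        fourth Sign.- = ≡.refl

      tr-Z-own : ∀ {i} → Commutes Sign.- (S i) Z → tr (S i ∙ Z) ≈ 0#
      tr-Z-own {i} iZ = tr-anticommuting (involution i) (Commutes-∙ {σ = Sign.+} {τ = Sign.-}
          (Commutes-refl (S i)) iZ)

      -- Here `p` counts the positive generators beyond the first four. If S i is negative, the
      -- first generator anticommutes with S i Z. If S i is one of these `p`, another of them does;
      -- were there exactly one, S i Z would be, up to sign, the product of all positive generators,
      -- which commutes with every S k.
      tr-Z : p ≢ 1 → ∀ i → tr (S i ∙ Z) ≈ 0#
      tr-Z p≢1 0F = tr-Z-own {0F} (χ-commutes 0F)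
      tr-Z p≢1 1F = tr-Z-own {1F} (χ-commutes 1F)
      tr-Z p≢1 2F = tr-Z-own {2F} (χ-commutes 2F)
      tr-Z p≢1 3F = tr-Z-own {3F} (χ-commutes 3F)
      tr-Z p≢1 (4+ r) = split-elim p {P = λ r → tr (S (4+ r) ∙ Z) ≈ 0#} left right r
        where
        right : ∀ b → tr (S (4+ (p ↑ʳ b)) ∙ Z) ≈ 0#
        right b = tr-anticommuting (involution 0F)
          (Commutes-∙ {σ = Sign.+} {τ = Sign.-} (commute-mixed F zero b) (χ-commutes 0F))
        left : ∀ a → tr (S (4+ (a ↑ˡ q)) ∙ Z) ≈ 0#
        left a with another p≢1 a
        ... | a′ , a′≢a = tr-anticommuting (involution (4+ (a′ ↑ˡ q)))
          (Commutes-∙ {σ = Sign.-} {τ = Sign.+} (anticommuteˡ F {4+ a′} {4+ a} (λ { ≡.refl → a′≢a ≡.refl }))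
              (χ-commutes (4+ (a′ ↑ˡ q))))

    -- The ε i χ i add up to -4 + p - q. As 4 + p is the number of positive generators, that number
    -- exceeds q by 8.
    fourfold⇒p≡4+q : Fin m → p ≢ 1 → (∀ a b c d → Φ a b c d ≈ 0#) → p ≡ 4 ℕ.+ q
    fourfold⇒p≡4+q a p≢1 Φ≈0 = fromℕ-difference≈0 F (begin
      fromℕ p + - fromℕ (4 ℕ.+ q)
        ≈⟨ +-congˡ (-‿cong (fromℕ-+ 4 q)) ⟩
      fromℕ p + - (fromℕ 4 + fromℕ q)
        ≈⟨ solve 2 (λ p q → p :+ :- (con (ℤ.+ 4) :+ q) := (:- :1 :+ (:- :1 :+ (:- :1 :+ (:- :1 :+ p)))) :+ :-
            q) refl (fromℕ p) (fromℕ q) ⟩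
      (- 1# + (- 1# + (- 1# + (- 1# + fromℕ p)))) + - fromℕ q
        ≈⟨ +-cong (+-congˡ (+-congˡ (+-congˡ (+-congˡ (trans (∑-const p 1#) (*-identityʳ _))))))
            (-‿cong (trans (∑-const q 1#) (*-identityʳ _))) ⟨
      (- 1# + (- 1# + (- 1# + (- 1# + ∑[ i < p ] 1#)))) + - (∑[ j < q ] 1#)
        ≈⟨ Signature.∑-signature (Reals.commutativeRing ℝ) (4 ℕ.+ p) q (λ i → fromSign (χ i)) ⟨
      ∑[ i < n ] (e i * fromSign (χ i))
        ≈⟨ conjugation-signature Φ≈0 a symZ Z² χ χ-commutes (tr-Z p≢1) ⟩
      0# ∎)

-- The case p = q = 1.

module SignatureOneOne {c ℓ₁ ℓ₂} (ℝ : Reals c ℓ₁ ℓ₂) {m : ℕ} where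
  open RealFamily ℝ
  open ≈-Reasoning

  module _ {S : Vector (Matrix m) 2} (F : IsCliffordFamily (signature 1 1) S) where
    open Quartic F

    private
      two : Carrier
      two = 1# + 1#

      S₀ S₁ K : Matrix m
      S₀ = S zero
      S₁ = S (suc zero)
      K  = S₀ ∙ S₁

      τ : Carrier
      τ = tr K

      S₁∙S₀ : S₁ ∙ S₀ ≋ₘ K
      S₁∙S₀ a b = trans (commutes {suc zero} {zero} (λ ()) a b) (*-identityˡ _)

      S₀∙K : S₀ ∙ K ≋ₘ S₁
      S₀∙K = ≋-trans (≋-sym (∙-assoc S₀ S₀ S₁)) (≋-trans (∙-congʳ {B = S₁} (involution zero))
          (∙-identityˡ S₁))

      K² : K ∙ K ≋ₘ 1ₘ
      K² = ≋-trans (∙-congʳ {B = K} (≋-sym S₁∙S₀)) (≋-trans (∙-assoc S₁ S₀ K) (≋-trans (∙-congˡ {A = S₁} S₀∙K)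
          (involution (suc zero))))

      symK : Symmetric K
      symK a b = trans (Symmetric-∙ {σ = Sign.+} (symmetric zero) (symmetric (suc zero))
          (commutes {zero} {suc zero} (λ ())) a b) (*-identityˡ _)

    module _ (σ : Sign) where
      private
        s x : Carrier
        s = fromSign σ
        x = fromℕ m + s * τ

        -- Twice the projection onto the subspace where S₀ = s S₁.
        M : Matrix m
        M a b = δ a b + s * K a b

        -- Since `K` is a symmetric involution, M M = 2 M; the squared norm of `M` is twice its
        -- trace, which is `x`.
        norm-M : pair M M ≈ two * x
        norm-M = begin
          pair M M
            ≈⟨ trans (pair-+ M _ _) (+-congˡ (pair-* M K s)) ⟩
          pair M 1ₘ + s * pair M K
            ≈⟨ +-cong (trans (pair-tr M δ-sym) (tr-cong (∙-identityˡ M))) (*-congˡ (pair-tr M symK)) ⟩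
          tr M + s * tr (K ∙ M)
            ≈⟨ +-cong tr-M (*-congˡ tr-K∙M) ⟩
          x + s * (τ + s * fromℕ m)
            ≈⟨ solve 3 (λ s t m → (m :+ s :* t) :+ s :* (t :+ s :* m) := (m :+ s :* t) :+
                (s :* t :+ (s :* s) :* m)) refl s τ (fromℕ m) ⟩
          x + (s * τ + s * s * fromℕ m)
            ≈⟨ +-congˡ (+-congˡ (*-congʳ (fromSign-square σ))) ⟩
          x + (s * τ + 1# * fromℕ m)
            ≈⟨ solve 2 (λ m t → (m :+ t) :+ (t :+ :1 :* m) := (:1 :+ :1) :* (m :+ t)) refl (fromℕ m) (s * τ) ⟩
          two * x ∎
          where
          tr-M : tr M ≈ x
          tr-M = trans (∑-distrib-+ {m} _ _) (+-cong (tr-1 {m}) (sym (*-distribˡ-sum {m} s _)))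
          tr-K∙M : tr (K ∙ M) ≈ τ + s * fromℕ m
          tr-K∙M = begin
            ∑[ a < m ] ∑[ l < m ] (K a l * (δ l a + s * K l a))
              ≈⟨ ∑∑-cong {m} {m} (λ a l → solve 4 (λ k d s k′ → k :* (d :+ s :* k′) := k :* d :+ s :*
                  (k :* k′)) refl (K a l) (δ l a) s (K l a)) ⟩
            ∑[ a < m ] ∑[ l < m ] (K a l * δ l a + s * (K a l * K l a))
              ≈⟨ ∑∑-distrib-+ {m} {m} _ _ ⟩
            tr (K ∙ 1ₘ) + ∑[ a < m ] ∑[ l < m ] (s * (K a l * K l a))
              ≈⟨ +-cong (tr-cong (∙-identityʳ K)) (trans (∑∑-distribˡ {m} {m} s _)
                  (*-congˡ (trans (tr-cong K²) (tr-1 {m})))) ⟩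
            τ + s * fromℕ m ∎

        nonneg-2x : Nonnegative (two * x)
        nonneg-2x = nonneg-resp norm-M (nonneg-∑ {m} (λ a → nonneg-∑ {m} (λ b → nonneg-square _)))

      -- By `norm-M` the matrix `M` vanishes, and S₀ M = S₀ + s S₁ because S₀ K = S₁.
      x≈0⇒S₀≈-s*S₁ : x ≈ 0# → ∀ a b → S₀ a b ≈ - (s * S₁ a b)
      x≈0⇒S₀≈-s*S₁ x≈0 a b = begin
        S₀ a b                                           ≈⟨ solve 2 (λ x y → x := (x :+ y) :+ :- y) refl
            (S₀ a b) (s * S₁ a b) ⟩
        (S₀ a b + s * S₁ a b) + - (s * S₁ a b)           ≈⟨ +-congʳ sum≈0 ⟩
        0# + - (s * S₁ a b)                              ≈⟨ +-identityˡ _ ⟩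
        - (s * S₁ a b)                                   ∎
        where
        M≈0 : ∀ a b → M a b ≈ 0#
        M≈0 a b = square≈0 (nonneg-∑≈0 {m} (λ b → nonneg-square _)
          (nonneg-∑≈0 {m} (λ a → nonneg-∑ {m} (λ b → nonneg-square _))
              (trans norm-M (trans (*-congˡ x≈0) (zeroʳ _))) a) b)
        sum≈0 : S₀ a b + s * S₁ a b ≈ 0#
        sum≈0 = begin
          S₀ a b + s * S₁ a b
            ≈⟨ +-cong (∙-identityʳ S₀ a b) (*-congˡ (S₀∙K a b)) ⟨
          (S₀ ∙ 1ₘ) a b + s * (S₀ ∙ K) a b
            ≈⟨ +-congˡ (*-distribˡ-sum {m} s _) ⟩
          ∑[ l < m ] (S₀ a l * δ l b) + ∑[ l < m ] (s * (S₀ a l * K l b))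
            ≈⟨ ∑-distrib-+ {m} _ _ ⟨
          ∑[ l < m ] (S₀ a l * δ l b + s * (S₀ a l * K l b))
            ≈⟨ ∑-zero {m} (λ l → trans (solve 4 (λ p d s k → p :* d :+ s :* (p :* k) := p :* (d :+ s :* k))
                refl (S₀ a l) (δ l b) s (K l b))
                 (trans (*-congˡ (M≈0 l b)) (zeroʳ _))) ⟩
          0# ∎

      module _ {g : Vector (Vector Carrier m) 2} (Ψ≈0 : ∀ a b c → Ψ g a b c ≈ 0#) where
        private
          g₀ g₁ f : Vector Carrier m
          g₀ = g zero
          g₁ = g (suc zero)
          f a = g₀ a + s * g₁ a

          Ψ-contraction≈0 : ∀ k a → ∑[ i < 2 ] (tr (S i ∙ S k) * g i a + two * (S i *ᵥ (S k *ᵥ g i)) a) ≈ 0#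
          Ψ-contraction≈0 k a = trans (sym (Ψ-contraction (symmetric k) g a))
            (∑-zero {m} (λ b → ∑-zero {m} (λ c → trans (*-congˡ (Ψ≈0 a b c)) (zeroʳ _))))

          own : ∀ i a → tr (S i ∙ S i) * g i a + two * (S i *ᵥ (S i *ᵥ g i)) a ≈ fromℕ m * g i a + two * g i a
          own i a = +-cong (*-congʳ (trans (tr-cong (involution i)) (tr-1 {m})))
            (*-congˡ (trans (sym (∙-*ᵥ (S i) (S i) (g i) a)) (trans ((involution i *ᵥ-cong (λ _ → refl)) a)
                (1-*ᵥ (g i) a))))

          eq₀ : ∀ a → (fromℕ m * g₀ a + two * g₀ a) + ((τ * g₁ a + two * (K *ᵥ g₁) a) + 0#) ≈ 0#
          eq₀ a = trans (sym (+-cong (own zero a) (+-congʳ (+-cong (*-congʳ (tr-cong S₁∙S₀))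
            (*-congˡ (trans (sym (∙-*ᵥ S₁ S₀ g₁ a)) ((S₁∙S₀ *ᵥ-cong (λ _ → refl)) a)))))))
                (Ψ-contraction≈0 zero a)

          eq₁ : ∀ a → (τ * g₀ a + two * (K *ᵥ g₀) a) + ((fromℕ m * g₁ a + two * g₁ a) + 0#) ≈ 0#
          eq₁ a = trans (sym (+-cong (+-congˡ (*-congˡ (sym (∙-*ᵥ S₀ S₁ g₀ a))))
              (+-congʳ (own (suc zero) a)))) (Ψ-contraction≈0 (suc zero) a)

          K*ᵥf : ∀ a → (K *ᵥ f) a ≈ (K *ᵥ g₀) a + s * (K *ᵥ g₁) a
          K*ᵥf a = trans (·-comm (K a) f) (trans (·-linear s g₀ g₁ (K a)) (+-cong (·-comm g₀ (K a))
              (*-congˡ (·-comm g₁ (K a)))))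

          -- The contraction with S₀ plus `s` times the contraction with S₁; because s s = 1, they
          -- combine into an equation in `f` alone.
          f-eigen : ∀ a → (x + two) * f a ≈ - (two * s) * (K *ᵥ f) a
          f-eigen a = x∙y⁻¹≈ε⇒x≈y _ _ (begin
            (x + two) * f a + - (- (two * s) * (K *ᵥ f) a)
              ≈⟨ +-congˡ (-‿cong (*-congˡ (K*ᵥf a))) ⟩
            (x + two) * f a + - (- (two * s) * (k₀ + s * k₁))
              ≈⟨ solve 7 (λ m s t u v k l →
                   (m :+ s :* t :+ (:1 :+ :1)) :* (u :+ s :* v) :+ :- (:- ((:1 :+ :1) :* s) :* (k :+ s :* l))
                       :=
                   (((m :* u :+ (:1 :+ :1) :* u) :+ ((t :* v :+ (:1 :+ :1) :* l) :+ :0)) :+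
                   s :* ((t :* u :+ (:1 :+ :1) :* k) :+ ((m :* v :+ (:1 :+ :1) :* v) :+ :0))) :+
                   (s :* s :+ :- :1) :* (t :* v :+ (:1 :+ :1) :* l))
                   refl (fromℕ m) s τ (g₀ a) (g₁ a) k₀ k₁ ⟩
            (((fromℕ m * g₀ a + two * g₀ a) + ((τ * g₁ a + two * k₁) + 0#)) +
            s * ((τ * g₀ a + two * k₀) + ((fromℕ m * g₁ a + two * g₁ a) + 0#))) +
            (s * s + - 1#) * (τ * g₁ a + two * k₁)
              ≈⟨ +-cong (+-cong (eq₀ a) (trans (*-congˡ (eq₁ a)) (zeroʳ s)))
                  (trans (*-congʳ (trans (+-congʳ (fromSign-square σ)) (-‿inverseʳ 1#))) (zeroˡ _)) ⟩
            (0# + 0#) + 0#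
              ≈⟨ trans (+-identityʳ _) (+-identityʳ _) ⟩
            0# ∎)
            where
            k₀ = (K *ᵥ g₀) a
            k₁ = (K *ᵥ g₁) a

          Kf-eigen : ∀ a → (x + two) * (K *ᵥ f) a ≈ - (two * s) * f a
          Kf-eigen a = begin
            (x + two) * (K *ᵥ f) a
              ≈⟨ *-distribˡ-sum {m} _ _ ⟩
            ∑[ b < m ] ((x + two) * (K a b * f b))
              ≈⟨ sum-cong-≋ {m} (λ b → trans (solve 3 (λ x k f → x :* (k :* f) := k :* (x :* f)) refl
                  (x + two) (K a b) (f b))
                   (trans (*-congˡ (f-eigen b)) (solve 3 (λ k x f → k :* (x :* f) := x :* (k :* f)) refl
                       (K a b) (- (two * s)) _))) ⟩
            ∑[ b < m ] (- (two * s) * (K a b * (K *ᵥ f) b))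
              ≈⟨ *-distribˡ-sum {m} _ _ ⟨
            - (two * s) * (K *ᵥ (K *ᵥ f)) a
              ≈⟨ *-congˡ (trans (sym (∙-*ᵥ K K f a)) (trans ((K² *ᵥ-cong (λ _ → refl)) a) (1-*ᵥ f a))) ⟩
            - (two * s) * f a ∎

          -- Using `f-eigen` and `Kf-eigen` in turn gives (x + 2)² f = 4 f, and (x + 2)² - 4 = x (x
          -- + 4).
          x[x+4]f≈0 : ∀ a → (x + fromℕ 4) * (x * f a) ≈ 0#
          x[x+4]f≈0 a = begin
            (x + fromℕ 4) * (x * f a)
              ≈⟨ solve 2 (λ x f → (x :+ con (ℤ.+ 4)) :* (x :* f) := (x :+ (:1 :+ :1)) :*
                  ((x :+ (:1 :+ :1)) :* f) :+ :- (con (ℤ.+ 4) :* f)) refl x (f a) ⟩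
            (x + two) * ((x + two) * f a) + - (fromℕ 4 * f a)
              ≈⟨ +-congʳ (trans (*-congˡ (f-eigen a))
                  (solve 3 (λ x s k → x :* (:- s :* k) := :- s :* (x :* k)) refl (x + two) (two * s) _)) ⟩
            - (two * s) * ((x + two) * (K *ᵥ f) a) + - (fromℕ 4 * f a)
              ≈⟨ +-congʳ (*-congˡ (Kf-eigen a)) ⟩
            - (two * s) * (- (two * s) * f a) + - (fromℕ 4 * f a)
              ≈⟨ solve 2 (λ s f → :- ((:1 :+ :1) :* s) :* (:- ((:1 :+ :1) :* s) :* f) :+ :- (con (ℤ.+ 4) :* f)
                  := (s :* s :+ :- :1) :* (con (ℤ.+ 4) :* f)) refl s (f a) ⟩
            (s * s + - 1#) * (fromℕ 4 * f a)
              ≈⟨ trans (*-congʳ (trans (+-congʳ (fromSign-square σ)) (-‿inverseʳ 1#))) (zeroˡ _) ⟩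
            0# ∎

          -- 2 x is a sum of squares, so 2 x + 8 is positive.
          x+4≉0 : ¬ (x + fromℕ 4 ≈ 0#)
          x+4≉0 x+4≈0 = fromℕ-suc≉0 7 (nonneg-+≈0ʳ nonneg-2x (nonneg-fromℕ 8)
            (trans (solve 1 (λ x → (:1 :+ :1) :* x :+ con (ℤ.+ 8) := (:1 :+ :1) :* (x :+ con (ℤ.+ 4))) refl x)
              (trans (*-congˡ x+4≈0) (zeroʳ _))))

        x≉0⇒g₀+s*g₁≈0 : ¬ (x ≈ 0#) → ∀ a → g₀ a + s * g₁ a ≈ 0#
        x≉0⇒g₀+s*g₁≈0 x≉0 a = integral x≉0 (integral x+4≉0 (x[x+4]f≈0 a))

    -- If m + s tr K = 0 for one sign, the generators agree up to the opposite sign: s = + gives S₀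
    -- = - S₁. If both numbers are nonzero, g₀ + g₁ and g₀ - g₁ vanish, so the relation is trivial.
    linearRelation⇒equalUpToSign : HasLinearRelation ℝ 1 1 S → EqualUpToSign ℝ 1 1 S
    linearRelation⇒equalUpToSign (f , linear , f≉0 , relation) with fromℕ m + 1# * τ ≈? 0# | fromℕ m + - 1# *
        τ ≈? 0#
    ... | yes m+τ≈0 | _ = ≡.refl , inj₂ (λ a b → trans (x≈0⇒S₀≈-s*S₁ Sign.+ m+τ≈0 a b)
        (-‿cong (*-identityˡ _)))
    ... | no _ | yes m-τ≈0 = ≡.refl , inj₁ (λ a b → trans (x≈0⇒S₀≈-s*S₁ Sign.- m-τ≈0 a b)
      (solve 1 (λ x → :- ((:- :1) :* x) := x) refl _))
    ... | no m+τ≉0 | no m-τ≉0 = contradiction f≈0 f≉0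
      where
      g : Vector (Vector Carrier m) 2
      g i a = f i (δ a)
      Ψ≈0 : ∀ a b c → Ψ g a b c ≈ 0#
      Ψ≈0 = relation⇒Ψ≈0 linear relation
      plus : ∀ a → g zero a + 1# * g (suc zero) a ≈ 0#
      plus = x≉0⇒g₀+s*g₁≈0 Sign.+ {g = g} Ψ≈0 m+τ≉0
      minus : ∀ a → g zero a + - 1# * g (suc zero) a ≈ 0#
      minus = x≉0⇒g₀+s*g₁≈0 Sign.- {g = g} Ψ≈0 m-τ≉0
      g≈0 : ∀ i a → g i a ≈ 0#
      g≈0 zero a = x+x≈0⇒x≈0 _ (trans
        (solve 2 (λ u v → u :+ u := (u :+ :1 :* v) :+ (u :+ (:- :1) :* v)) refl (g zero a) (g (suc zero) a))
        (trans (+-cong (plus a) (minus a)) (+-identityˡ 0#)))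
      g≈0 (suc zero) a = x+x≈0⇒x≈0 _ (trans
        (solve 2 (λ u v → v :+ v := (u :+ :1 :* v) :+ :- (u :+ (:- :1) :* v)) refl (g zero a)
            (g (suc zero) a))
        (trans (+-cong (plus a) (-‿cong (minus a))) (-‿inverseʳ 0#)))
      f≈0 : ∀ i w → f i w ≈ 0#
      f≈0 i w = trans (linearForm-basis (linear i) w) (∑-zero {m} (λ a → trans (*-congˡ (g≈0 i a)) (zeroʳ _)))

    equalUpToSign⇒quartic≈0 : EqualUpToSign ℝ 1 1 S → ∀ w → quadric (Q w) ≈ 0#
    equalUpToSign⇒quartic≈0 (≡.refl , eq) w = begin
      1# * (Q w zero * Q w zero) + (- 1# * (Q w (suc zero) * Q w (suc zero)) + 0#)
        ≈⟨ +-congʳ (*-congˡ (squares eq)) ⟩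
      1# * (Q w (suc zero) * Q w (suc zero)) + (- 1# * (Q w (suc zero) * Q w (suc zero)) + 0#)
        ≈⟨ solve 1 (λ x → :1 :* x :+ ((:- :1) :* x :+ :0) := :0) refl _ ⟩
      0# ∎
      where
      squares : (S₀ ≋ₘ S₁) ⊎ (S₀ ≋ₘ -ₘ S₁) → Q w zero * Q w zero ≈ Q w (suc zero) * Q w (suc zero)
      squares (inj₁ S₀≋S₁)  = *-cong (⟦⟧-cong S₀≋S₁) (⟦⟧-cong S₀≋S₁)
      squares (inj₂ S₀≋-S₁) = trans (*-cong Q₀ Q₀) (solve 1 (λ x → (:- :1) :* x :* ((:- :1) :* x) := x :* x)
          refl _)
        where
        Q₀ : Q w zero ≈ - 1# * Q w (suc zero)
        Q₀ = trans (⟦⟧-cong (λ a b → trans (S₀≋-S₁ a b) (solve 1 (λ x → :- x := (:- :1) :* x) refl _)))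
            (⟦⟧-⊙ Sign.- S₁ w)

-- Arithmetic of the triples and assembly of the equivalences.

module Equivalences {c ℓ₁ ℓ₂} (ℝ : Reals c ℓ₁ ℓ₂) where
  open RealFamily ℝ

  private triples = exceptionalTriples ℝ

  exceptional⇒dimension : ∀ {p q m} → (p , q , m) ∈ triples → m ℕ.+ 4 ≡ 2 ℕ.* (p ℕ.+ q) × 2 ℕ.≤ p
  exceptional⇒dimension (here ≡.refl) = ≡.refl , s≤s (s≤s z≤n)
  exceptional⇒dimension (there (here ≡.refl)) = ≡.refl , s≤s (s≤s z≤n)
  exceptional⇒dimension (there (there (here ≡.refl))) = ≡.refl , s≤s (s≤s z≤n)
  exceptional⇒dimension (there (there (there (here ≡.refl)))) = ≡.refl , s≤s (s≤s z≤n)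
  exceptional⇒dimension (there (there (there (there (here ≡.refl))))) = ≡.refl , s≤s (s≤s z≤n)
  exceptional⇒dimension (there (there (there (there (there (here ≡.refl)))))) = ≡.refl , s≤s (s≤s z≤n)
  exceptional⇒dimension (there (there (there (there (there (there (here ≡.refl))))))) = ≡.refl , s≤s (s≤s z≤n)

  -- There are 2 + p positive generators, or 4 + r in the last constraint, which is silent for p =
  -- 0, p = 1 and r = 1. Each surviving pair determines `m` through the dimension equation.
  dimension⇒exceptional : ∀ p q m → m ℕ.+ 4 ≡ 2 ℕ.* (2 ℕ.+ p ℕ.+ q) → (q ≢ 1 → 2 ℕ.+ p ≡ q) →
    (∀ r → p ≡ 2 ℕ.+ r → r ≢ 1 → r ≡ 4 ℕ.+ q) → (2 ℕ.+ p , q , m) ∈ triples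
  dimension⇒exceptional p q m dim p≡q p≡8+q with q ℕₚ.≟ 1
  dimension⇒exceptional 0 q m dim p≡q p≡8+q | yes ≡.refl with ℕₚ.+-cancelʳ-≡ 4 m 2 dim
  ... | ≡.refl = here ≡.refl
  dimension⇒exceptional 1 q m dim p≡q p≡8+q | yes ≡.refl with ℕₚ.+-cancelʳ-≡ 4 m 4 dim
  ... | ≡.refl = there (here ≡.refl)
  dimension⇒exceptional (suc (suc r)) q m dim p≡q p≡8+q | yes ≡.refl with r ℕₚ.≟ 1
  ... | yes ≡.refl with ℕₚ.+-cancelʳ-≡ 4 m 8 dim
  ...   | ≡.refl = there (there (here ≡.refl))
  dimension⇒exceptional (suc (suc r)) q m dim p≡q p≡8+q | yes ≡.refl | no r≢1 with p≡8+q r ≡.refl r≢1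
  ...   | ≡.refl with ℕₚ.+-cancelʳ-≡ 4 m 16 dim
  ...     | ≡.refl = there (there (there (here ≡.refl)))
  dimension⇒exceptional p q m dim p≡q p≡8+q | no q≢1 with p≡q q≢1
  dimension⇒exceptional 0 _ m dim p≡q p≡8+q | no q≢1 | ≡.refl with ℕₚ.+-cancelʳ-≡ 4 m 4 dim
  ... | ≡.refl = there (there (there (there (here ≡.refl))))
  dimension⇒exceptional 1 _ m dim p≡q p≡8+q | no q≢1 | ≡.refl with ℕₚ.+-cancelʳ-≡ 4 m 8 dim
  ... | ≡.refl = there (there (there (there (there (here ≡.refl)))))
  dimension⇒exceptional (suc (suc r)) _ m dim p≡q p≡8+q | no q≢1 | ≡.refl with r ℕₚ.≟ 1
  ... | yes ≡.refl with ℕₚ.+-cancelʳ-≡ 4 m 16 dim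
  ...   | ≡.refl = there (there (there (there (there (there (here ≡.refl))))))
  dimension⇒exceptional (suc (suc r)) _ m dim p≡q p≡8+q | no q≢1 | ≡.refl | no r≢1 =
    -- As q = 4 + r here, the fourfold constraint would read r = 8 + r.
    contradiction (p≡8+q r ≡.refl r≢1) (ℕₚ.m≢1+n+m r {7})

  module _ {q m p : ℕ} {S : Vector (Matrix m) (2 ℕ.+ p ℕ.+ q)} (F : IsCliffordFamily (signature (2 ℕ.+ p) q)
      S) where
    open Classification ℝ {q} {m}
    open TraceOrthogonality ℝ {q} {m} {p}

    linearRelation⇒exceptional : Fin m → HasLinearRelation ℝ (2 ℕ.+ p) q S → (2 ℕ.+ p , q , m) ∈ triples
    linearRelation⇒exceptional a relation = dimension⇒exceptional p q m dim
      (λ q≢1 → traceless⇒p≡q F a Φ≈0′ (traceless F (λ ()) q≢1))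
      (λ { r ≡.refl r≢1 → Fourfold.fourfold⇒p≡4+q ℝ F a r≢1 Φ≈0′ })
      where
      dim = defect⇒dimension F (trace-orthogonal F) (linearRelation⇒defect F (trace-orthogonal F) relation)
      Φ≈0′ = Φ≈0 F (trace-orthogonal F) dim

  -- The cases are split by trace orthogonality: vacuous for (1,0), possibly false for (1,1), and
  -- proved for p ≥ 2.
  conditions : ∀ p q {m} {S : Vector (Matrix m) (p ℕ.+ q)} → q ℕ.≤ p → 1 ℕ.≤ p ℕ.+ q → Fin m →
    IsCliffordFamily (signature p q) S →
    (HasLinearRelation ℝ p q S → Exceptional ℝ p q S) × (Exceptional ℝ p q S → QuarticVanishes ℝ p q S)
  conditions 1 0 {m} {S} _ _ a F = to , from
    where
    open Classification ℝ {0} {m}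
    orthogonal : ∀ {i k} → i ≢ k → tr (S i ∙ S k) ≈ 0#
    orthogonal {zero} {zero} 0≢0 = contradiction ≡.refl 0≢0
    to : HasLinearRelation ℝ 1 0 S → Exceptional ℝ 1 0 S
    -- With n = 1 the dimension equation reads m + 4 = 2.
    to relation with ≡.trans (ℕₚ.+-comm 4 m) (defect⇒dimension F orthogonal
        (linearRelation⇒defect F orthogonal relation))
    ... | ()
    from : Exceptional ℝ 1 0 S → QuarticVanishes ℝ 1 0 S
    from (inj₁ exceptional) with proj₂ (exceptional⇒dimension exceptional)
    ... | s≤s ()
    from (inj₂ (() , _))
  conditions 1 1 {m} {S} _ _ a F = (λ relation → inj₂ (linearRelation⇒equalUpToSign F relation)) , from
    where
    open SignatureOneOne ℝ {m}
    from : Exceptional ℝ 1 1 S → QuarticVanishes ℝ 1 1 S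
    from (inj₁ exceptional) with proj₂ (exceptional⇒dimension exceptional)
    ... | s≤s ()
    from (inj₂ equal) = quadric⇒QuarticVanishes ℝ {1} {1} F (equalUpToSign⇒quartic≈0 F equal)
  conditions 1 (suc (suc q)) (s≤s ()) _ _ _
  conditions (suc (suc p)) q {m} {S} _ _ a F = (λ relation → inj₁ (linearRelation⇒exceptional F a relation)) ,
      from
    where
    open Classification ℝ {q} {m}
    open TraceOrthogonality ℝ {q} {m} {p}
    from : Exceptional ℝ (2 ℕ.+ p) q S → QuarticVanishes ℝ (2 ℕ.+ p) q S
    from (inj₁ exceptional) = quadric⇒QuarticVanishes ℝ {2 ℕ.+ p} {q} F
      (dimension⇒quartic≈0 F (trace-orthogonal F) (proj₁ (exceptional⇒dimension exceptional)))
    from (inj₂ (() , _))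

open import Defs
open import Data.Nat.Base using (_+_; _≤_)

theorem2p7 : ∀ {c ℓ₁ ℓ₂} (ℝ : Reals c ℓ₁ ℓ₂) (p q m : ℕ) → q ≤ p → 1 ≤ p + q → 1 ≤ m →
    (φ : Representation ℝ p q m) →
    let S = Representation.basisMatrices φ in
    (∀ i → LinearAlgebra.Symmetric (Reals.rawRing ℝ) (S i)) →
    (Degenerate ℝ p q S ⇔ QuarticVanishes ℝ p q S) ×
    (QuarticVanishes ℝ p q S ⇔ HasLinearRelation ℝ p q S) ×
    (HasLinearRelation ℝ p q S ⇔ Exceptional ℝ p q S)
theorem2p7 ℝ p q m q≤p 1≤p+q 1≤m φ symS =
  mk⇔ (degenerate⇒quarticVanishes ℝ {p} {q} F) (quarticVanishes⇒degenerate ℝ {p} {q} F) ,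
  mk⇔ ii⇒iii (λ relation → iv⇒ii (iii⇒iv relation)) ,
  mk⇔ iii⇒iv (λ exceptional → ii⇒iii (iv⇒ii exceptional))
  where
  open Equivalences ℝ
  F = RepresentationFamily.isCliffordFamily ℝ {p} {q} φ symS
  ii⇒iii = λ vanishes → Classification.quartic≈0⇒linearRelation ℝ {q} {m} {p} F (fromℕ< 1≤p+q) (fromℕ< 1≤m)
      (QuarticVanishes⇒quadric ℝ {p} {q} F vanishes)
  iii⇒iv = proj₁ (conditions p q q≤p 1≤p+q (fromℕ< 1≤m) F)
  iv⇒ii  = proj₂ (conditions p q q≤p 1≤p+q (fromℕ< 1≤m) F)
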